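{- Let $\mathcal{L}:x+y-z=0$ be Schur's equation. There is an absolute constant $c>0$ such that for every real $\varepsilon\in(0,1]$, $d(\mathcal{L},\varepsilon)\ge c\varepsilon$, i.e. $d(\mathcal{L},\varepsilon)=\Omega(\varepsilon)$.
   Context: For a prime $p$, a set $A\subseteq\mathbb{F}_p$ is solution-free for $\mathcal{L}$ if there are no pairwise distinct $x,y,z\in A$ with $x+y-z=0$ in $\mathbb{F}_p$. The Cayley graph $\mathrm{Cay}_{\mathbb{F}_p}(A)$ is the digraph on $\mathbb{F}_p$ with an arc $\vec{uv}$ iff $v-u\in A$; $\alpha$ of a digraph is the independence number of its underlying undirected graph. $D(\mathcal{L},\varepsilon,p)$ is the maximum size of a solution-free set $A$ of $\mathcal{L}$ in $\mathbb{F}_p$ with $\alpha(\mathrm{Cay}_{\mathbb{F}_p}(A))\le\varepsilon p$, and $d(\mathcal{L},\varepsilon):=\limsup_{p\to\infty,\ p\text{ prime}} D(\mathcal{L},\varepsilon,p)/p$.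
   Formalization: The parameter ε ranges over the rationals in (0,1] rather than the reals (as does the slack in the unfolded limsup); the real case follows since d(L,ε) is nondecreasing in ε and the rationals are dense. -}

module Defs where

open import Data.Nat using (ℕ; _+_)
open import Data.Fin using (Fin; toℕ)
open import Data.Fin.Subset using (Subset; _∈_; ∣_∣)
open import Data.Integer using (+_)
open import Data.Rational using (ℚ; _/_; _≤_; _*_)
open import Data.Product using (Σ; _×_)
open import Data.Sum using (_⊎_)
open import Relation.Nullary using (¬_)
open import Relation.Binary.PropositionalEquality using (_≡_; _≢_)

ℕ→ℚ : ℕ → ℚ
ℕ→ℚ n = + n / 1

-- F_p is modelled as Fin p (residues 0..p-1).
-- AddEq p x y z  :⇔  x + y = z in ℤ/pℤ  (x + y < 2p, so the sum is z or z + p)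
AddEq : (p : ℕ) → Fin p → Fin p → Fin p → Set
AddEq p x y z = (toℕ x + toℕ y ≡ toℕ z) ⊎ (toℕ x + toℕ y ≡ toℕ z + p)

SolutionFree : (p : ℕ) → Subset p → Set
SolutionFree p A = ∀ x y z → x ∈ A → y ∈ A → z ∈ A →
  x ≢ y → x ≢ z → y ≢ z → ¬ AddEq p x y z

Arc : (p : ℕ) → Subset p → Fin p → Fin p → Set
Arc p A u v = Σ (Fin p) (λ a → (a ∈ A) × AddEq p u a v)

-- I is independent in the underlying undirected graph of Cay(A)
-- (loops ignored: only distinct vertices are compared; both directions are
-- covered since u, v range over ordered pairs).
Independent : (p : ℕ) → Subset p → Subset p → Set
Independent p A I = ∀ u v → u ∈ I → v ∈ I → u ≢ v → ¬ Arc p A u v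

AlphaLe : (p : ℕ) → Subset p → ℚ → Set
AlphaLe p A ε = ∀ I → Independent p A I → ℕ→ℚ ∣ I ∣ ≤ ε * ℕ→ℚ p

-- Let q be a prime of order 1/ε, h = ⌊q/6⌋, and let S ⊆ F_q³ consist of the points t (y, y², y³) with
-- 2h ≤ t < 4h and y ≠ 0.  Distinct points of the moment curve are linearly independent in threes and
-- [2h, 4h) is sum-free modulo q, so S is sum-free.  If X is independent in Cay(S), then the segments
-- x + [0, h) v and x + 3h v + [0, h) v, where v = (y, y², y³), never both meet X.  Hence |X ∩ segment|
-- has a large second moment in every direction y.  On the other hand the total of the variances over
-- all y is small: splitting functions on F_q³ along the linear forms ξ (Parseval) reduces this to
-- dilated progressions of length h on F_q with differences ξ(y, y², y³), and this cubic in y takes every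
-- value at most three times.  Together, |X| = O(q²) = O(|S|).
--
-- To pass to F_p with p much larger than q, points of F_q³ are written as the three leading digits,
-- widely spaced, of residues modulo p, and the digits below them are free.  The primes q in a dyadic
-- range come from Chebyshev's argument with least common multiples.
module Submission where

open import Defs
open import Data.Nat as ℕ using (ℕ; zero; suc; NonZero; z≤n; s≤s; _>_)
import Data.Nat.DivMod as ℕ
import Data.Nat.Properties as ℕ
open import Data.Nat.Primality using (Prime; prime⇒nonZero)
import Data.Nat.Tactic.RingSolver as ℕSolver
open import Data.Fin.Subset as Subset using (Subset)
open import Data.Product using (Σ; ∃; _×_; _,_; proj₁; proj₂)
open import Data.Sum using (_⊎_; inj₁; inj₂; [_,_]′)
open import Relation.Nullary using (Dec; does; yes; no; ¬_; contradiction)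
open import Relation.Nullary.Decidable using (dec-true; ¬?; _×-dec_)
open import Relation.Binary.PropositionalEquality using (_≡_; _≢_; refl; sym; trans; cong; cong₂; subst; subst₂; module ≡-Reasoning)

-- A set without any `x + y = z` is itself independent in its Cayley graph, so its size is at most
-- `α` and order `ε` is the most that can be hoped for: the bound on independent sets has to match
-- the size of `S`, about q²/3 out of q³, up to a constant. The decisive gain is a factor of two.
-- Two disjoint segments force the second moment of |X ∩ segment| to be at least twice the squared
-- mean, whereas in the upper bound the linear form ξ = 0 accounts for the squared mean only once;
-- the surplus is charged to the forms ξ ≠ 0, where the cubic spreads out. Sums over the planes ξ(x)
-- = s replace characters, and means and variances are multiplied by powers of q, so the whole
-- argument stays in ℤ. The obstacle in F_p is that reduction modulo p must not disturb congruences
-- modulo q. With p = ρ + P q and P the leading place value, k p amounts to k q in the leading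
-- digit, which vanishes modulo q, and to k ρ in the lowest digit, which has room for it. This room
-- exists because q depends on `ε` only while p grows. As constants are free, q is needed only up to
-- a bounded factor.

-- Chebyshev's argument: a prime between n/8 and n for n = 4^a

module PrimesInIntervals where
  open import Data.Nat
  open import Data.Nat.Combinatorics
  open import Data.Nat.Coprimality using (Coprime; coprime-divisor)
  open import Data.Nat.Divisibility
  open import Data.Nat.DivMod using (m/n*n≡m)
  open import Data.Nat.Induction using (<-rec)
  open import Data.Nat.ListAction using (product)
  open import Data.Nat.Primality using (euclidsLemma; prime?; prime⇒irreducible; prime⇒nonTrivial)
  open import Data.Nat.Primality.Factorisation using (factorise)
  open import Data.Nat.Properties
  open import Data.Nat.Tactic.RingSolver using (solve-∀)
  open import Data.List using ([]; _∷_)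
  open import Data.List.Relation.Unary.All using (_∷_)
  open import Data.Empty using (⊥-elim)

  C-absorb : ∀ n k → suc k * (suc n C suc k) ≡ suc n * (n C k)
  C-absorb zero zero = refl
  C-absorb zero (suc k) = trans (cong (suc (suc k) *_) (k>n⇒nCk≡0 {1} {suc (suc k)} (s≤s (s≤s z≤n))))
     (trans (*-zeroʳ (suc (suc k))) (sym (trans (cong (1 *_) (k>n⇒nCk≡0 {0} {suc k} (s≤s z≤n))) refl)))
  C-absorb (suc n) zero = trans (cong (1 *_) (nC1≡n (suc (suc n)))) (*-comm 1 (suc (suc n)))
  C-absorb (suc n) (suc k) = begin
    suc (suc k) * (suc (suc n) C suc (suc k))
      ≡⟨ cong (suc (suc k) *_) (sym (nCk+nC[k+1]≡[n+1]C[k+1] (suc n) (suc k))) ⟩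
    suc (suc k) * (u + (suc n C suc (suc k)))
      ≡⟨ *-distribˡ-+ (suc (suc k)) u _ ⟩
    (u + suc k * u) + suc (suc k) * (suc n C suc (suc k))
      ≡⟨ cong₂ (λ x y → (u + x) + y) (C-absorb n k) (C-absorb n (suc k)) ⟩
    (u + suc n * (n C k)) + suc n * (n C suc k)
      ≡⟨ trans (+-assoc u _ _) (cong (u +_) (sym (*-distribˡ-+ (suc n) (n C k) _))) ⟩
    u + suc n * (n C k + n C suc k)
      ≡⟨ cong (λ x → u + suc n * x) (nCk+nC[k+1]≡[n+1]C[k+1] n k) ⟩
    suc (suc n) * u ∎
    where
    open ≡-Reasoning
    u = suc n C suc k

  nCk>0 : ∀ {n k} → k ≤ n → 1 ≤ n C k
  nCk>0 {n} {zero} _ = ≤-reflexive (sym (trans (nCk≡nC[n∸k] {0} {n} z≤n) (nCn≡1 n)))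
  nCk>0 {suc n} {suc k} (s≤s k≤n) = ≤-trans (nCk>0 k≤n) (≤-trans (m≤m+n _ _) (≤-reflexive (nCk+nC[k+1]≡[n+1]C[k+1] n k)))

  -- The Leibniz harmonic triangle: the reciprocals of c, a, b satisfy 1/c = 1/a - 1/b.
  leibniz-∣ : ∀ {D} a b c .{{_ : NonZero (a * b)}} → b * c ≡ a * c + a * b → a ∣ D → b ∣ D → c ∣ D
  leibniz-∣ {D} a b c bc≡ (divides k D≡ka) (divides l D≡lb) =
    ∣m+n∣m⇒∣n (subst (c ∣_) eq (n∣m*n k)) (n∣m*n l)
    where
    open ≡-Reasoning
    eq : k * c ≡ l * c + D
    eq = *-cancelʳ-≡ (k * c) (l * c + D) (a * b) (begin
      k * c * (a * b)               ≡⟨ e₁ k c a b ⟩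
      k * a * (b * c)               ≡⟨ cong₂ _*_ (sym D≡ka) bc≡ ⟩
      D * (a * c + a * b)           ≡⟨ e₂ D a c b ⟩
      D * (a * c) + D * (a * b)     ≡⟨ cong (λ x → x * (a * c) + D * (a * b)) D≡lb ⟩
      l * b * (a * c) + D * (a * b) ≡⟨ e₃ l b a c D ⟩
      (l * c + D) * (a * b)         ∎)
      where
      e₁ : ∀ k c a b → k * c * (a * b) ≡ k * a * (b * c)
      e₁ = solve-∀
      e₂ : ∀ D a c b → D * (a * c + a * b) ≡ D * (a * c) + D * (a * b)
      e₂ = solve-∀
      e₃ : ∀ l b a c D → l * b * (a * c) + D * (a * b) ≡ (l * c + D) * (a * b)
      e₃ = solve-∀

  -- The numbers `suc k * (n C suc k)` are the reciprocals of the entries of row `n` of the harmonic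
  -- triangle. The first column consists of the integers themselves; every other entry follows by
  -- `leibniz-∣` from its left neighbour and from the entry above that neighbour.
  commonMultiple⇒kC∣ : ∀ {D} n k → (∀ i → 1 ≤ i → i ≤ n → i ∣ D) → k < n → suc k * (n C suc k) ∣ D
  commonMultiple⇒kC∣ {D} (suc n) zero mult _ =
    subst (_∣ D) (sym (trans (*-identityˡ _) (nC1≡n (suc n)))) (mult (suc n) (s≤s z≤n) ≤-refl)
  commonMultiple⇒kC∣ {D} (suc n) (suc k) mult (s≤s k<n) =
    leibniz-∣ a b c bc≡ (commonMultiple⇒kC∣ n k (λ i 1≤i i≤n → mult i 1≤i (m≤n⇒m≤1+n i≤n)) k<n)
      (commonMultiple⇒kC∣ (suc n) k mult (m≤n⇒m≤1+n k<n))
    where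
    open ≡-Reasoning
    x = n C k
    y = n C suc k
    a = suc k * y
    b = suc k * (suc n C suc k)
    c = suc (suc k) * (suc n C suc (suc k))
    instance
      y≢0 : NonZero y
      y≢0 = >-nonZero (nCk>0 k<n)
      z≢0 : NonZero (suc n C suc k)
      z≢0 = >-nonZero (nCk>0 (m≤n⇒m≤1+n k<n))
      a≢0 : NonZero a
      a≢0 = m*n≢0 (suc k) y
      b≢0 : NonZero b
      b≢0 = m*n≢0 (suc k) (suc n C suc k)
      ab≢0 : NonZero (a * b)
      ab≢0 = m*n≢0 a b
    b≡ : suc k * (x + y) ≡ suc n * x
    b≡ = trans (cong (suc k *_) (nCk+nC[k+1]≡[n+1]C[k+1] n k)) (C-absorb n k)
    bc≡ : b * c ≡ a * c + a * b
    bc≡ = begin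
      b * c                                          ≡⟨ cong₂ (λ u v → suc k * u * v) (sym (nCk+nC[k+1]≡[n+1]C[k+1] n k)) (C-absorb n (suc k)) ⟩
      suc k * (x + y) * (suc n * y)                  ≡⟨ e₁ (suc k) x y (suc n) ⟩
      suc k * y * (suc n * y) + suc k * y * (suc n * x)  ≡⟨ cong₂ (λ u v → suc k * y * u + suc k * y * v) (sym (C-absorb n (suc k))) (sym b≡) ⟩
      a * c + a * (suc k * (x + y))                  ≡⟨ cong (λ u → a * c + a * (suc k * u)) (nCk+nC[k+1]≡[n+1]C[k+1] n k) ⟩
      a * c + a * b                                  ∎
      where
      e₁ : ∀ k x y n → k * (x + y) * (n * y) ≡ k * y * (n * y) + k * y * (n * x)
      e₁ = solve-∀

  C≤2^n : ∀ n k → n C k ≤ 2 ^ n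
  C≤2^n zero zero = ≤-refl
  C≤2^n zero (suc k) = ≤-trans (≤-reflexive (k>n⇒nCk≡0 {0} {suc k} (s≤s z≤n))) z≤n
  C≤2^n (suc n) zero = ≤-trans (≤-reflexive (trans (nCk≡nC[n∸k] {0} {suc n} z≤n) (nCn≡1 (suc n)))) (m^n>0 2 (suc n))
  C≤2^n (suc n) (suc k) = begin
    suc n C suc k          ≡⟨ nCk+nC[k+1]≡[n+1]C[k+1] n k ⟨
    n C k + n C suc k      ≤⟨ +-mono-≤ (C≤2^n n k) (≤-trans (C≤2^n n (suc k)) (m≤m+n _ 0)) ⟩
    2 ^ suc n              ∎
    where open ≤-Reasoning

  -- Applying Pascal's rule twice finds two copies of the previous central coefficient, so each step
  -- at least doubles. This is weaker than the true growth 4^n, at the cost of a wider interval for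
  -- the prime.
  2^n≤[n+m]Cn : ∀ n m → n ≤ m → 2 ^ n ≤ (n + m) C n
  2^n≤[n+m]Cn zero m _ = nCk>0 {m} {0} z≤n
  2^n≤[n+m]Cn (suc n) (suc m) (s≤s n≤m) = begin
    2 ^ n + (2 ^ n + 0)          ≡⟨ cong (2 ^ n +_) (+-identityʳ _) ⟩
    2 ^ n + 2 ^ n                ≤⟨ +-mono-≤ (2^n≤[n+m]Cn n m n≤m) (2^n≤[n+m]Cn n m n≤m) ⟩
    N C n + N C n                ≤⟨ +-mono-≤ (C≤sucC n) (≤-trans (m≤m+n _ _) (≤-reflexive (nCk+nC[k+1]≡[n+1]C[k+1] N n))) ⟩
    suc N C n + suc N C suc n    ≡⟨ nCk+nC[k+1]≡[n+1]C[k+1] (suc N) n ⟩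
    suc (suc N) C suc n          ≡⟨ cong (λ x → suc x C suc n) (+-suc n m) ⟨
    (suc n + suc m) C suc n      ∎
    where
    open ≤-Reasoning
    N = n + m
    C≤sucC : ∀ k → N C k ≤ suc N C k
    C≤sucC zero = ≤-reflexive (trans (nCk≡nC[n∸k] {0} {N} z≤n) (trans (nCn≡1 N) (sym (trans (nCk≡nC[n∸k] {0} {suc N} z≤n) (nCn≡1 (suc N))))))
    C≤sucC (suc k) = ≤-trans (m≤n+m _ _) (≤-reflexive (nCk+nC[k+1]≡[n+1]C[k+1] N k))

  prime>1 : ∀ {p} → Prime p → 1 < p
  prime>1 p-prime = nonTrivial⇒n>1 _ {{prime⇒nonTrivial p-prime}}

  prime∤1 : ∀ {p} → Prime p → ¬ p ∣ 1
  prime∤1 p-prime p∣1 = <⇒≱ (prime>1 p-prime) (∣⇒≤ p∣1)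

  prime∣n!⇒≤ : ∀ {p} n → Prime p → p ∣ n ! → p ≤ n
  prime∣n!⇒≤ zero p-prime p∣ = ⊥-elim (prime∤1 p-prime p∣)
  prime∣n!⇒≤ (suc n) p-prime p∣ with euclidsLemma (suc n) (n !) p-prime p∣
  ... | inj₁ p∣sn = ∣⇒≤ p∣sn
  ... | inj₂ p∣n! = m≤n⇒m≤1+n (prime∣n!⇒≤ n p-prime p∣n!)

  i≤n⇒i∣n! : ∀ {i} n → 1 ≤ i → i ≤ n → i ∣ n !
  i≤n⇒i∣n! zero 1≤i i≤0 = ⊥-elim (<⇒≱ 1≤i i≤0)
  i≤n⇒i∣n! (suc n) 1≤i i≤sn with m≤n⇒m<n∨m≡n i≤sn
  ... | inj₁ (s≤s i≤n) = ∣n⇒∣m*n (suc n) (i≤n⇒i∣n! n 1≤i i≤n)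
  ... | inj₂ refl = m∣m*n (n !)

  prime∣centralBinomial : ∀ {p} n → Prime p → n < p → p ≤ n + n → p ∣ (n + n) C n
  prime∣centralBinomial {p} n p-prime n<p p≤2n with euclidsLemma ((n + n) C n) (n ! * n !) p-prime
      (subst (p ∣_) (sym eq) (i≤n⇒i∣n! (n + n) (<⇒≤ (prime>1 p-prime)) p≤2n))
    where
    eq : ((n + n) C n) * (n ! * n !) ≡ (n + n) !
    eq = begin
      ((n + n) C n) * (n ! * n !)               ≡⟨ cong (λ x → ((n + n) C n) * (n ! * x !)) (m+n∸n≡m n n) ⟨
      ((n + n) C n) * (n ! * (n + n ∸ n) !)     ≡⟨ cong (_* (n ! * (n + n ∸ n) !)) (nCk≡n!/k![n-k]! (m≤m+n n n)) ⟩
      _                                         ≡⟨ m/n*n≡m (k![n∸k]!∣n! (m≤m+n n n)) ⟩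
      (n + n) !                                 ∎
      where
      open ≡-Reasoning
      instance _ = n !* (n + n ∸ n) !≢0
  ... | inj₁ d = d
  ... | inj₂ d = ⊥-elim (<⇒≱ n<p ([ prime∣n!⇒≤ n p-prime , prime∣n!⇒≤ n p-prime ]′ (euclidsLemma (n !) (n !) p-prime d)))

  ∃primeFactor : ∀ n → 1 < n → ∃ λ p → Prime p × p ∣ n
  ∃primeFactor n 1<n with factorise n {{>-nonZero (<⇒≤ 1<n)}}
  ... | record { factors = [] ; isFactorisation = eq } = ⊥-elim (<-irrefl (sym eq) 1<n)
  ... | record { factors = p ∷ ps ; isFactorisation = eq ; factorsPrime = p-prime ∷ _ } =
    p , p-prime , subst (p ∣_) (sym eq) (m∣m*n (product ps))

  prime∣^⇒∣ : ∀ {p} m e → Prime p → p ∣ m ^ e → p ∣ m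
  prime∣^⇒∣ m zero p-prime p∣1 = ⊥-elim (prime∤1 p-prime p∣1)
  prime∣^⇒∣ m (suc e) p-prime p∣ = [ (λ p∣m → p∣m) , prime∣^⇒∣ m e p-prime ]′ (euclidsLemma m (m ^ e) p-prime p∣)

  prime∣prime⇒≡ : ∀ {p r} → Prime p → Prime r → p ∣ r → p ≡ r
  prime∣prime⇒≡ p-prime r-prime p∣r with prime⇒irreducible r-prime p∣r
  ... | inj₁ refl = ⊥-elim (<-irrefl refl (prime>1 p-prime))
  ... | inj₂ p≡r = p≡r

  distinctPrimes⇒coprime : ∀ {p r} e → Prime p → Prime r → r ≢ p → Coprime (r ^ e) p
  distinctPrimes⇒coprime {p} {r} e p-prime r-prime r≢p (d∣r^e , d∣p) with prime⇒irreducible p-prime d∣p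
  ... | inj₁ d≡1 = d≡1
  ... | inj₂ refl = ⊥-elim (r≢p (sym (prime∣prime⇒≡ p-prime r-prime (prime∣^⇒∣ r e p-prime d∣r^e))))

  -- Strong induction, cancelling one prime factor `p` from both `i` and `D`. The hypothesis
  -- survives: for powers of `p` the exponent shifts by one, and powers of another prime are coprime
  -- to the cancelled `p`.
  primePowers∣⇒∣ : ∀ i D → 1 ≤ i → (∀ p e → Prime p → p ^ e ∣ i → p ^ e ∣ D) → i ∣ D
  primePowers∣⇒∣ = <-rec (λ i → ∀ D → 1 ≤ i → (∀ p e → Prime p → p ^ e ∣ i → p ^ e ∣ D) → i ∣ D) step
    where
    step : ∀ i → (∀ {j} → j < i → ∀ D → 1 ≤ j → (∀ p e → Prime p → p ^ e ∣ j → p ^ e ∣ D) → j ∣ D) →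
           ∀ D → 1 ≤ i → (∀ p e → Prime p → p ^ e ∣ i → p ^ e ∣ D) → i ∣ D
    step 1 rec D _ _ = 1∣ D
    step i@(suc (suc _)) rec D 1≤i hyp with ∃primeFactor i (s≤s (s≤s z≤n))
    ... | p , p-prime , divides zero ()
    ... | p , p-prime , divides j@(suc _) i≡j*p with subst (_∣ D) (*-identityʳ p) (hyp p 1 p-prime (divides j (trans i≡j*p (cong (j *_) (sym (*-identityʳ p))))))
    ... | divides D′ D≡D′*p = subst₂ _∣_ (sym i≡j*p) (sym D≡D′*p) (*-monoˡ-∣ p (rec j<i D′ (s≤s z≤n) hyp′))
      where
      instance
        p≢0 : NonZero p
        p≢0 = prime⇒nonZero p-prime
      j<i : j < i
      j<i = subst (j <_) (sym i≡j*p) (m<m*n j p (prime>1 p-prime))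
      hyp′ : ∀ r e → Prime r → r ^ e ∣ j → r ^ e ∣ D′
      hyp′ r e r-prime r^e∣j with r ≟ p
      ... | yes refl = *-cancelˡ-∣ p (subst (p * p ^ e ∣_) (trans D≡D′*p (*-comm D′ p))
                         (hyp p (suc e) p-prime (subst (p * p ^ e ∣_) (trans (*-comm p j) (sym i≡j*p)) (*-monoʳ-∣ p r^e∣j))))
      ... | no r≢p = coprime-divisor (distinctPrimes⇒coprime e p-prime r-prime r≢p)
                       (subst (r ^ e ∣_) (trans D≡D′*p (*-comm D′ p)) (hyp r e r-prime (subst (r ^ e ∣_) (sym i≡j*p) (∣m⇒∣m*n p r^e∣j))))

  -- A substitute for the product of all primes up to 2^k: the coefficient C(2^(i+1), 2^i) contains
  -- every prime of the dyadic block from 2^i to 2^(i+1), and the sizes of the blocks form a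
  -- geometric series, which keeps the product below 2^(2^(k+1)).
  centralBinomials : ℕ → ℕ
  centralBinomials zero = 1
  centralBinomials (suc k) = ((2 ^ k + 2 ^ k) C (2 ^ k)) * centralBinomials k

  2^suc : ∀ k → 2 ^ suc k ≡ 2 ^ k + 2 ^ k
  2^suc k = cong (2 ^ k +_) (+-identityʳ (2 ^ k))

  prime∣centralBinomials : ∀ {p} k → Prime p → p ≤ 2 ^ k → p ∣ centralBinomials k
  prime∣centralBinomials zero p-prime p≤1 = ⊥-elim (<⇒≱ (prime>1 p-prime) p≤1)
  prime∣centralBinomials {p} (suc k) p-prime p≤ with p ≤? 2 ^ k
  ... | yes p≤2^k = ∣n⇒∣m*n ((2 ^ k + 2 ^ k) C (2 ^ k)) (prime∣centralBinomials k p-prime p≤2^k)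
  ... | no p≰2^k = ∣m⇒∣m*n (centralBinomials k)
                     (prime∣centralBinomial (2 ^ k) p-prime (≰⇒> p≰2^k) (subst (p ≤_) (2^suc k) p≤))

  centralBinomials>0 : ∀ k → 0 < centralBinomials k
  centralBinomials>0 zero = s≤s z≤n
  centralBinomials>0 (suc k) = *-mono-≤ (nCk>0 (m≤m+n (2 ^ k) (2 ^ k))) (centralBinomials>0 k)

  centralBinomials≤ : ∀ k → centralBinomials k ≤ 2 ^ (2 ^ k + 2 ^ k)
  centralBinomials≤ zero = s≤s z≤n
  centralBinomials≤ (suc k) = begin
    ((N C (2 ^ k)) * centralBinomials k)  ≤⟨ *-mono-≤ (C≤2^n N (2 ^ k)) (centralBinomials≤ k) ⟩
    2 ^ N * 2 ^ N                         ≡⟨ ^-distribˡ-+-* 2 N N ⟨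
    2 ^ (N + N)                           ≡⟨ cong (λ x → 2 ^ (x + x)) (2^suc k) ⟨
    2 ^ (2 ^ suc k + 2 ^ suc k)           ∎
    where
    open ≤-Reasoning
    N = 2 ^ k + 2 ^ k

  n!≤m^n : ∀ m n → n ≤ m → n ! ≤ m ^ n
  n!≤m^n m zero _ = ≤-refl
  n!≤m^n m (suc n) n<m = *-mono-≤ n<m (n!≤m^n m n (<⇒≤ n<m))

  ∣-^ : ∀ {m n} e → m ∣ n → m ^ e ∣ n ^ e
  ∣-^ zero _ = ∣-refl
  ∣-^ (suc e) m∣n = *-pres-∣ m∣n (∣-^ e m∣n)

  ^-∣ : ∀ m {e f} → e ≤ f → m ^ e ∣ m ^ f
  ^-∣ m {e} {f} e≤f = subst (m ^ e ∣_) (trans (sym (^-distribˡ-+-* m e (f ∸ e))) (cong (m ^_) (m+[n∸m]≡n e≤f))) (m∣m*n (m ^ (f ∸ e)))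

  ^-cancel-≤ : ∀ b e f → b > 1 → b ^ e ≤ b ^ f → e ≤ f
  ^-cancel-≤ b e f b>1 b^e≤b^f with e ≤? f
  ... | yes e≤f = e≤f
  ... | no e≰f = ⊥-elim (<⇒≱ (^-monoʳ-< b b>1 (≰⇒> e≰f)) b^e≤b^f)

  -- This is what makes the factor (2^a)!^(2a), which is at most 2^(2 a² 2^a), smaller than 2^(2 K)
  -- with K = 4^a / 8. The inequality fails at 9, hence the threshold 10.
  8a²<2^a : ∀ b → 8 * ((10 + b) * (10 + b)) < 2 ^ (10 + b)
  8a²<2^a zero = ≤ᵇ⇒≤ 801 1024 _
  8a²<2^a (suc b) = begin-strict
    8 * ((11 + b) * (11 + b))                                 ≤⟨ m≤m+n _ (8 * (b * b + 18 * b + 79)) ⟩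
    8 * ((11 + b) * (11 + b)) + 8 * (b * b + 18 * b + 79)     ≡⟨ eq b ⟩
    2 * (8 * ((10 + b) * (10 + b)))                           <⟨ *-monoʳ-< 2 (8a²<2^a b) ⟩
    2 * 2 ^ (10 + b)                                          ∎
    where
    open ≤-Reasoning
    eq : ∀ b → 8 * ((11 + b) * (11 + b)) + 8 * (b * b + 18 * b + 79) ≡ 2 * (8 * ((10 + b) * (10 + b)))
    eq = solve-∀

  -- If there were no such prime, then every number up to n = 4^a would divide
  -- D = (2^a)!^(2a) ∏_{i<k} C(2^(i+1), 2^i): primes up to 2^a occur in it at most to the power 2a,
  -- larger ones at most once.  But then 2^(n/2) ≤ C(n, n/2) ≤ D < 2^(n/2).
  ∃prime : ∀ a k → 10 ≤ a → k + 3 ≡ a + a → ∃ λ q → Prime q × 2 ^ k < q × q ≤ 2 ^ (a + a)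
  ∃prime a k 10≤a k+3≡2a with anyUpTo? (λ q → prime? q ×-dec (2 ^ k <? q)) (suc (2 ^ (a + a)))
  ... | yes (q , s≤s q≤ , q-prime , <q) = q , q-prime , <q , q≤
  ... | no none = ⊥-elim (<⇒≱ D<2^m (≤-trans (2^n≤[n+m]Cn m m ≤-refl) (≤-trans (m≤n*m _ m {{m≢0}}) (∣⇒≤ {{D≢0}} mC∣D))))
    where
    -- Here m = 4 K and n = 2 m = 8 K. Each of the two factors of `D` contributes at most 2 K to the
    -- exponent of 2, the first strictly less, so `D` stays below 2^(4 K); this fixes the relation
    -- `k + 3 ≡ a + a`.
    m = 2 ^ (2 + k)
    n = 2 ^ (a + a)
    K = 2 ^ k
    F = ((2 ^ a) !) ^ (a + a)
    D = F * centralBinomials k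
    D≢0 : NonZero D
    D≢0 = m*n≢0 F (centralBinomials k) {{m^n≢0 ((2 ^ a) !) (a + a) {{(2 ^ a) !≢0}}}} {{>-nonZero (centralBinomials>0 k)}}
    m≢0 : NonZero m
    m≢0 = m^n≢0 2 (2 + k)
    n≡ : n ≡ m + m
    n≡ = trans (cong (2 ^_) (trans (sym k+3≡2a) (+-comm k 3))) (2^suc (2 + k))
    n≡′ : 2 ^ a * 2 ^ a ≡ 8 * K
    n≡′ = trans (sym (^-distribˡ-+-* 2 a a)) (trans (cong (2 ^_) (sym k+3≡2a)) (trans (^-distribˡ-+-* 2 k 3) (*-comm K 8)))
    prime≤n⇒≤K : ∀ p → Prime p → p ≤ n → p ≤ K
    prime≤n⇒≤K p p-prime p≤n with p ≤? K
    ... | yes p≤K = p≤K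
    ... | no p≰K = ⊥-elim (none (p , s≤s p≤n , p-prime , ≰⇒> p≰K))
    primePower∣D : ∀ i → 1 ≤ i → i ≤ n → ∀ p e → Prime p → p ^ e ∣ i → p ^ e ∣ D
    primePower∣D i 1≤i i≤n p e p-prime p^e∣i with p ≤? 2 ^ a
    ... | yes p≤2^a = ∣m⇒∣m*n (centralBinomials k) (∣-trans (^-∣ p e≤2a) (∣-^ (a + a) (i≤n⇒i∣n! (2 ^ a) (<⇒≤ (prime>1 p-prime)) p≤2^a)))
      where
      e≤2a : e ≤ a + a
      e≤2a = ^-cancel-≤ 2 e (a + a) (s≤s (s≤s z≤n)) (≤-trans (^-monoˡ-≤ e (prime>1 p-prime)) (≤-trans (∣⇒≤ {{>-nonZero 1≤i}} p^e∣i) i≤n))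
    ... | no p≰2^a = large e p^e∣i
      where
      2^a<p = ≰⇒> p≰2^a
      large : ∀ e → p ^ e ∣ i → p ^ e ∣ D
      large zero _ = 1∣ D
      large 1 p∣i = subst (_∣ D) (sym (*-identityʳ p)) (∣n⇒∣m*n F (prime∣centralBinomials k p-prime
        (prime≤n⇒≤K p p-prime (≤-trans (∣⇒≤ {{>-nonZero 1≤i}} (subst (_∣ i) (*-identityʳ p) p∣i)) i≤n))))
      large (suc (suc e)) p^e∣i = ⊥-elim (<⇒≱ (subst (_< p * p) (sym (^-distribˡ-+-* 2 a a)) (*-mono-< 2^a<p 2^a<p))
        (≤-trans (∣⇒≤ {{>-nonZero 1≤i}} (∣-trans (subst (_∣ p ^ suc (suc e)) (cong (p *_) (*-identityʳ p)) (^-∣ p {2} {suc (suc e)} (s≤s (s≤s z≤n)))) p^e∣i)) i≤n))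
    mC∣D : m * ((m + m) C m) ∣ D
    mC∣D = subst (λ x → x * ((m + m) C x) ∣ D) (suc-pred m {{m≢0}})
      (commonMultiple⇒kC∣ (m + m) (pred m)
        (λ i 1≤i i≤ → primePowers∣⇒∣ i D 1≤i (primePower∣D i 1≤i (subst (i ≤_) (sym n≡) i≤)))
        (subst (_≤ m + m) (sym (suc-pred m {{m≢0}})) (m≤m+n m m)))
    exponent< : a * 2 ^ a * (a + a) < K + K
    exponent< = *-cancelˡ-< 8 _ _ (begin-strict
      8 * (a * 2 ^ a * (a + a))       ≡⟨ e₁ a (2 ^ a) ⟩
      8 * (a * a) * (2 ^ a + 2 ^ a)   <⟨ *-monoˡ-< (2 ^ a + 2 ^ a) {{>-nonZero (≤-trans (m^n>0 2 a) (m≤m+n _ _))}}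
                                          (subst (λ x → 8 * (x * x) < 2 ^ x) (m+[n∸m]≡n 10≤a) (8a²<2^a (a ∸ 10))) ⟩
      2 ^ a * (2 ^ a + 2 ^ a)         ≡⟨ *-distribˡ-+ (2 ^ a) _ _ ⟩
      2 ^ a * 2 ^ a + 2 ^ a * 2 ^ a   ≡⟨ cong (λ x → x + x) n≡′ ⟩
      8 * K + 8 * K                   ≡⟨ *-distribˡ-+ 8 K K ⟨
      8 * (K + K)                     ∎)
      where
      open ≤-Reasoning
      e₁ : ∀ a b → 8 * (a * b * (a + a)) ≡ 8 * (a * a) * (b + b)
      e₁ = solve-∀
    D<2^m : D < 2 ^ m
    D<2^m = begin-strict
      F * centralBinomials k                       ≤⟨ *-mono-≤ (^-monoˡ-≤ (a + a) (n!≤m^n (2 ^ a) (2 ^ a) ≤-refl)) (centralBinomials≤ k) ⟩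
      ((2 ^ a) ^ (2 ^ a)) ^ (a + a) * 2 ^ (K + K)  ≡⟨ cong (_* 2 ^ (K + K)) (trans (cong (_^ (a + a)) (^-*-assoc 2 a (2 ^ a))) (^-*-assoc 2 (a * 2 ^ a) (a + a))) ⟩
      2 ^ (a * 2 ^ a * (a + a)) * 2 ^ (K + K)      ≡⟨ ^-distribˡ-+-* 2 (a * 2 ^ a * (a + a)) (K + K) ⟨
      2 ^ (a * 2 ^ a * (a + a) + (K + K))          <⟨ ^-monoʳ-< 2 (s≤s (s≤s z≤n)) (+-monoˡ-< (K + K) exponent<) ⟩
      2 ^ (K + K + (K + K))                        ≡⟨ cong (2 ^_) (trans (cong₂ _+_ (sym (2^suc k)) (sym (2^suc k))) (sym (2^suc (suc k)))) ⟩
      2 ^ m                                        ∎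
      where open ≤-Reasoning

open PrimesInIntervals using (prime>1; 2^suc; ∃prime)

module CayleyGraphs where
  open import Algebra.Bundles using (CommutativeRing)
  import Algebra.Solver.Ring
  open import Algebra.Solver.Ring.AlmostCommutativeRing using (fromCommutativeRing; _-Raw-AlmostCommutative⟶_)
  open import Data.Fin as Fin using (Fin; zero; suc; toℕ; fromℕ<)
  import Data.Fin.Properties as Fin
  open import Data.Fin.Subset using (_∈_)
  open import Data.Fin.Subset.Properties using (_∈?_; x∈p⇒∣p-x∣<∣p∣; x∈p∧x≢y⇒x∈p-y; drop-there)
  open import Data.Bool using (true; false)
  open import Data.Integer as ℤ using (ℤ; +_; -[1+_]; +[1+_]; _+_; _*_; -_; _-_; 0ℤ; 1ℤ; _≤_; +≤+; ∣_∣; _/ℕ_)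
  open import Data.Integer.DivMod using (n%ℕd<d; a≡a%ℕn+[a/ℕn]*n)
  import Data.Integer.Properties as ℤ
  import Data.Integer.Tactic.RingSolver as ℤ
  open import Data.List using (List; []; _∷_; length; filter; allFin; _++_; map; cartesianProduct)
  import Data.List as List
  import Data.List.Properties as List
  open import Data.List.Relation.Unary.All using (All; []; _∷_)
  open import Data.List.Relation.Unary.All.Properties using (all-filter)
  open import Data.List.Relation.Unary.AllPairs using ([]; _∷_)
  open import Data.List.Relation.Unary.Unique.Propositional using (Unique)
  open import Data.List.Relation.Unary.Unique.Propositional.Properties using (allFin⁺; filter⁺)
  open import Data.Maybe using (Maybe; just; nothing)
  open import Data.Nat.Coprimality using (prime⇒coprime; coprime-Bézout)
  open import Data.Nat.GCD using (module Bézout)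
  open import Data.Product.Properties using (≡-dec)
  open import Data.Vec using ([]; _∷_; tabulate; there)
  import Data.Vec.Properties as Vec
  open import Function using (_∘_)
  open import Level using (0ℓ)
  open import Relation.Binary.Definitions using (DecidableEquality)
  open import Relation.Binary.PropositionalEquality using (isEquivalence)
  open import Relation.Unary using (Decidable)

  -- Residues modulo n as a commutative ring

  i+kn≡j⇒i≡j : ∀ {n i j} k → i ℕ.< n → j ℕ.< n → + i ≡ + j + k * + n → i ≡ j
  i+kn≡j⇒i≡j {n} {i} {j} (+ zero) _ _ eq = ℤ.+-injective (trans eq (ℤ.+-identityʳ (+ j)))
  i+kn≡j⇒i≡j {n} {i} {j} +[1+ k ] i<n _ eq = contradiction i<n (ℕ.≤⇒≯ (begin
    n                   ≤⟨ ℕ.m≤m+n n (k ℕ.* n) ⟩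
    suc k ℕ.* n         ≤⟨ ℕ.m≤n+m (suc k ℕ.* n) j ⟩
    j ℕ.+ suc k ℕ.* n   ≡⟨ ℤ.+-injective (trans eq (cong (λ x → + j + x) (sym (ℤ.pos-* (suc k) n)))) ⟨
    i                   ∎))
    where open ℕ.≤-Reasoning
  i+kn≡j⇒i≡j {n} {i} {j} -[1+ k ] i<n j<n eq =
    sym (i+kn≡j⇒i≡j +[1+ k ] j<n i<n (trans (e (+ j) -[1+ k ] (+ n)) (cong (_+ +[1+ k ] * + n) (sym eq))))
    where
    e : ∀ j k n → j ≡ j + k * n + - k * n
    e = ℤ.solve-∀

  module Residues (n : ℕ) .{{n≢0 : NonZero n}} where

    infix 4 _≋_

    _≋_ : ℤ → ℤ → Set
    a ≋ b = ∃ λ k → a ≡ b + k * + n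

    F : Set
    F = Fin n

    ι : F → ℤ
    ι x = + toℕ x

    abstract
      π : ℤ → F
      π a = fromℕ< (n%ℕd<d a n)

      ι-π : ∀ a → a ≋ ι (π a)
      ι-π a = a /ℕ n , trans (a≡a%ℕn+[a/ℕn]*n a n) (cong (λ r → + r + (a /ℕ n) * + n) (sym (Fin.toℕ-fromℕ< (n%ℕd<d a n))))

    π-injective : ∀ {a b} → π a ≡ π b → a ≋ b
    π-injective {a} {b} eq with ι-π a | ι-π b
    ... | k , a≡ | l , b≡ = k - l , (begin
      a                                 ≡⟨ a≡ ⟩
      ι (π a) + k * + n                 ≡⟨ cong (λ x → ι x + k * + n) eq ⟩
      ι (π b) + k * + n                 ≡⟨ e (ι (π b)) k l (+ n) ⟩
      ι (π b) + l * + n + (k - l) * + n ≡⟨ cong (_+ (k - l) * + n) b≡ ⟨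
      b + (k - l) * + n                 ∎)
      where
      open ≡-Reasoning
      e : ∀ r k l n → r + k * n ≡ r + l * n + (k - l) * n
      e = ℤ.solve-∀

    ι-≋⇒≡ : ∀ {x y} → ι x ≋ ι y → x ≡ y
    ι-≋⇒≡ {x} {y} (k , eq) = Fin.toℕ-injective (i+kn≡j⇒i≡j k (Fin.toℕ<n x) (Fin.toℕ<n y) eq)

    π-cong : ∀ {a b} → a ≋ b → π a ≡ π b
    π-cong {a} {b} (m , a≡b) with ι-π a | ι-π b
    ... | k , a≡ | l , b≡ = ι-≋⇒≡ (m + l - k , (begin
      ι (π a)                             ≡⟨ e₁ (ι (π a)) k (+ n) ⟩
      ι (π a) + k * + n - k * + n         ≡⟨ cong (_- k * + n) (trans (sym a≡) a≡b) ⟩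
      b + m * + n - k * + n               ≡⟨ cong (λ x → x + m * + n - k * + n) b≡ ⟩
      ι (π b) + l * + n + m * + n - k * + n  ≡⟨ e₂ (ι (π b)) l m k (+ n) ⟩
      ι (π b) + (m + l - k) * + n         ∎))
      where
      open ≡-Reasoning
      e₁ : ∀ r k n → r ≡ r + k * n - k * n
      e₁ = ℤ.solve-∀
      e₂ : ∀ r l m k n → r + l * n + m * n - k * n ≡ r + (m + l - k) * n
      e₂ = ℤ.solve-∀

    π-ι : ∀ x → π (ι x) ≡ x
    π-ι x with ι-π (ι x)
    ... | k , eq = sym (ι-≋⇒≡ (k , eq))

    infixl 6 _⊕_
    infixl 7 _⊗_
    infix  8 ⊖_

    abstract
      _⊕_ _⊗_ : F → F → F
      x ⊕ y = π (ι x + ι y)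
      x ⊗ y = π (ι x * ι y)

      ⊖_ : F → F
      ⊖ x = π (- ι x)

      π-+ : ∀ a b → π (a + b) ≡ π a ⊕ π b
      π-+ a b with ι-π a | ι-π b
      ... | k , a≡ | l , b≡ = π-cong {a + b} {ι (π a) + ι (π b)} (k + l , trans (cong₂ _+_ a≡ b≡) (e (ι (π a)) (ι (π b)) k l (+ n)))
        where
        e : ∀ x y k l n → (x + k * n) + (y + l * n) ≡ x + y + (k + l) * n
        e = ℤ.solve-∀

      π-* : ∀ a b → π (a * b) ≡ π a ⊗ π b
      π-* a b with ι-π a | ι-π b
      ... | k , a≡ | l , b≡ = π-cong {a * b} {ι (π a) * ι (π b)} (ι (π a) * l + k * ι (π b) + k * l * + n , trans (cong₂ _*_ a≡ b≡) (e (ι (π a)) (ι (π b)) k l (+ n)))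
        where
        e : ∀ x y k l n → (x + k * n) * (y + l * n) ≡ x * y + (x * l + k * y + k * l * n) * n
        e = ℤ.solve-∀

      π-neg : ∀ a → π (- a) ≡ ⊖ π a
      π-neg a with ι-π a
      ... | k , a≡ = π-cong { - a} { - ι (π a)} (- k , trans (cong -_ a≡) (e (ι (π a)) k (+ n)))
        where
        e : ∀ x k n → - (x + k * n) ≡ - x + - k * n
        e = ℤ.solve-∀

    0F 1F : F
    0F = π 0ℤ
    1F = π 1ℤ

    private
      ⊕-assoc : ∀ x y z → (x ⊕ y) ⊕ z ≡ x ⊕ (y ⊕ z)
      ⊕-assoc x y z = subst₂ (λ x y → (x ⊕ y) ⊕ z ≡ x ⊕ (y ⊕ z)) (π-ι x) (π-ι y)
        (subst (λ z → (π a ⊕ π b) ⊕ z ≡ π a ⊕ (π b ⊕ z)) (π-ι z) (begin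
          (π a ⊕ π b) ⊕ π c ≡⟨ cong (_⊕ π c) (π-+ a b) ⟨
          π (a + b) ⊕ π c   ≡⟨ π-+ (a + b) c ⟨
          π ((a + b) + c)   ≡⟨ cong π (ℤ.+-assoc a b c) ⟩
          π (a + (b + c))   ≡⟨ π-+ a (b + c) ⟩
          π a ⊕ π (b + c)   ≡⟨ cong (π a ⊕_) (π-+ b c) ⟩
          π a ⊕ (π b ⊕ π c) ∎))
        where
        open ≡-Reasoning
        a = ι x; b = ι y; c = ι z

      ⊗-assoc : ∀ x y z → (x ⊗ y) ⊗ z ≡ x ⊗ (y ⊗ z)
      ⊗-assoc x y z = subst₂ (λ x y → (x ⊗ y) ⊗ z ≡ x ⊗ (y ⊗ z)) (π-ι x) (π-ι y)
        (subst (λ z → (π a ⊗ π b) ⊗ z ≡ π a ⊗ (π b ⊗ z)) (π-ι z) (begin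
          (π a ⊗ π b) ⊗ π c ≡⟨ cong (_⊗ π c) (π-* a b) ⟨
          π (a * b) ⊗ π c   ≡⟨ π-* (a * b) c ⟨
          π ((a * b) * c)   ≡⟨ cong π (ℤ.*-assoc a b c) ⟩
          π (a * (b * c))   ≡⟨ π-* a (b * c) ⟩
          π a ⊗ π (b * c)   ≡⟨ cong (π a ⊗_) (π-* b c) ⟩
          π a ⊗ (π b ⊗ π c) ∎))
        where
        open ≡-Reasoning
        a = ι x; b = ι y; c = ι z

      ⊗-distribˡ-⊕ : ∀ x y z → x ⊗ (y ⊕ z) ≡ x ⊗ y ⊕ x ⊗ z
      ⊗-distribˡ-⊕ x y z = subst₂ (λ x y → x ⊗ (y ⊕ z) ≡ x ⊗ y ⊕ x ⊗ z) (π-ι x) (π-ι y)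
        (subst (λ z → π a ⊗ (π b ⊕ z) ≡ π a ⊗ π b ⊕ π a ⊗ z) (π-ι z) (begin
          π a ⊗ (π b ⊕ π c)         ≡⟨ cong (π a ⊗_) (π-+ b c) ⟨
          π a ⊗ π (b + c)           ≡⟨ π-* a (b + c) ⟨
          π (a * (b + c))           ≡⟨ cong π (ℤ.*-distribˡ-+ a b c) ⟩
          π (a * b + a * c)         ≡⟨ π-+ (a * b) (a * c) ⟩
          π (a * b) ⊕ π (a * c)     ≡⟨ cong₂ _⊕_ (π-* a b) (π-* a c) ⟩
          π a ⊗ π b ⊕ π a ⊗ π c     ∎))
        where
        open ≡-Reasoning
        a = ι x; b = ι y; c = ι z

      ⊕-comm : ∀ x y → x ⊕ y ≡ y ⊕ x
      ⊕-comm x y = subst₂ (λ x y → x ⊕ y ≡ y ⊕ x) (π-ι x) (π-ι y)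
        (trans (sym (π-+ (ι x) (ι y))) (trans (cong π (ℤ.+-comm (ι x) (ι y))) (π-+ (ι y) (ι x))))

      ⊗-comm : ∀ x y → x ⊗ y ≡ y ⊗ x
      ⊗-comm x y = subst₂ (λ x y → x ⊗ y ≡ y ⊗ x) (π-ι x) (π-ι y)
        (trans (sym (π-* (ι x) (ι y))) (trans (cong π (ℤ.*-comm (ι x) (ι y))) (π-* (ι y) (ι x))))

      ⊕-identityˡ : ∀ x → 0F ⊕ x ≡ x
      ⊕-identityˡ x = subst (λ x → 0F ⊕ x ≡ x) (π-ι x)
        (trans (sym (π-+ 0ℤ (ι x))) (cong π (ℤ.+-identityˡ (ι x))))

      ⊗-identityˡ : ∀ x → 1F ⊗ x ≡ x
      ⊗-identityˡ x = subst (λ x → 1F ⊗ x ≡ x) (π-ι x)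
        (trans (sym (π-* 1ℤ (ι x))) (cong π (ℤ.*-identityˡ (ι x))))

      ⊖-inverseˡ : ∀ x → ⊖ x ⊕ x ≡ 0F
      ⊖-inverseˡ x = subst (λ x → ⊖ x ⊕ x ≡ 0F) (π-ι x)
        (trans (cong (_⊕ π (ι x)) (sym (π-neg (ι x)))) (trans (sym (π-+ (- ι x) (ι x))) (cong π (ℤ.+-inverseˡ (ι x)))))

    commutativeRing : CommutativeRing 0ℓ 0ℓ
    commutativeRing = record
      { Carrier = F ; _≈_ = _≡_ ; _+_ = _⊕_ ; _*_ = _⊗_ ; -_ = ⊖_ ; 0# = 0F ; 1# = 1F
      ; isCommutativeRing = record
        { isRing = record
          { +-isAbelianGroup = record
            { isGroup = record
              { isMonoid = record
                { isSemigroup = record { isMagma = record { isEquivalence = isEquivalence ; ∙-cong = cong₂ _⊕_ } ; assoc = ⊕-assoc }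
                ; identity = ⊕-identityˡ , (λ x → trans (⊕-comm x 0F) (⊕-identityˡ x)) }
              ; inverse = ⊖-inverseˡ , (λ x → trans (⊕-comm x (⊖ x)) (⊖-inverseˡ x))
              ; ⁻¹-cong = cong ⊖_ }
            ; comm = ⊕-comm }
          ; *-cong = cong₂ _⊗_
          ; *-assoc = ⊗-assoc
          ; *-identity = ⊗-identityˡ , (λ x → trans (⊗-comm x 1F) (⊗-identityˡ x))
          ; distrib = ⊗-distribˡ-⊕ , (λ x y z → trans (⊗-comm (y ⊕ z) x) (trans (⊗-distribˡ-⊕ x y z) (cong₂ _⊕_ (⊗-comm x y) (⊗-comm x z)))) }
        ; *-comm = ⊗-comm } }

    private
      π-morphism : CommutativeRing.rawRing ℤ.+-*-commutativeRing -Raw-AlmostCommutative⟶ fromCommutativeRing commutativeRing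
      π-morphism = record { ⟦_⟧ = π ; +-homo = π-+ ; *-homo = π-* ; -‿homo = π-neg ; 0-homo = refl ; 1-homo = refl }

      coeff≟ : ∀ a b → Maybe (π a ≡ π b)
      coeff≟ a b with a ℤ.≟ b
      ... | yes a≡b = just (cong π a≡b)
      ... | no _ = nothing

    module Solver = Algebra.Solver.Ring (CommutativeRing.rawRing ℤ.+-*-commutativeRing) (fromCommutativeRing commutativeRing) π-morphism coeff≟

  -- Integer sums over finite types

  module FiniteSums where
    private variable
      A B : Set
      P Q : Set

    ⟦_⟧ : Dec P → ℤ
    ⟦ yes _ ⟧ = 1ℤ
    ⟦ no _ ⟧ = 0ℤ

    ⟦⟧-yes : (d : Dec P) → P → ⟦ d ⟧ ≡ 1ℤ
    ⟦⟧-yes (yes _) _ = refl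
    ⟦⟧-yes (no ¬p) p = contradiction p ¬p

    ⟦⟧-no : (d : Dec P) → ¬ P → ⟦ d ⟧ ≡ 0ℤ
    ⟦⟧-no (yes p) ¬p = contradiction p ¬p
    ⟦⟧-no (no _) _ = refl

    ⟦⟧-cong : (d : Dec P) (e : Dec Q) → (P → Q) → (Q → P) → ⟦ d ⟧ ≡ ⟦ e ⟧
    ⟦⟧-cong (yes p) e f g = sym (⟦⟧-yes e (f p))
    ⟦⟧-cong (no ¬p) e f g = sym (⟦⟧-no e (¬p ∘ g))

    ⟦⟧-square : (d : Dec P) → ⟦ d ⟧ * ⟦ d ⟧ ≡ ⟦ d ⟧
    ⟦⟧-square (yes _) = refl
    ⟦⟧-square (no _) = refl

    ⟦⟧-nonneg : (d : Dec P) → 0ℤ ≤ ⟦ d ⟧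
    ⟦⟧-nonneg (yes _) = +≤+ z≤n
    ⟦⟧-nonneg (no _) = +≤+ z≤n

    ∑ : List A → (A → ℤ) → ℤ
    ∑ [] f = 0ℤ
    ∑ (x ∷ xs) f = f x + ∑ xs f

    infixr 6.5 ∑
    syntax ∑ xs (λ x → e) = ∑[ x ∈ xs ] e

    ∑-cong : (xs : List A) {f g : A → ℤ} → (∀ x → f x ≡ g x) → ∑ xs f ≡ ∑ xs g
    ∑-cong [] _ = refl
    ∑-cong (x ∷ xs) f≗g = cong₂ _+_ (f≗g x) (∑-cong xs f≗g)

    ∑-mono : (xs : List A) {f g : A → ℤ} → (∀ x → f x ≤ g x) → ∑ xs f ≤ ∑ xs g
    ∑-mono [] _ = ℤ.≤-refl
    ∑-mono (x ∷ xs) f≤g = ℤ.+-mono-≤ (f≤g x) (∑-mono xs f≤g)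

    ∑-+ : (xs : List A) (f g : A → ℤ) → ∑[ x ∈ xs ] (f x + g x) ≡ ∑ xs f + ∑ xs g
    ∑-+ [] f g = refl
    ∑-+ (x ∷ xs) f g = trans (cong (λ s → f x + g x + s) (∑-+ xs f g)) (e (f x) (g x) (∑ xs f) (∑ xs g))
      where
      e : ∀ a b c d → a + b + (c + d) ≡ a + c + (b + d)
      e = ℤ.solve-∀

    ∑-*ˡ : (xs : List A) (c : ℤ) (f : A → ℤ) → ∑[ x ∈ xs ] (c * f x) ≡ c * ∑ xs f
    ∑-*ˡ [] c f = sym (ℤ.*-zeroʳ c)
    ∑-*ˡ (x ∷ xs) c f = trans (cong (λ s → c * f x + s) (∑-*ˡ xs c f)) (sym (ℤ.*-distribˡ-+ c (f x) (∑ xs f)))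

    ∑-*ʳ : (xs : List A) (f : A → ℤ) (c : ℤ) → ∑[ x ∈ xs ] (f x * c) ≡ ∑ xs f * c
    ∑-*ʳ xs f c = trans (∑-cong xs (λ x → ℤ.*-comm (f x) c)) (trans (∑-*ˡ xs c f) (ℤ.*-comm c (∑ xs f)))

    ∑-const : (xs : List A) (c : ℤ) → ∑[ x ∈ xs ] c ≡ + length xs * c
    ∑-const [] c = sym (ℤ.*-zeroˡ c)
    ∑-const (x ∷ xs) c = trans (cong (λ s → c + s) (∑-const xs c)) (sym (ℤ.suc-* (+ length xs) c))

    ∑-zero : (xs : List A) {f : A → ℤ} → (∀ x → f x ≡ 0ℤ) → ∑ xs f ≡ 0ℤ
    ∑-zero xs f≗0 = trans (∑-cong xs f≗0) (trans (∑-const xs 0ℤ) (ℤ.*-zeroʳ (+ length xs)))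

    ∑-nonneg : (xs : List A) {f : A → ℤ} → (∀ x → 0ℤ ≤ f x) → 0ℤ ≤ ∑ xs f
    ∑-nonneg xs {f} 0≤f = subst (_≤ ∑ xs f) (∑-zero xs {λ _ → 0ℤ} (λ _ → refl)) (∑-mono xs 0≤f)

    ∑-comm : (xs : List A) (ys : List B) (f : A → B → ℤ) → ∑[ x ∈ xs ] ∑[ y ∈ ys ] f x y ≡ ∑[ y ∈ ys ] ∑[ x ∈ xs ] f x y
    ∑-comm [] ys f = sym (∑-zero ys (λ _ → refl))
    ∑-comm (x ∷ xs) ys f = trans (cong (λ s → ∑ ys (f x) + s) (∑-comm xs ys f)) (sym (∑-+ ys (f x) _))

    ∑-*-∑ : (xs : List A) (ys : List B) (f : A → ℤ) (g : B → ℤ) → ∑ xs f * ∑ ys g ≡ ∑[ x ∈ xs ] ∑[ y ∈ ys ] f x * g y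
    ∑-*-∑ xs ys f g = trans (sym (∑-*ʳ xs f (∑ ys g))) (∑-cong xs (λ x → sym (∑-*ˡ ys (f x) g)))

    ∑-++ : (xs ys : List A) (f : A → ℤ) → ∑ (xs ++ ys) f ≡ ∑ xs f + ∑ ys f
    ∑-++ [] ys f = sym (ℤ.+-identityˡ _)
    ∑-++ (x ∷ xs) ys f = trans (cong (λ s → f x + s) (∑-++ xs ys f)) (sym (ℤ.+-assoc (f x) _ _))

    ∑-map : (h : B → A) (ys : List B) (f : A → ℤ) → ∑ (map h ys) f ≡ ∑ ys (f ∘ h)
    ∑-map h [] f = refl
    ∑-map h (y ∷ ys) f = cong (λ s → f (h y) + s) (∑-map h ys f)

    ∑-cartesianProduct : (xs : List A) (ys : List B) (f : A × B → ℤ) → ∑ (cartesianProduct xs ys) f ≡ ∑[ x ∈ xs ] ∑[ y ∈ ys ] f (x , y)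
    ∑-cartesianProduct [] ys f = refl
    ∑-cartesianProduct (x ∷ xs) ys f = trans (∑-++ (map (x ,_) ys) _ f) (cong₂ _+_ (∑-map (x ,_) ys f) (∑-cartesianProduct xs ys f))

    ∑-⟦⟧-filter : {P : A → Set} (P? : Decidable P) (xs : List A) → ∑[ x ∈ xs ] ⟦ P? x ⟧ ≡ + length (filter P? xs)
    ∑-⟦⟧-filter P? [] = refl
    ∑-⟦⟧-filter P? (x ∷ xs) with P? x
    ... | yes _ = cong (λ s → 1ℤ + s) (∑-⟦⟧-filter P? xs)
    ... | no _ = trans (ℤ.+-identityˡ _) (∑-⟦⟧-filter P? xs)

    0≤i*i : ∀ i → 0ℤ ≤ i * i
    0≤i*i (+ i) = subst (0ℤ ≤_) (ℤ.pos-* i i) (+≤+ z≤n)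
    0≤i*i -[1+ i ] = +≤+ z≤n

    -- Cauchy-Schwarz against the constant function 1; the cross terms of the induction step are
    -- bounded by 2 a b ≤ a² + b².
    ∑-square-≤ : (xs : List A) (f : A → ℤ) → ∑ xs f * ∑ xs f ≤ + length xs * (∑[ x ∈ xs ] f x * f x)
    ∑-square-≤ [] f = ℤ.≤-refl
    ∑-square-≤ (x ∷ xs) f = begin
      (a + s) * (a + s)                     ≡⟨ e₁ a s ⟩
      a * a + (a * s + a * s) + s * s       ≤⟨ ℤ.+-monoʳ-≤ (a * a + (a * s + a * s)) (∑-square-≤ xs f) ⟩
      a * a + (a * s + a * s) + n * t       ≤⟨ ℤ.+-monoˡ-≤ (n * t) (ℤ.+-monoʳ-≤ (a * a) cross) ⟩
      a * a + (n * (a * a) + t) + n * t     ≡⟨ e₂ a n t ⟩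
      (1ℤ + n) * (a * a + t)                ∎
      where
      open ℤ.≤-Reasoning
      a = f x
      s = ∑ xs f
      t = ∑[ y ∈ xs ] f y * f y
      n = + length xs
      e₁ : ∀ a s → (a + s) * (a + s) ≡ a * a + (a * s + a * s) + s * s
      e₁ = ℤ.solve-∀
      e₂ : ∀ a n t → a * a + (n * (a * a) + t) + n * t ≡ (1ℤ + n) * (a * a + t)
      e₂ = ℤ.solve-∀
      cross : a * s + a * s ≤ n * (a * a) + t
      cross = begin
        a * s + a * s                              ≡⟨ cong (λ u → u + u) (∑-*ˡ xs a f) ⟨
        ∑[ y ∈ xs ] (a * f y) + ∑[ y ∈ xs ] (a * f y)  ≡⟨ ∑-+ xs _ _ ⟨
        ∑[ y ∈ xs ] (a * f y + a * f y)            ≤⟨ ∑-mono xs (λ y → ℤ.0≤i-j⇒j≤i (subst (0ℤ ≤_) (e₃ a (f y)) (0≤i*i (a - f y)))) ⟩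
        ∑[ y ∈ xs ] (a * a + f y * f y)            ≡⟨ ∑-+ xs _ _ ⟩
        ∑[ y ∈ xs ] (a * a) + t                    ≡⟨ cong (_+ t) (∑-const xs (a * a)) ⟩
        n * (a * a) + t                            ∎
        where
        e₃ : ∀ a b → (a - b) * (a - b) ≡ a * a + b * b - (a * b + a * b)
        e₃ = ℤ.solve-∀

    -- An enumeration without repetition, with "exactly once" expressed as a sum of indicators.
    -- Reindexing along a bijection then amounts to inserting a delta function and interchanging two
    -- sums, with no permutations of lists.
    record Finite (A : Set) : Set where
      field
        elements : List A
        _≟_ : DecidableEquality A
        once : ∀ a → ∑[ x ∈ elements ] ⟦ a ≟ x ⟧ ≡ 1ℤ

      ∑-δ : (a : A) (f : A → ℤ) → ∑[ x ∈ elements ] ⟦ a ≟ x ⟧ * f x ≡ f a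
      ∑-δ a f = begin
        ∑[ x ∈ elements ] ⟦ a ≟ x ⟧ * f x   ≡⟨ ∑-cong elements (λ x → lemma x (a ≟ x)) ⟩
        ∑[ x ∈ elements ] ⟦ a ≟ x ⟧ * f a   ≡⟨ ∑-*ʳ elements (λ x → ⟦ a ≟ x ⟧) (f a) ⟩
        (∑[ x ∈ elements ] ⟦ a ≟ x ⟧) * f a ≡⟨ cong (_* f a) (once a) ⟩
        1ℤ * f a                            ≡⟨ ℤ.*-identityˡ (f a) ⟩
        f a                                 ∎
        where
        open ≡-Reasoning
        lemma : ∀ x (d : Dec (a ≡ x)) → ⟦ d ⟧ * f x ≡ ⟦ d ⟧ * f a
        lemma x (yes refl) = refl
        lemma x (no _) = refl

    open Finite using (elements)

    ∑-bijection : (FA : Finite A) (FB : Finite B) (σ : A → B) (τ : B → A) → (∀ x → τ (σ x) ≡ x) → (∀ y → σ (τ y) ≡ y) →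
                  (f : B → ℤ) → ∑[ x ∈ elements FA ] f (σ x) ≡ ∑ (elements FB) f
    ∑-bijection FA FB σ τ τσ στ f = begin
      ∑[ x ∈ as ] f (σ x)                                     ≡⟨ ∑-cong as (λ x → sym (FB.∑-δ (σ x) f)) ⟩
      ∑[ x ∈ as ] ∑[ y ∈ bs ] ⟦ σ x FB.≟ y ⟧ * f y            ≡⟨ ∑-comm as bs _ ⟩
      ∑[ y ∈ bs ] ∑[ x ∈ as ] ⟦ σ x FB.≟ y ⟧ * f y            ≡⟨ ∑-cong bs (λ y → ∑-*ʳ as (λ x → ⟦ σ x FB.≟ y ⟧) (f y)) ⟩
      ∑[ y ∈ bs ] (∑[ x ∈ as ] ⟦ σ x FB.≟ y ⟧) * f y          ≡⟨ ∑-cong bs (λ y → cong (_* f y) (trans (∑-cong as (inverse y)) (FA.once (τ y)))) ⟩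
      ∑[ y ∈ bs ] 1ℤ * f y                                    ≡⟨ ∑-cong bs (λ y → ℤ.*-identityˡ (f y)) ⟩
      ∑ bs f                                                  ∎
      where
      open ≡-Reasoning
      module FA = Finite FA
      module FB = Finite FB
      as = elements FA
      bs = elements FB
      inverse : ∀ y x → ⟦ σ x FB.≟ y ⟧ ≡ ⟦ τ y FA.≟ x ⟧
      inverse y x = ⟦⟧-cong (σ x FB.≟ y) (τ y FA.≟ x) (λ { refl → τσ x }) (λ { refl → στ y })

    ∑-tabulate : ∀ {n} (h : Fin n → A) (f : A → ℤ) → ∑ (List.tabulate h) f ≡ ∑ (allFin n) (f ∘ h)
    ∑-tabulate {n = n} h f = trans (cong (λ xs → ∑ xs f) (sym (List.map-tabulate (λ x → x) h))) (∑-map h (allFin n) f)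

    ∑-allFin-suc : ∀ n (f : Fin (suc n) → ℤ) → ∑ (allFin (suc n)) f ≡ f zero + ∑ (allFin n) (f ∘ suc)
    ∑-allFin-suc n f = cong (λ s → f zero + s) (∑-tabulate suc f)

    Fin-finite : ∀ n → Finite (Fin n)
    Fin-finite n = record { elements = allFin n ; _≟_ = Fin._≟_ ; once = once }
      where
      once : ∀ {n} (a : Fin n) → ∑[ x ∈ allFin n ] ⟦ a Fin.≟ x ⟧ ≡ 1ℤ
      once {suc n} zero = trans (∑-allFin-suc n (λ x → ⟦ zero Fin.≟ x ⟧)) (cong (λ s → 1ℤ + s) (∑-zero (allFin n) (λ _ → refl)))
      once {suc n} (suc a) = trans (∑-allFin-suc n (λ x → ⟦ suc a Fin.≟ x ⟧)) (trans (ℤ.+-identityˡ _)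
        (trans (∑-cong (allFin n) (λ x → ⟦⟧-cong (suc a Fin.≟ suc x) (a Fin.≟ x) Fin.suc-injective (cong suc))) (once a)))

    ×-finite : Finite A → Finite B → Finite (A × B)
    ×-finite FA FB = record { elements = cartesianProduct as bs ; _≟_ = ≡-dec FA._≟_ FB._≟_ ; once = once }
      where
      module FA = Finite FA
      module FB = Finite FB
      as = FA.elements
      bs = FB.elements
      _≟_ = ≡-dec FA._≟_ FB._≟_
      open ≡-Reasoning
      ⟦⟧-× : ∀ {a b x y} (d : Dec (a ≡ x)) (e : Dec (b ≡ y)) (de : Dec ((a , b) ≡ (x , y))) → ⟦ de ⟧ ≡ ⟦ d ⟧ * ⟦ e ⟧
      ⟦⟧-× (yes refl) (yes refl) de = ⟦⟧-yes de refl
      ⟦⟧-× (yes refl) (no b≢y) de = ⟦⟧-no de (b≢y ∘ cong proj₂)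
      ⟦⟧-× (no a≢x) e de = trans (⟦⟧-no de (a≢x ∘ cong proj₁)) (sym (ℤ.*-zeroˡ ⟦ e ⟧))
      once : ∀ p → ∑[ x ∈ cartesianProduct as bs ] ⟦ p ≟ x ⟧ ≡ 1ℤ
      once (a , b) = begin
        ∑[ x ∈ cartesianProduct as bs ] ⟦ (a , b) ≟ x ⟧                 ≡⟨ ∑-cartesianProduct as bs _ ⟩
        ∑[ x ∈ as ] ∑[ y ∈ bs ] ⟦ (a , b) ≟ (x , y) ⟧                   ≡⟨ ∑-cong as (λ x → ∑-cong bs (λ y → ⟦⟧-× (a FA.≟ x) (b FB.≟ y) ((a , b) ≟ (x , y)))) ⟩
        ∑[ x ∈ as ] ∑[ y ∈ bs ] ⟦ a FA.≟ x ⟧ * ⟦ b FB.≟ y ⟧             ≡⟨ ∑-*-∑ as bs _ _ ⟨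
        (∑[ x ∈ as ] ⟦ a FA.≟ x ⟧) * (∑[ y ∈ bs ] ⟦ b FB.≟ y ⟧)         ≡⟨ cong₂ _*_ (FA.once a) (FB.once b) ⟩
        1ℤ                                                              ∎

  open FiniteSums

  -- Counting in subsets, and signed positional notation

  subset : ∀ {n} {P : Fin n → Set} → Decidable P → Subset n
  subset P? = tabulate (λ x → does (P? x))

  ∈-subset⁺ : ∀ {n} {P : Fin n → Set} (P? : Decidable P) {x} → P x → x ∈ subset P?
  ∈-subset⁺ P? {x} Px = Vec.lookup⇒[]= x _ (trans (Vec.lookup∘tabulate _ x) (dec-true (P? x) Px))

  ∈-subset⁻ : ∀ {n} {P : Fin n → Set} (P? : Decidable P) {x} → x ∈ subset P? → P x
  ∈-subset⁻ P? {x} x∈ with P? x | trans (sym (Vec.lookup∘tabulate (λ x → does (P? x)) x)) (Vec.[]=⇒lookup x∈)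
  ... | yes Px | _ = Px
  ... | no _ | ()

  injection⇒≤∣∣ : ∀ {m n} (φ : Fin m → Fin n) → (∀ {i j} → φ i ≡ φ j → i ≡ j) → (A : Subset n) → (∀ i → φ i ∈ A) → m ℕ.≤ Subset.∣ A ∣
  injection⇒≤∣∣ {zero} φ inj A φ∈A = z≤n
  injection⇒≤∣∣ {suc m} φ inj A φ∈A = ℕ.≤-<-trans
    (injection⇒≤∣∣ (φ ∘ suc) (Fin.suc-injective ∘ inj) (A Subset.- φ zero) (λ i → x∈p∧x≢y⇒x∈p-y (φ∈A (suc i)) (λ eq → Fin.0≢1+n (sym (inj eq)))))
    (x∈p⇒∣p-x∣<∣p∣ (φ∈A zero))

  ∑-∈ : ∀ {n} (A : Subset n) → ∑[ x ∈ allFin n ] ⟦ x ∈? A ⟧ ≡ + Subset.∣ A ∣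
  ∑-∈ [] = refl
  ∑-∈ {suc n} (b ∷ A) = trans (∑-allFin-suc n (λ x → ⟦ x ∈? (b ∷ A) ⟧)) (trans (cong (λ s → ⟦ zero ∈? (b ∷ A) ⟧ + s)
      (trans (∑-cong (allFin n) (λ x → ⟦⟧-cong (suc x ∈? (b ∷ A)) (x ∈? A) drop-there there)) (∑-∈ A)))
    (head b))
    where
    head : ∀ b → ⟦ zero ∈? (b ∷ A) ⟧ + + Subset.∣ A ∣ ≡ + Subset.∣ b ∷ A ∣
    head true = refl
    head false = refl

  -- Applied with smaller and smaller place values `d`, this reads off the signed digits of zero
  -- from the top.
  digit-zero : ∀ {x y} d → x * + d + y ≡ 0ℤ → ∣ y ∣ ℕ.< d → x ≡ 0ℤ × y ≡ 0ℤ
  digit-zero {x} {y} d eq ∣y∣<d = x≡0 , y≡0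
    where
    ∣x∣*d≡∣y∣ : ∣ x ∣ ℕ.* d ≡ ∣ y ∣
    ∣x∣*d≡∣y∣ = begin
      ∣ x ∣ ℕ.* d    ≡⟨ ℤ.abs-* x (+ d) ⟨
      ∣ x * + d ∣    ≡⟨ cong ∣_∣ (trans (e x (+ d) y) (cong (_- y) eq)) ⟩
      ∣ 0ℤ - y ∣     ≡⟨ cong ∣_∣ (ℤ.+-identityˡ (- y)) ⟩
      ∣ - y ∣        ≡⟨ ℤ.∣-i∣≡∣i∣ y ⟩
      ∣ y ∣          ∎
      where
      open ≡-Reasoning
      e : ∀ x d y → x * d ≡ x * d + y - y
      e = ℤ.solve-∀
    ∣x∣≡0 : ∀ n → n ℕ.* d ≡ ∣ y ∣ → n ≡ 0
    ∣x∣≡0 zero _ = refl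
    ∣x∣≡0 (suc n) eq = contradiction (ℕ.≤-trans (ℕ.m≤m+n d (n ℕ.* d)) (ℕ.≤-reflexive eq)) (ℕ.<⇒≱ ∣y∣<d)
    x≡0 : x ≡ 0ℤ
    x≡0 = ℤ.∣i∣≡0⇒i≡0 (∣x∣≡0 ∣ x ∣ ∣x∣*d≡∣y∣)
    y≡0 : y ≡ 0ℤ
    y≡0 = trans (sym (trans (cong (λ x → x * + d + y) x≡0) (ℤ.+-identityˡ y))) eq

  -- The prime field and linear relations on the moment curve

  module PrimeField (q : ℕ) (q-prime : Prime q) where

    private instance
      q≢0 : NonZero q
      q≢0 = prime⇒nonZero q-prime

    open Residues q public

    F-finite : Finite F
    F-finite = Fin-finite q

    Fs : List F
    Fs = allFin q

    _≟_ = Fin._≟_ {q}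

    inverse : ∀ {c} → c ≢ 0F → ∃ λ d → c ⊗ d ≡ 1F
    inverse {c} c≢0 with coprime-Bézout (prime⇒coprime q-prime {{ℕ.≢-nonZero toℕc≢0}} (Fin.toℕ<n c))
      where
      toℕc≢0 : toℕ c ≢ 0
      toℕc≢0 eq = c≢0 (trans (sym (π-ι c)) (cong (π ∘ +_) eq))
    ... | Bézout.+- x y eq = π (- + y) , (begin
      c ⊗ π (- + y)         ≡⟨ cong (_⊗ π (- + y)) (π-ι c) ⟨
      π (ι c) ⊗ π (- + y)   ≡⟨ π-* (ι c) (- + y) ⟨
      π (ι c * - + y)       ≡⟨ π-cong (- + x , trans (e (ι c) (+ y)) (trans (cong (λ z → 1ℤ - z) eq′) (e′ (+ x) (+ q)))) ⟩
      1F                    ∎)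
      where
      open ≡-Reasoning
      e : ∀ c y → c * - y ≡ 1ℤ - (1ℤ + y * c)
      e = ℤ.solve-∀
      eq′ : 1ℤ + + y * ι c ≡ + x * + q
      eq′ = trans (cong (λ z → 1ℤ + z) (sym (ℤ.pos-* y (toℕ c)))) (trans (cong +_ eq) (ℤ.pos-* x q))
      e′ : ∀ x q → 1ℤ - x * q ≡ 1ℤ + - x * q
      e′ = ℤ.solve-∀
    ... | Bézout.-+ x y eq = π (+ y) , (begin
      c ⊗ π (+ y)           ≡⟨ cong (_⊗ π (+ y)) (π-ι c) ⟨
      π (ι c) ⊗ π (+ y)     ≡⟨ π-* (ι c) (+ y) ⟨
      π (ι c * + y)         ≡⟨ π-cong (+ x , trans (ℤ.*-comm (ι c) (+ y)) (sym eq′)) ⟩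
      1F                    ∎)
      where
      open ≡-Reasoning
      eq′ : 1ℤ + + x * + q ≡ + y * ι c
      eq′ = trans (cong (λ z → 1ℤ + z) (sym (ℤ.pos-* x q))) (trans (cong +_ eq) (ℤ.pos-* y (toℕ c)))

    ⊗-cancel-0 : ∀ {c x} → c ≢ 0F → c ⊗ x ≡ 0F → x ≡ 0F
    ⊗-cancel-0 {c} {x} c≢0 cx≡0 with inverse c≢0
    ... | d , cd≡1 = begin
      x              ≡⟨ solve 1 (λ x → x := con 1ℤ :* x) refl x ⟩
      1F ⊗ x         ≡⟨ cong (_⊗ x) cd≡1 ⟨
      c ⊗ d ⊗ x      ≡⟨ solve 3 (λ c d x → c :* d :* x := d :* (c :* x)) refl c d x ⟩
      d ⊗ (c ⊗ x)    ≡⟨ cong (d ⊗_) cx≡0 ⟩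
      d ⊗ 0F         ≡⟨ solve 1 (λ d → d :* con 0ℤ := con 0ℤ) refl d ⟩
      0F             ∎
      where
      open ≡-Reasoning
      open Solver using (solve; _:=_; _:+_; _:*_; :-_; con)

    ⊕⊖≡0⇒≡ : ∀ {x y} → x ⊕ ⊖ y ≡ 0F → x ≡ y
    ⊕⊖≡0⇒≡ {x} {y} eq = begin
      x               ≡⟨ solve 2 (λ x y → x := (x :+ (:- y)) :+ y) refl x y ⟩
      x ⊕ ⊖ y ⊕ y     ≡⟨ cong (_⊕ y) eq ⟩
      0F ⊕ y          ≡⟨ solve 1 (λ y → con 0ℤ :+ y := y) refl y ⟩
      y               ∎
      where
      open ≡-Reasoning
      open Solver using (solve; _:=_; _:+_; _:*_; :-_; con)

    ≡⇒⊕⊖≡0 : ∀ {x y} → x ≡ y → x ⊕ ⊖ y ≡ 0F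
    ≡⇒⊕⊖≡0 {x} refl = solve 1 (λ x → x :+ (:- x) := con 0ℤ) refl x where open Solver using (solve; _:=_; _:+_; _:*_; :-_; con)

    V : Set
    V = F × F × F

    0V : V
    0V = 0F , 0F , 0F

    dot : V → V → F
    dot (a , b , c) (x , y , z) = a ⊗ x ⊕ b ⊗ y ⊕ c ⊗ z

    curve : F → V
    curve y = y , y ⊗ y , y ⊗ y ⊗ y

    cancel-difference : ∀ {y z w r} → y ≢ z → (y ⊕ ⊖ z) ⊗ w ≡ r → r ≡ 0F → w ≡ 0F
    cancel-difference y≢z eq r≡0 = ⊗-cancel-0 (y≢z ∘ ⊕⊖≡0⇒≡) (trans eq r≡0)

    -- Successive divided differences of the cubic y ↦ dot ξ (curve y).
    fourRoots⇒0 : ∀ ξ {s y₁ y₂ y₃ y₄} → y₁ ≢ y₂ → y₁ ≢ y₃ → y₁ ≢ y₄ → y₂ ≢ y₃ → y₂ ≢ y₄ → y₃ ≢ y₄ →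
      dot ξ (curve y₁) ≡ s → dot ξ (curve y₂) ≡ s → dot ξ (curve y₃) ≡ s → dot ξ (curve y₄) ≡ s → ξ ≡ 0V
    fourRoots⇒0 ξ@(a , b , c) {s} {y₁} {y₂} {y₃} {y₄} 1≢2 1≢3 1≢4 2≢3 2≢4 3≢4 r₁ r₂ r₃ r₄ =
      cong₂ _,_ a≡0 (cong₂ _,_ b≡0 c≡0)
      where
      open Solver using (solve; _:=_; _:+_; _:*_; :-_; con)
      d₁ : F → F
      d₁ y = a ⊕ b ⊗ (y ⊕ y₁) ⊕ c ⊗ (y ⊗ y ⊕ y ⊗ y₁ ⊕ y₁ ⊗ y₁)
      d₂ : F → F
      d₂ y = b ⊕ c ⊗ (y ⊕ y₁ ⊕ y₂)
      d₁≡0 : ∀ {y} → y₁ ≢ y → dot ξ (curve y) ≡ s → d₁ y ≡ 0F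
      d₁≡0 {y} 1≢y r = cancel-difference {y} {y₁} (1≢y ∘ sym)
        (solve 5 (λ a b c y z → (y :+ (:- z)) :* (a :+ b :* (y :+ z) :+ c :* (y :* y :+ y :* z :+ z :* z))
           := (a :* y :+ b :* (y :* y) :+ c :* (y :* y :* y)) :+ (:- (a :* z :+ b :* (z :* z) :+ c :* (z :* z :* z)))) refl a b c y y₁)
        (≡⇒⊕⊖≡0 (trans r (sym r₁)))
      d₂≡0 : ∀ {y} → y₁ ≢ y → y₂ ≢ y → dot ξ (curve y) ≡ s → d₂ y ≡ 0F
      d₂≡0 {y} 1≢y 2≢y r = cancel-difference {y} {y₂} (2≢y ∘ sym)
        (solve 6 (λ a b c y z w → (y :+ (:- w)) :* (b :+ c :* (y :+ z :+ w))
           := (a :+ b :* (y :+ z) :+ c :* (y :* y :+ y :* z :+ z :* z)) :+ (:- (a :+ b :* (w :+ z) :+ c :* (w :* w :+ w :* z :+ z :* z)))) refl a b c y y₁ y₂)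
        (≡⇒⊕⊖≡0 (trans (d₁≡0 1≢y r) (sym (d₁≡0 1≢2 r₂))))
      c≡0 : c ≡ 0F
      c≡0 = cancel-difference {y₃} {y₄} 3≢4
        (solve 6 (λ b c y w z t → (y :+ (:- w)) :* c := (b :+ c :* (y :+ z :+ t)) :+ (:- (b :+ c :* (w :+ z :+ t)))) refl b c y₃ y₄ y₁ y₂)
        (≡⇒⊕⊖≡0 (trans (d₂≡0 1≢3 2≢3 r₃) (sym (d₂≡0 1≢4 2≢4 r₄))))
      b≡0 : b ≡ 0F
      b≡0 = trans (solve 2 (λ b u → b := b :+ con 0ℤ :* u) refl b (y₃ ⊕ y₁ ⊕ y₂))
        (trans (cong (λ c → b ⊕ c ⊗ (y₃ ⊕ y₁ ⊕ y₂)) (sym c≡0)) (d₂≡0 1≢3 2≢3 r₃))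
      a≡0 : a ≡ 0F
      a≡0 = trans (solve 3 (λ a u v → a := a :+ con 0ℤ :* u :+ con 0ℤ :* v) refl a (y₂ ⊕ y₁) (y₂ ⊗ y₂ ⊕ y₂ ⊗ y₁ ⊕ y₁ ⊗ y₁))
        (trans (cong₂ (λ b c → a ⊕ b ⊗ (y₂ ⊕ y₁) ⊕ c ⊗ (y₂ ⊗ y₂ ⊕ y₂ ⊗ y₁ ⊕ y₁ ⊗ y₁)) (sym b≡0) (sym c≡0)) (d₁≡0 1≢2 r₂))

    ∑-curve≤3 : ∀ {ξ} → ξ ≢ 0V → ∀ s → ∑[ y ∈ Fs ] ⟦ dot ξ (curve y) ≟ s ⟧ ≤ + 3
    ∑-curve≤3 {ξ} ξ≢0 s = subst (_≤ + 3) (sym (∑-⟦⟧-filter root? Fs)) (+≤+ (length≤3 (filter root? Fs) (filter⁺ root? (allFin⁺ q)) (all-filter root? Fs)))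
      where
      root? : Decidable (λ y → dot ξ (curve y) ≡ s)
      root? y = dot ξ (curve y) ≟ s
      length≤3 : ∀ ys → Unique ys → All (λ y → dot ξ (curve y) ≡ s) ys → length ys ℕ.≤ 3
      length≤3 [] _ _ = z≤n
      length≤3 (_ ∷ []) _ _ = s≤s z≤n
      length≤3 (_ ∷ _ ∷ []) _ _ = s≤s (s≤s z≤n)
      length≤3 (_ ∷ _ ∷ _ ∷ []) _ _ = s≤s (s≤s (s≤s z≤n))
      length≤3 (_ ∷ _ ∷ _ ∷ _ ∷ _) ((1≢2 ∷ 1≢3 ∷ 1≢4 ∷ _) ∷ (2≢3 ∷ 2≢4 ∷ _) ∷ (3≢4 ∷ _) ∷ _) (r₁ ∷ r₂ ∷ r₃ ∷ r₄ ∷ _) =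
        contradiction (fourRoots⇒0 ξ 1≢2 1≢3 1≢4 2≢3 2≢4 3≢4 r₁ r₂ r₃ r₄) ξ≢0

    ∑-translate : ∀ a (f : F → ℤ) → ∑[ x ∈ Fs ] f (x ⊕ a) ≡ ∑ Fs f
    ∑-translate a = ∑-bijection F-finite F-finite (_⊕ a) (_⊕ ⊖ a)
      (λ x → solve 2 (λ x a → x :+ a :+ (:- a) := x) refl x a) (λ x → solve 2 (λ x a → x :+ (:- a) :+ a := x) refl x a)
      where open Solver using (solve; _:=_; _:+_; _:*_; :-_; con)

    ∑-affine : ∀ a {c} → c ≢ 0F → (f : F → ℤ) → ∑[ x ∈ Fs ] f (a ⊕ c ⊗ x) ≡ ∑ Fs f
    ∑-affine a {c} c≢0 with inverse c≢0
    ... | d , cd≡1 = ∑-bijection F-finite F-finite (λ x → a ⊕ c ⊗ x) (λ y → d ⊗ (y ⊕ ⊖ a))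
      (λ x → trans (solve 4 (λ a c d x → d :* (a :+ c :* x :+ (:- a)) := c :* d :* x) refl a c d x) (unit x))
      (λ y → trans (solve 4 (λ a c d y → a :+ c :* (d :* (y :+ (:- a))) := a :+ c :* d :* (y :+ (:- a))) refl a c d y)
        (trans (cong (a ⊕_) (unit (y ⊕ ⊖ a))) (solve 2 (λ a y → a :+ (y :+ (:- a)) := y) refl a y)))
      where
      open Solver using (solve; _:=_; _:+_; _:*_; :-_; con)
      unit : ∀ x → c ⊗ d ⊗ x ≡ x
      unit x = trans (cong (_⊗ x) cd≡1) (solve 1 (λ x → con 1ℤ :* x := x) refl x)

    open Solver using (solve; _:=_; _:+_; _:*_; :-_; con)

    ⊗-≢0 : ∀ {x y} → x ≢ 0F → y ≢ 0F → x ⊗ y ≢ 0F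
    ⊗-≢0 x≢0 y≢0 xy≡0 = y≢0 (⊗-cancel-0 x≢0 xy≡0)

    -- The cubic t (t - y) (t - z) separates x from y and z.
    threePoints : ∀ {a b c x y z} → a ≢ 0F → x ≢ 0F →
      a ⊗ x ⊕ b ⊗ y ⊕ c ⊗ z ≡ 0F →
      a ⊗ (x ⊗ x) ⊕ b ⊗ (y ⊗ y) ⊕ c ⊗ (z ⊗ z) ≡ 0F →
      a ⊗ (x ⊗ x ⊗ x) ⊕ b ⊗ (y ⊗ y ⊗ y) ⊕ c ⊗ (z ⊗ z ⊗ z) ≡ 0F →
      x ≡ y ⊎ x ≡ z
    threePoints {a} {b} {c} {x} {y} {z} a≢0 x≢0 e₁ e₂ e₃ with x ≟ y
    ... | yes x≡y = inj₁ x≡y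
    ... | no x≢y = inj₂ (⊕⊖≡0⇒≡ (⊗-cancel-0 (⊗-≢0 (⊗-≢0 a≢0 x≢0) (x≢y ∘ ⊕⊖≡0⇒≡)) (begin
      a ⊗ x ⊗ (x ⊕ ⊖ y) ⊗ (x ⊕ ⊖ z)
        ≡⟨ solve 6 (λ a b c x y z → a :* x :* (x :+ (:- y)) :* (x :+ (:- z))
             := y :* z :* (a :* x :+ b :* y :+ c :* z) :+ (:- (y :+ z)) :* (a :* (x :* x) :+ b :* (y :* y) :+ c :* (z :* z))
                :+ (a :* (x :* x :* x) :+ b :* (y :* y :* y) :+ c :* (z :* z :* z))) refl a b c x y z ⟩
      y ⊗ z ⊗ (a ⊗ x ⊕ b ⊗ y ⊕ c ⊗ z) ⊕ ⊖ (y ⊕ z) ⊗ (a ⊗ (x ⊗ x) ⊕ b ⊗ (y ⊗ y) ⊕ c ⊗ (z ⊗ z)) ⊕ (a ⊗ (x ⊗ x ⊗ x) ⊕ b ⊗ (y ⊗ y ⊗ y) ⊕ c ⊗ (z ⊗ z ⊗ z))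
        ≡⟨ cong₂ _⊕_ (cong₂ (λ u v → y ⊗ z ⊗ u ⊕ ⊖ (y ⊕ z) ⊗ v) e₁ e₂) e₃ ⟩
      y ⊗ z ⊗ 0F ⊕ ⊖ (y ⊕ z) ⊗ 0F ⊕ 0F
        ≡⟨ solve 2 (λ y z → y :* z :* con 0ℤ :+ (:- (y :+ z)) :* con 0ℤ :+ con 0ℤ := con 0ℤ) refl y z ⟩
      0F ∎)))
      where open ≡-Reasoning

    -- All coefficients being nonzero, `threePoints` can be applied with each of the three points in
    -- the leading role, so each parameter equals one of the other two. Hence all three agree, and
    -- the relation collapses to (a + b - c) x = 0.
    curve-sum : ∀ {a b c x y z} → a ≢ 0F → b ≢ 0F → c ≢ 0F → x ≢ 0F → y ≢ 0F → z ≢ 0F →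
      a ⊗ x ⊕ b ⊗ y ≡ c ⊗ z →
      a ⊗ (x ⊗ x) ⊕ b ⊗ (y ⊗ y) ≡ c ⊗ (z ⊗ z) →
      a ⊗ (x ⊗ x ⊗ x) ⊕ b ⊗ (y ⊗ y ⊗ y) ≡ c ⊗ (z ⊗ z ⊗ z) →
      a ⊕ b ≡ c
    curve-sum {a} {b} {c} {x} {y} {z} a≢0 b≢0 c≢0 x≢0 y≢0 z≢0 e₁ e₂ e₃ = equal x≡y z≡x
      where
      ⊖c≢0 : ⊖ c ≢ 0F
      ⊖c≢0 ⊖c≡0 = c≢0 (trans (solve 1 (λ c → c := (:- c) :* (:- (con 1ℤ))) refl c) (trans (cong (_⊗ ⊖ 1F) ⊖c≡0) (solve 1 (λ t → con 0ℤ :* t := con 0ℤ) refl (⊖ 1F))))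
      r₁ : ∀ {u v w} → a ⊗ u ⊕ b ⊗ v ≡ c ⊗ w → a ⊗ u ⊕ b ⊗ v ⊕ ⊖ c ⊗ w ≡ 0F
      r₁ {u} {v} {w} e = trans (solve 6 (λ a b c u v w → a :* u :+ b :* v :+ (:- c) :* w := (a :* u :+ b :* v) :+ (:- (c :* w))) refl a b c u v w) (≡⇒⊕⊖≡0 e)
      r₂ : ∀ {u v w} → a ⊗ u ⊕ b ⊗ v ≡ c ⊗ w → b ⊗ v ⊕ a ⊗ u ⊕ ⊖ c ⊗ w ≡ 0F
      r₂ {u} {v} {w} e = trans (solve 6 (λ a b c u v w → b :* v :+ a :* u :+ (:- c) :* w := (a :* u :+ b :* v) :+ (:- (c :* w))) refl a b c u v w) (≡⇒⊕⊖≡0 e)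
      r₃ : ∀ {u v w} → a ⊗ u ⊕ b ⊗ v ≡ c ⊗ w → ⊖ c ⊗ w ⊕ a ⊗ u ⊕ b ⊗ v ≡ 0F
      r₃ {u} {v} {w} e = trans (solve 6 (λ a b c u v w → (:- c) :* w :+ a :* u :+ b :* v := (a :* u :+ b :* v) :+ (:- (c :* w))) refl a b c u v w) (≡⇒⊕⊖≡0 e)
      third : ∀ {u v w : F} → u ≡ v ⊎ u ≡ w → v ≡ u ⊎ v ≡ w → u ≡ v
      third (inj₁ u≡v) _ = u≡v
      third (inj₂ _) (inj₁ v≡u) = sym v≡u
      third (inj₂ u≡w) (inj₂ v≡w) = trans u≡w (sym v≡w)
      x≡y : x ≡ y
      x≡y = third (threePoints a≢0 x≢0 (r₁ e₁) (r₁ e₂) (r₁ e₃)) (threePoints b≢0 y≢0 (r₂ e₁) (r₂ e₂) (r₂ e₃))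
      z≡x : z ≡ x
      z≡x = [ (λ z≡x → z≡x) , (λ z≡y → trans z≡y (sym x≡y)) ]′ (threePoints ⊖c≢0 z≢0 (r₃ e₁) (r₃ e₂) (r₃ e₃))
      equal : x ≡ y → z ≡ x → a ⊕ b ≡ c
      equal refl refl = ⊕⊖≡0⇒≡ (⊗-cancel-0 x≢0
        (trans (solve 4 (λ a b c x → x :* (a :+ b :+ (:- c)) := (a :* x :+ b :* x) :+ (:- (c :* x))) refl a b c x) (≡⇒⊕⊖≡0 e₁)))

    -- Serves the count of `S`: the 2h (q - 1) points t (y, y², y³) are pairwise distinct.
    curve-unique : ∀ {a b x y} → a ≢ 0F → x ≢ 0F → a ⊗ x ≡ b ⊗ y → a ⊗ (x ⊗ x) ≡ b ⊗ (y ⊗ y) → a ≡ b × x ≡ y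
    curve-unique {a} {b} {x} {y} a≢0 x≢0 e₁ e₂ = a≡b x≡y , x≡y
      where
      x≡y : x ≡ y
      x≡y = ⊕⊖≡0⇒≡ (⊗-cancel-0 (⊗-≢0 a≢0 x≢0)
        (trans (solve 4 (λ a b x y → a :* x :* (x :+ (:- y)) := (a :* (x :* x) :+ (:- (b :* (y :* y)))) :+ (b :* y :+ (:- (a :* x))) :* y) refl a b x y)
          (trans (cong₂ (λ u v → u ⊕ v ⊗ y) (≡⇒⊕⊖≡0 e₂) (≡⇒⊕⊖≡0 (sym e₁))) (solve 1 (λ y → con 0ℤ :+ con 0ℤ :* y := con 0ℤ) refl y))))
      a≡b : x ≡ y → a ≡ b
      a≡b refl = ⊕⊖≡0⇒≡ (⊗-cancel-0 x≢0 (trans (solve 3 (λ a b x → x :* (a :+ (:- b)) := a :* x :+ (:- (b :* x))) refl a b x) (≡⇒⊕⊖≡0 e₁)))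

  -- Variances along progressions in F_q

  module CurveGraph (q : ℕ) (q-prime : Prime q) (h : ℕ) (h≤q : h ℕ.≤ q) where
    private instance
      q≢0 : NonZero q
      q≢0 = prime⇒nonZero q-prime
    open PrimeField q q-prime

    Q H : ℤ
    Q = + q
    H = + h

    js : List (Fin h)
    js = allFin h

    [_] : ℕ → F
    [ i ] = π (+ i)

    ∑-Fs-const : ∀ c → ∑[ x ∈ Fs ] c ≡ Q * c
    ∑-Fs-const c = trans (∑-const Fs c) (cong (λ l → + l * c) (List.length-tabulate {n = q} (λ x → x)))

    ∑-js-const : ∀ c → ∑[ x ∈ js ] c ≡ H * c
    ∑-js-const c = trans (∑-const js c) (cong (λ l → + l * c) (List.length-tabulate {n = h} (λ x → x)))

    []-injective : ∀ {i j : Fin h} → [ toℕ i ] ≡ [ toℕ j ] → i ≡ j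
    []-injective {i} {j} eq with π-injective eq
    ... | k , i≡j+kq = Fin.toℕ-injective (i+kn≡j⇒i≡j k (ℕ.<-≤-trans (Fin.toℕ<n i) h≤q) (ℕ.<-≤-trans (Fin.toℕ<n j) h≤q) i≡j+kq)

    progression : (F → ℤ) → F → F → ℤ
    progression u c s = ∑[ j ∈ js ] u (s ⊕ [ toℕ j ] ⊗ c)

    ∑-progression : ∀ u c → ∑ Fs (progression u c) ≡ H * ∑ Fs u
    ∑-progression u c = trans (∑-comm Fs js (λ s j → u (s ⊕ [ toℕ j ] ⊗ c)))
      (trans (∑-cong js (λ j → ∑-translate ([ toℕ j ] ⊗ c) u)) (∑-js-const (∑ Fs u)))

    -- For i ≠ j the substitution c ↦ s + (j - i) c makes the sum over c run over all of F, so the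
    -- cross terms of the squares vanish when u has mean zero.
    correlation : ∀ u → ∑ Fs u ≡ 0ℤ → ∀ (i j : Fin h) →
      ∑[ c ∈ Fs ] ∑[ s ∈ Fs ] u (s ⊕ [ toℕ i ] ⊗ c) * u (s ⊕ [ toℕ j ] ⊗ c) ≡ ⟦ i Fin.≟ j ⟧ * (Q * (∑[ s ∈ Fs ] u s * u s))
    correlation u ∑u≡0 i j with i Fin.≟ j
    ... | yes refl = trans (∑-cong Fs (λ c → ∑-translate ([ toℕ i ] ⊗ c) (λ s → u s * u s))) (trans (∑-Fs-const _) (sym (ℤ.*-identityˡ _)))
    ... | no i≢j = begin
      ∑[ c ∈ Fs ] ∑[ s ∈ Fs ] u (s ⊕ [ toℕ i ] ⊗ c) * u (s ⊕ [ toℕ j ] ⊗ c)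
        ≡⟨ ∑-cong Fs (λ c → trans (∑-cong Fs (λ s → cong (λ t → u (s ⊕ [ toℕ i ] ⊗ c) * u t) (e s [ toℕ i ] [ toℕ j ] c)))
             (∑-translate ([ toℕ i ] ⊗ c) (λ s → u s * u (s ⊕ d ⊗ c)))) ⟩
      ∑[ c ∈ Fs ] ∑[ s ∈ Fs ] u s * u (s ⊕ d ⊗ c)
        ≡⟨ ∑-comm Fs Fs _ ⟩
      ∑[ s ∈ Fs ] ∑[ c ∈ Fs ] u s * u (s ⊕ d ⊗ c)
        ≡⟨ ∑-zero Fs (λ s → trans (∑-*ˡ Fs (u s) _) (trans (cong (u s *_) (trans (∑-affine s d≢0 u) ∑u≡0)) (ℤ.*-zeroʳ (u s)))) ⟩
      0ℤ
        ≡⟨ ℤ.*-zeroˡ (Q * (∑[ s ∈ Fs ] u s * u s)) ⟨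
      0ℤ * (Q * (∑[ s ∈ Fs ] u s * u s)) ∎
      where
      open ≡-Reasoning
      d = [ toℕ j ] ⊕ ⊖ [ toℕ i ]
      d≢0 : d ≢ 0F
      d≢0 d≡0 = i≢j (sym ([]-injective (⊕⊖≡0⇒≡ d≡0)))
      e : ∀ s a b c → s ⊕ b ⊗ c ≡ s ⊕ a ⊗ c ⊕ (b ⊕ ⊖ a) ⊗ c
      e = solve 4 (λ s a b c → s :+ b :* c := s :+ a :* c :+ (b :+ (:- a)) :* c) refl where open Solver using (solve; _:=_; _:+_; _:*_; :-_; con)

    ∑-progression² : ∀ u → ∑ Fs u ≡ 0ℤ →
      ∑[ c ∈ Fs ] ∑[ s ∈ Fs ] progression u c s * progression u c s ≡ Q * H * (∑[ s ∈ Fs ] u s * u s)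
    ∑-progression² u ∑u≡0 = begin
      ∑[ c ∈ Fs ] ∑[ s ∈ Fs ] progression u c s * progression u c s
        ≡⟨ ∑-cong Fs (λ c → ∑-cong Fs (λ s → ∑-*-∑ js js _ _)) ⟩
      ∑[ c ∈ Fs ] ∑[ s ∈ Fs ] ∑[ i ∈ js ] ∑[ j ∈ js ] t c s i j
        ≡⟨ ∑-cong Fs (λ c → trans (∑-comm Fs js _) (∑-cong js (λ i → ∑-comm Fs js _))) ⟩
      ∑[ c ∈ Fs ] ∑[ i ∈ js ] ∑[ j ∈ js ] ∑[ s ∈ Fs ] t c s i j
        ≡⟨ trans (∑-comm Fs js _) (∑-cong js (λ i → ∑-comm Fs js _)) ⟩
      ∑[ i ∈ js ] ∑[ j ∈ js ] ∑[ c ∈ Fs ] ∑[ s ∈ Fs ] t c s i j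
        ≡⟨ ∑-cong js (λ i → ∑-cong js (correlation u ∑u≡0 i)) ⟩
      ∑[ i ∈ js ] ∑[ j ∈ js ] ⟦ i Fin.≟ j ⟧ * (Q * U)
        ≡⟨ ∑-cong js (λ i → Finite.∑-δ (Fin-finite h) i (λ _ → Q * U)) ⟩
      ∑[ i ∈ js ] Q * U
        ≡⟨ ∑-js-const (Q * U) ⟩
      H * (Q * U)
        ≡⟨ e H Q U ⟩
      Q * H * U ∎
      where
      open ≡-Reasoning
      U = ∑[ s ∈ Fs ] u s * u s
      t : F → F → Fin h → Fin h → ℤ
      t c s i j = u (s ⊕ [ toℕ i ] ⊗ c) * u (s ⊕ [ toℕ j ] ⊗ c)
      e : ∀ h q u → h * (q * u) ≡ q * h * u
      e = ℤ.solve-∀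

    -- The variance and the centering are scaled by q² and q respectively, to stay in ℤ.
    variance : (F → ℤ) → ℤ
    variance f = Q * (∑[ s ∈ Fs ] f s * f s) - ∑ Fs f * ∑ Fs f

    centered : (F → ℤ) → F → ℤ
    centered f s = Q * f s - ∑ Fs f

    variance-nonneg : ∀ f → 0ℤ ≤ variance f
    variance-nonneg f = ℤ.i≤j⇒0≤j-i (subst (λ l → ∑ Fs f * ∑ Fs f ≤ + l * (∑[ s ∈ Fs ] f s * f s)) (List.length-tabulate {n = q} (λ x → x)) (∑-square-≤ Fs f))

    ∑-linear : ∀ a f k → ∑[ s ∈ Fs ] (a * f s + k) ≡ a * ∑ Fs f + Q * k
    ∑-linear a f k = trans (∑-+ Fs (λ s → a * f s) (λ _ → k)) (cong₂ _+_ (∑-*ˡ Fs a f) (∑-Fs-const k))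

    ∑-centered : ∀ f → ∑ Fs (centered f) ≡ 0ℤ
    ∑-centered f = trans (∑-linear Q f (- ∑ Fs f)) (e Q (∑ Fs f))
      where
      e : ∀ q m → q * m + q * - m ≡ 0ℤ
      e = ℤ.solve-∀

    ∑-centered² : ∀ f → ∑[ s ∈ Fs ] centered f s * centered f s ≡ Q * variance f
    ∑-centered² f = begin
      ∑[ s ∈ Fs ] centered f s * centered f s
        ≡⟨ ∑-cong Fs (λ s → e₁ Q (f s) m) ⟩
      ∑[ s ∈ Fs ] (Q * Q * (f s * f s) + (- (Q * m + Q * m) * f s + m * m))
        ≡⟨ ∑-+ Fs _ _ ⟩
      (∑[ s ∈ Fs ] Q * Q * (f s * f s)) + (∑[ s ∈ Fs ] (- (Q * m + Q * m) * f s + m * m))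
        ≡⟨ cong₂ _+_ (∑-*ˡ Fs (Q * Q) (λ s → f s * f s)) (∑-linear (- (Q * m + Q * m)) f (m * m)) ⟩
      Q * Q * S + (- (Q * m + Q * m) * m + Q * (m * m))
        ≡⟨ e₂ Q S m ⟩
      Q * (Q * S - m * m) ∎
      where
      open ≡-Reasoning
      m = ∑ Fs f
      S = ∑[ s ∈ Fs ] f s * f s
      e₁ : ∀ q x m → (q * x - m) * (q * x - m) ≡ q * q * (x * x) + (- (q * m + q * m) * x + m * m)
      e₁ = ℤ.solve-∀
      e₂ : ∀ q s m → q * q * s + (- (q * m + q * m) * m + q * (m * m)) ≡ q * (q * s - m * m)
      e₂ = ℤ.solve-∀

    progression-centered : ∀ f c s → progression (centered f) c s ≡ centered (progression f c) s
    progression-centered f c s = begin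
      progression (centered f) c s                       ≡⟨ ∑-+ js (λ j → Q * f (s ⊕ [ toℕ j ] ⊗ c)) (λ _ → - ∑ Fs f) ⟩
      _                                                  ≡⟨ cong₂ _+_ (∑-*ˡ js Q (λ j → f (s ⊕ [ toℕ j ] ⊗ c))) (∑-js-const (- ∑ Fs f)) ⟩
      Q * progression f c s + H * - ∑ Fs f               ≡⟨ cong (λ x → Q * progression f c s + x) (trans (sym (ℤ.neg-distribʳ-* H (∑ Fs f))) (cong -_ (sym (∑-progression f c)))) ⟩
      centered (progression f c) s                       ∎
      where open ≡-Reasoning

    -- For a uniformly random difference `c` the `h` terms of the progression are pairwise
    -- uncorrelated, so their variances add up: the average over the `q` differences is
    -- `H * variance f`.
    ∑-variance-progression : ∀ f → ∑[ c ∈ Fs ] variance (progression f c) ≡ Q * H * variance f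
    ∑-variance-progression f = ℤ.*-cancelˡ-≡ Q _ _ (begin
      Q * (∑[ c ∈ Fs ] variance (progression f c))
        ≡⟨ ∑-*ˡ Fs Q _ ⟨
      ∑[ c ∈ Fs ] Q * variance (progression f c)
        ≡⟨ ∑-cong Fs (λ c → sym (∑-centered² (progression f c))) ⟩
      ∑[ c ∈ Fs ] ∑[ s ∈ Fs ] centered (progression f c) s * centered (progression f c) s
        ≡⟨ ∑-cong Fs (λ c → ∑-cong Fs (λ s → cong (λ x → x * x) (sym (progression-centered f c s)))) ⟩
      ∑[ c ∈ Fs ] ∑[ s ∈ Fs ] progression (centered f) c s * progression (centered f) c s
        ≡⟨ ∑-progression² (centered f) (∑-centered f) ⟩
      Q * H * (∑[ s ∈ Fs ] centered f s * centered f s)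
        ≡⟨ cong (Q * H *_) (∑-centered² f) ⟩
      Q * H * (Q * variance f)
        ≡⟨ e Q H (variance f) ⟩
      Q * (Q * H * variance f) ∎)
      where
      open ≡-Reasoning
      e : ∀ q h v → q * h * (q * v) ≡ q * (q * h * v)
      e = ℤ.solve-∀

    -- Sums over planes in F_q³

    V-finite : Finite V
    V-finite = ×-finite F-finite (×-finite F-finite F-finite)

    Vs : List V
    Vs = Finite.elements V-finite

    _≟V_ = Finite._≟_ V-finite

    ∑-V : ∀ f → ∑ Vs f ≡ ∑[ a ∈ Fs ] ∑[ b ∈ Fs ] ∑[ c ∈ Fs ] f (a , b , c)
    ∑-V f = trans (∑-cartesianProduct Fs _ f) (∑-cong Fs (λ a → ∑-cartesianProduct Fs Fs (λ v → f (a , v))))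

    ∑-Vs-const : ∀ c → ∑[ x ∈ Vs ] c ≡ Q * (Q * (Q * c))
    ∑-Vs-const c = trans (∑-V (λ _ → c)) (trans (∑-cong Fs (λ _ → trans (∑-cong Fs (λ _ → ∑-Fs-const c)) (∑-Fs-const (Q * c)))) (∑-Fs-const (Q * (Q * c))))

    length-Vs : + length Vs ≡ Q * (Q * Q)
    length-Vs = trans (sym (trans (∑-const Vs 1ℤ) (ℤ.*-identityʳ _))) (trans (∑-Vs-const 1ℤ) (cong (λ x → Q * (Q * x)) (ℤ.*-identityʳ Q)))

    infixl 6 _+ᵥ_
    infixl 7 _•_

    _+ᵥ_ : V → V → V
    (a , b , c) +ᵥ (x , y , z) = a ⊕ x , b ⊕ y , c ⊕ z

    -ᵥ_ : V → V
    -ᵥ (a , b , c) = ⊖ a , ⊖ b , ⊖ c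

    _•_ : F → V → V
    s • (a , b , c) = s ⊗ a , s ⊗ b , s ⊗ c

    ∑-V-translate : ∀ a (f : V → ℤ) → ∑[ x ∈ Vs ] f (x +ᵥ a) ≡ ∑ Vs f
    ∑-V-translate (a₁ , a₂ , a₃) = ∑-bijection V-finite V-finite (_+ᵥ (a₁ , a₂ , a₃)) (_+ᵥ (-ᵥ (a₁ , a₂ , a₃)))
      (λ (x , y , z) → cong₂ _,_ (e₁ x a₁) (cong₂ _,_ (e₁ y a₂) (e₁ z a₃)))
      (λ (x , y , z) → cong₂ _,_ (e₂ x a₁) (cong₂ _,_ (e₂ y a₂) (e₂ z a₃)))
      where
      open Solver using (solve; _:=_; _:+_; _:*_; :-_; con)
      e₁ : ∀ x a → x ⊕ a ⊕ ⊖ a ≡ x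
      e₁ = solve 2 (λ x a → x :+ a :+ (:- a) := x) refl
      e₂ : ∀ x a → x ⊕ ⊖ a ⊕ a ≡ x
      e₂ = solve 2 (λ x a → x :+ (:- a) :+ a := x) refl

    dot-+• : ∀ ξ x s v → dot ξ (x +ᵥ s • v) ≡ dot ξ x ⊕ s ⊗ dot ξ v
    dot-+• (a , b , c) (x , y , z) s (u , v , w) =
      solve 10 (λ a b c x y z s u v w → a :* (x :+ s :* u) :+ b :* (y :+ s :* v) :+ c :* (z :+ s :* w)
        := (a :* x :+ b :* y :+ c :* z) :+ s :* (a :* u :+ b :* v :+ c :* w)) refl a b c x y z s u v w
      where open Solver using (solve; _:=_; _:+_; _:*_; :-_; con)

    ∑-⟦affine⟧ : (f g : F → F) (k d : F) → d ≢ 0F → (∀ a → f a ⊕ ⊖ g a ≡ k ⊕ d ⊗ a) → ∑[ a ∈ Fs ] ⟦ f a ≟ g a ⟧ ≡ 1ℤ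
    ∑-⟦affine⟧ f g k d d≢0 eq = trans (∑-cong Fs (λ a → ⟦⟧-cong (f a ≟ g a) (0F ≟ (k ⊕ d ⊗ a))
        (λ e → trans (sym (≡⇒⊕⊖≡0 e)) (eq a)) (λ e → ⊕⊖≡0⇒≡ (trans (eq a) (sym e)))))
      (trans (∑-affine k d≢0 (λ t → ⟦ 0F ≟ t ⟧)) (Finite.once F-finite 0F))

    ∑-agreeing-functionals : ∀ x z → x ≢ z → ∑[ ξ ∈ Vs ] ⟦ dot ξ z ≟ dot ξ x ⟧ ≡ Q * Q
    ∑-agreeing-functionals (x₁ , x₂ , x₃) (z₁ , z₂ , z₃) x≢z = trans (∑-V _) agree
      where
      open Solver using (solve; _:=_; _:+_; _:*_; :-_; con)
      open ≡-Reasoning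
      t : F → F → F → ℤ
      t a b c = ⟦ dot (a , b , c) (z₁ , z₂ , z₃) ≟ dot (a , b , c) (x₁ , x₂ , x₃) ⟧
      square : ∑[ x ∈ Fs ] ∑[ y ∈ Fs ] 1ℤ ≡ Q * Q
      square = trans (∑-cong Fs (λ _ → trans (∑-Fs-const 1ℤ) (ℤ.*-identityʳ Q))) (∑-Fs-const Q)
      agree : ∑[ a ∈ Fs ] ∑[ b ∈ Fs ] ∑[ c ∈ Fs ] t a b c ≡ Q * Q
      -- The sum over a coordinate of ξ in which the two points differ is moved innermost. There the
      -- condition is an affine equation with nonzero slope and has exactly one solution; the other
      -- two coordinates are free.
      agree with z₃ ≟ x₃ | z₂ ≟ x₂ | z₁ ≟ x₁
      ... | no z≢x | _ | _ = trans (∑-cong Fs (λ a → ∑-cong Fs (λ b →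
              ∑-⟦affine⟧ _ _ (a ⊗ z₁ ⊕ b ⊗ z₂ ⊕ ⊖ (a ⊗ x₁ ⊕ b ⊗ x₂)) (z₃ ⊕ ⊖ x₃) (z≢x ∘ ⊕⊖≡0⇒≡)
                (λ c → solve 9 (λ a b c x y z u v w → (a :* u :+ b :* v :+ c :* w) :+ (:- (a :* x :+ b :* y :+ c :* z))
                  := (a :* u :+ b :* v :+ (:- (a :* x :+ b :* y))) :+ (w :+ (:- z)) :* c) refl a b c x₁ x₂ x₃ z₁ z₂ z₃)))) square
      ... | yes _ | no z≢x | _ = trans (∑-cong Fs (λ a → trans (∑-comm Fs Fs _) (∑-cong Fs (λ c →
              ∑-⟦affine⟧ _ _ (a ⊗ z₁ ⊕ c ⊗ z₃ ⊕ ⊖ (a ⊗ x₁ ⊕ c ⊗ x₃)) (z₂ ⊕ ⊖ x₂) (z≢x ∘ ⊕⊖≡0⇒≡)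
                (λ b → solve 9 (λ a b c x y z u v w → (a :* u :+ b :* v :+ c :* w) :+ (:- (a :* x :+ b :* y :+ c :* z))
                  := (a :* u :+ c :* w :+ (:- (a :* x :+ c :* z))) :+ (v :+ (:- y)) :* b) refl a b c x₁ x₂ x₃ z₁ z₂ z₃))))) square
      ... | yes _ | yes _ | no z≢x = trans (∑-comm Fs Fs _) (trans (∑-cong Fs (λ b → trans (∑-comm Fs Fs _) (∑-cong Fs (λ c →
              ∑-⟦affine⟧ _ _ (b ⊗ z₂ ⊕ c ⊗ z₃ ⊕ ⊖ (b ⊗ x₂ ⊕ c ⊗ x₃)) (z₁ ⊕ ⊖ x₁) (z≢x ∘ ⊕⊖≡0⇒≡)
                (λ a → solve 9 (λ a b c x y z u v w → (a :* u :+ b :* v :+ c :* w) :+ (:- (a :* x :+ b :* y :+ c :* z))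
                  := (b :* v :+ c :* w :+ (:- (b :* y :+ c :* z))) :+ (u :+ (:- x)) :* a) refl a b c x₁ x₂ x₃ z₁ z₂ z₃))))) square)
      ... | yes refl | yes refl | yes refl = contradiction refl x≢z

    -- The discrete Radon transform, which plays the part of the Fourier transform with integer
    -- values. Proportional forms ξ are all kept, and ξ = 0 puts the whole sum at s = 0.
    radon : (V → ℤ) → V → F → ℤ
    radon f ξ s = ∑[ x ∈ Vs ] ⟦ dot ξ x ≟ s ⟧ * f x

    ∑-radon : ∀ f ξ → ∑ Fs (radon f ξ) ≡ ∑ Vs f
    ∑-radon f ξ = trans (∑-comm Fs Vs _) (∑-cong Vs (λ x → trans (∑-*ʳ Fs (λ s → ⟦ dot ξ x ≟ s ⟧) (f x))
      (trans (cong (_* f x) (Finite.once F-finite (dot ξ x))) (ℤ.*-identityˡ (f x)))))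

    -- Expanding the square counts the ξ that agree on a pair of points: all q³ of them if the
    -- points coincide, q² otherwise. So every pair has weight q², and the diagonal has q³ - q² in
    -- addition.
    radon-parseval : ∀ f → ∑[ ξ ∈ Vs ] ∑[ s ∈ Fs ] radon f ξ s * radon f ξ s ≡
      (Q * Q * Q - Q * Q) * (∑[ x ∈ Vs ] f x * f x) + Q * Q * (∑ Vs f * ∑ Vs f)
    radon-parseval f = begin
      ∑[ ξ ∈ Vs ] ∑[ s ∈ Fs ] radon f ξ s * radon f ξ s
        ≡⟨ ∑-cong Vs (λ ξ → ∑-cong Fs (λ s → ∑-*-∑ Vs Vs _ _)) ⟩
      ∑[ ξ ∈ Vs ] ∑[ s ∈ Fs ] ∑[ x ∈ Vs ] ∑[ z ∈ Vs ] t ξ s x z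
        ≡⟨ ∑-cong Vs (λ ξ → trans (∑-comm Fs Vs _) (∑-cong Vs (λ x → ∑-comm Fs Vs _))) ⟩
      ∑[ ξ ∈ Vs ] ∑[ x ∈ Vs ] ∑[ z ∈ Vs ] ∑[ s ∈ Fs ] t ξ s x z
        ≡⟨ trans (∑-comm Vs Vs _) (∑-cong Vs (λ x → ∑-comm Vs Vs _)) ⟩
      ∑[ x ∈ Vs ] ∑[ z ∈ Vs ] ∑[ ξ ∈ Vs ] ∑[ s ∈ Fs ] t ξ s x z
        ≡⟨ ∑-cong Vs (λ x → ∑-cong Vs (λ z → kernel x z)) ⟩
      ∑[ x ∈ Vs ] ∑[ z ∈ Vs ] (⟦ x ≟V z ⟧ * ((Q * Q * Q - Q * Q) * (f x * f z)) + Q * Q * (f x * f z))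
        ≡⟨ trans (∑-cong Vs (λ x → ∑-+ Vs _ _)) (∑-+ Vs _ _) ⟩
      (∑[ x ∈ Vs ] ∑[ z ∈ Vs ] ⟦ x ≟V z ⟧ * ((Q * Q * Q - Q * Q) * (f x * f z))) + (∑[ x ∈ Vs ] ∑[ z ∈ Vs ] Q * Q * (f x * f z))
        ≡⟨ cong₂ _+_
             (trans (∑-cong Vs (λ x → Finite.∑-δ V-finite x (λ z → (Q * Q * Q - Q * Q) * (f x * f z)))) (∑-*ˡ Vs (Q * Q * Q - Q * Q) _))
             (trans (∑-cong Vs (λ x → ∑-*ˡ Vs (Q * Q) _)) (trans (∑-*ˡ Vs (Q * Q) _) (cong (Q * Q *_) (sym (∑-*-∑ Vs Vs f f))))) ⟩
      (Q * Q * Q - Q * Q) * (∑[ x ∈ Vs ] f x * f x) + Q * Q * (∑ Vs f * ∑ Vs f) ∎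
      where
      open ≡-Reasoning
      t : V → F → V → V → ℤ
      t ξ s x z = (⟦ dot ξ x ≟ s ⟧ * f x) * (⟦ dot ξ z ≟ s ⟧ * f z)
      e₁ : ∀ a b c d → (a * b) * (c * d) ≡ a * (c * (b * d))
      e₁ = ℤ.solve-∀
      e₂ : ∀ q u → q * (q * q) * u ≡ 1ℤ * ((q * q * q - q * q) * u) + q * q * u
      e₂ = ℤ.solve-∀
      e₃ : ∀ q u → q * q * u ≡ 0ℤ * ((q * q * q - q * q) * u) + q * q * u
      e₃ = ℤ.solve-∀
      count : ∀ x z → (∑[ ξ ∈ Vs ] ⟦ dot ξ z ≟ dot ξ x ⟧) * (f x * f z) ≡
        ⟦ x ≟V z ⟧ * ((Q * Q * Q - Q * Q) * (f x * f z)) + Q * Q * (f x * f z)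
      count x z with x ≟V z
      ... | yes refl = trans (cong (_* (f x * f x)) (trans (∑-cong Vs (λ ξ → ⟦⟧-yes (dot ξ x ≟ dot ξ x) refl))
                         (trans (∑-const Vs 1ℤ) (trans (ℤ.*-identityʳ _) length-Vs)))) (e₂ Q (f x * f x))
      ... | no x≢z = trans (cong (_* (f x * f z)) (∑-agreeing-functionals x z x≢z)) (e₃ Q (f x * f z))
      kernel : ∀ x z → ∑[ ξ ∈ Vs ] ∑[ s ∈ Fs ] t ξ s x z ≡ ⟦ x ≟V z ⟧ * ((Q * Q * Q - Q * Q) * (f x * f z)) + Q * Q * (f x * f z)
      kernel x z = trans (∑-cong Vs (λ ξ → trans (∑-cong Fs (λ s → e₁ ⟦ dot ξ x ≟ s ⟧ (f x) ⟦ dot ξ z ≟ s ⟧ (f z)))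
          (Finite.∑-δ F-finite (dot ξ x) (λ s → ⟦ dot ξ z ≟ s ⟧ * (f x * f z)))))
        (trans (∑-*ʳ Vs (λ ξ → ⟦ dot ξ z ≟ dot ξ x ⟧) (f x * f z)) (count x z))

    segment : (V → ℤ) → F → V → ℤ
    segment f y x = ∑[ j ∈ js ] f (x +ᵥ [ toℕ j ] • curve y)

    ∑-segment : ∀ f y → ∑ Vs (segment f y) ≡ H * ∑ Vs f
    ∑-segment f y = trans (∑-comm Vs js (λ x j → f (x +ᵥ [ toℕ j ] • curve y)))
      (trans (∑-cong js (λ j → ∑-V-translate ([ toℕ j ] • curve y) f)) (∑-js-const (∑ Vs f)))

    -- By linearity, a shift by j (y, y², y³) carries the plane at `s` to the plane at s + j ξ(y,
    -- y², y³).
    radon-segment : ∀ f y ξ s → radon (segment f y) ξ s ≡ progression (radon f ξ) (dot ξ (curve y)) s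
    radon-segment f y ξ s = begin
      ∑[ x ∈ Vs ] ⟦ dot ξ x ≟ s ⟧ * segment f y x
        ≡⟨ ∑-cong Vs (λ x → sym (∑-*ˡ js ⟦ dot ξ x ≟ s ⟧ _)) ⟩
      ∑[ x ∈ Vs ] ∑[ j ∈ js ] ⟦ dot ξ x ≟ s ⟧ * f (x +ᵥ [ toℕ j ] • curve y)
        ≡⟨ ∑-comm Vs js _ ⟩
      ∑[ j ∈ js ] ∑[ x ∈ Vs ] ⟦ dot ξ x ≟ s ⟧ * f (x +ᵥ [ toℕ j ] • curve y)
        ≡⟨ ∑-cong js (λ j → ∑-cong Vs (λ x → cong (_* f (x +ᵥ [ toℕ j ] • curve y))
             (⟦⟧-cong (dot ξ x ≟ s) (dot ξ (x +ᵥ [ toℕ j ] • curve y) ≟ (s ⊕ [ toℕ j ] ⊗ dot ξ (curve y)))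
               (λ { refl → dot-+• ξ x [ toℕ j ] (curve y) })
               (λ eq → cancel (trans (sym (dot-+• ξ x [ toℕ j ] (curve y))) eq))))) ⟩
      ∑[ j ∈ js ] ∑[ x ∈ Vs ] ⟦ dot ξ (x +ᵥ [ toℕ j ] • curve y) ≟ (s ⊕ [ toℕ j ] ⊗ dot ξ (curve y)) ⟧ * f (x +ᵥ [ toℕ j ] • curve y)
        ≡⟨ ∑-cong js (λ j → ∑-V-translate ([ toℕ j ] • curve y) (λ x → ⟦ dot ξ x ≟ (s ⊕ [ toℕ j ] ⊗ dot ξ (curve y)) ⟧ * f x)) ⟩
      progression (radon f ξ) (dot ξ (curve y)) s ∎
      where
      open ≡-Reasoning
      open Solver using (solve; _:=_; _:+_; _:*_; :-_; con)
      cancel : ∀ {a b c} → a ⊕ c ≡ b ⊕ c → a ≡ b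
      cancel {a} {b} {c} eq = ⊕⊖≡0⇒≡ (trans (solve 3 (λ a b c → a :+ (:- b) := (a :+ c) :+ (:- (b :+ c))) refl a b c) (≡⇒⊕⊖≡0 eq))

    variance-cong : ∀ {f g} → (∀ s → f s ≡ g s) → variance f ≡ variance g
    variance-cong f≗g = cong₂ (λ a b → Q * a - b * b) (∑-cong Fs (λ s → cong (λ x → x * x) (f≗g s))) (∑-cong Fs f≗g)

    -- Each `radon f ξ` has the same total `∑ Vs f`, so the subtracted squared totals cancel exactly
    -- the second term of `radon-parseval`.
    ∑-variance-radon : ∀ f → ∑[ ξ ∈ Vs ] variance (radon f ξ) ≡ Q * (Q * Q * Q - Q * Q) * (∑[ x ∈ Vs ] f x * f x)
    ∑-variance-radon f = begin
      ∑[ ξ ∈ Vs ] variance (radon f ξ)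
        ≡⟨ ∑-cong Vs (λ ξ → cong (λ t → Q * (∑[ s ∈ Fs ] radon f ξ s * radon f ξ s) + - (t * t)) (∑-radon f ξ)) ⟩
      ∑[ ξ ∈ Vs ] (Q * (∑[ s ∈ Fs ] radon f ξ s * radon f ξ s) + - (m * m))
        ≡⟨ trans (∑-+ Vs _ _) (cong₂ _+_ (trans (∑-*ˡ Vs Q _) (cong (Q *_) (radon-parseval f))) (∑-Vs-const (- (m * m)))) ⟩
      Q * ((Q * Q * Q - Q * Q) * S + Q * Q * (m * m)) + Q * (Q * (Q * - (m * m)))
        ≡⟨ e Q S m ⟩
      Q * (Q * Q * Q - Q * Q) * S ∎
      where
      open ≡-Reasoning
      m = ∑ Vs f
      S = ∑[ x ∈ Vs ] f x * f x
      e : ∀ q s m → q * ((q * q * q - q * q) * s + q * q * (m * m)) + q * (q * (q * - (m * m))) ≡ q * (q * q * q - q * q) * s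
      e = ℤ.solve-∀

    -- The contribution of ξ = 0, for which the cubic ξ(y, y², y³) is constant.
    atZero : ℤ → ℤ
    atZero m = Q * ((Q - 1ℤ) * ((H * m) * (H * m)))

    ∑-variance-curve-0 : ∀ f → ∑[ y ∈ Fs ] variance (progression (radon f 0V) (dot 0V (curve y))) ≡ atZero (∑ Vs f)
    ∑-variance-curve-0 f = trans (∑-cong Fs (λ y → trans (variance-cong (prog y)) (var y))) (∑-Fs-const _)
      where
      open Solver using (solve; _:=_; _:+_; _:*_; :-_; con)
      m = ∑ Vs f
      dot0 : ∀ v → dot 0V v ≡ 0F
      dot0 (x , y , z) = solve 3 (λ x y z → con 0ℤ :* x :+ con 0ℤ :* y :+ con 0ℤ :* z := con 0ℤ) refl x y z
      radon0 : ∀ s → radon f 0V s ≡ ⟦ 0F ≟ s ⟧ * m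
      radon0 s = trans (∑-cong Vs (λ x → cong (λ t → ⟦ t ≟ s ⟧ * f x) (dot0 x))) (∑-*ˡ Vs ⟦ 0F ≟ s ⟧ f)
      g : F → ℤ
      g s = H * (⟦ 0F ≟ s ⟧ * m)
      prog : ∀ y s → progression (radon f 0V) (dot 0V (curve y)) s ≡ g s
      prog y s = trans (∑-cong js (λ j → trans (cong (radon f 0V) (trans (cong (λ t → s ⊕ [ toℕ j ] ⊗ t) (dot0 (curve y)))
        (solve 2 (λ s j → s :+ j :* con 0ℤ := s) refl s [ toℕ j ]))) (radon0 s))) (∑-js-const _)
      ∑g : ∑ Fs g ≡ H * m
      ∑g = trans (∑-*ˡ Fs H _) (cong (H *_) (Finite.∑-δ F-finite 0F (λ _ → m)))
      ∑g² : ∑[ s ∈ Fs ] g s * g s ≡ (H * m) * (H * m)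
      ∑g² = trans (∑-cong Fs (λ s → e H m ⟦ 0F ≟ s ⟧)) (trans (Finite.∑-δ F-finite 0F (λ s → ⟦ 0F ≟ s ⟧ * ((H * m) * (H * m))))
        (trans (cong (_* ((H * m) * (H * m))) (⟦⟧-yes (0F ≟ 0F) refl)) (ℤ.*-identityˡ _)))
        where
        e : ∀ h m d → (h * (d * m)) * (h * (d * m)) ≡ d * (d * ((h * m) * (h * m)))
        e = ℤ.solve-∀
      var : ∀ (y : F) → variance g ≡ (Q - 1ℤ) * ((H * m) * (H * m))
      var _ = trans (cong₂ (λ a b → Q * a - b * b) ∑g² ∑g) (e Q ((H * m) * (H * m)))
        where
        e : ∀ q t → q * t - t ≡ (q - 1ℤ) * t
        e = ℤ.solve-∀

    -- For ξ ≠ 0, grouping the `y` by the value `c` of the cubic compares the sum with three times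
    -- the sum over all differences `c`; enlarging the multiplicities to three is legitimate because
    -- variances are nonnegative.
    ∑-variance-curve-≤ : ∀ f ξ → ∑[ y ∈ Fs ] variance (progression (radon f ξ) (dot ξ (curve y))) ≤
      + 3 * (Q * H * variance (radon f ξ)) + ⟦ 0V ≟V ξ ⟧ * atZero (∑ Vs f)
    ∑-variance-curve-≤ f ξ with 0V ≟V ξ
    ... | yes refl = begin
      ∑[ y ∈ Fs ] variance (progression (radon f 0V) (dot 0V (curve y)))  ≡⟨ trans (∑-variance-curve-0 f) (e (atZero (∑ Vs f))) ⟩
      0ℤ + 1ℤ * atZero (∑ Vs f)                                           ≤⟨ ℤ.+-monoˡ-≤ (1ℤ * atZero (∑ Vs f)) 0≤ ⟩
      + 3 * (Q * H * variance (radon f 0V)) + 1ℤ * atZero (∑ Vs f)        ∎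
      where
      open ℤ.≤-Reasoning
      e : ∀ k → k ≡ 0ℤ + 1ℤ * k
      e = ℤ.solve-∀
      -- At ξ = 0 the first term is mere slack; it is kept so that a single bound can be summed over
      -- all ξ.
      0≤ : 0ℤ ≤ + 3 * (Q * H * variance (radon f 0V))
      0≤ = ℤ.*-monoˡ-≤-nonNeg (+ 3) (subst (0ℤ ≤_) (∑-variance-progression (radon f 0V)) (∑-nonneg Fs (λ c → variance-nonneg (progression (radon f 0V) c))))
    ... | no 0≢ξ = begin
      ∑[ y ∈ Fs ] E (dot ξ (curve y))                                     ≡⟨ ∑-cong Fs (λ y → sym (Finite.∑-δ F-finite (dot ξ (curve y)) E)) ⟩
      ∑[ y ∈ Fs ] ∑[ c ∈ Fs ] ⟦ dot ξ (curve y) ≟ c ⟧ * E c               ≡⟨ ∑-comm Fs Fs _ ⟩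
      ∑[ c ∈ Fs ] ∑[ y ∈ Fs ] ⟦ dot ξ (curve y) ≟ c ⟧ * E c               ≤⟨ ∑-mono Fs bound ⟩
      ∑[ c ∈ Fs ] + 3 * E c                                               ≡⟨ trans (∑-*ˡ Fs (+ 3) E) (cong (+ 3 *_) (∑-variance-progression (radon f ξ))) ⟩
      + 3 * (Q * H * variance (radon f ξ))                                ≡⟨ e (+ 3 * (Q * H * variance (radon f ξ))) (atZero (∑ Vs f)) ⟩
      + 3 * (Q * H * variance (radon f ξ)) + 0ℤ * atZero (∑ Vs f)         ∎
      where
      open ℤ.≤-Reasoning
      e : ∀ k t → k ≡ k + 0ℤ * t
      e = ℤ.solve-∀
      E : F → ℤ
      E c = variance (progression (radon f ξ) c)
      bound : ∀ c → ∑[ y ∈ Fs ] ⟦ dot ξ (curve y) ≟ c ⟧ * E c ≤ + 3 * E c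
      bound c = subst (_≤ + 3 * E c) (sym (∑-*ʳ Fs (λ y → ⟦ dot ξ (curve y) ≟ c ⟧) (E c)))
        (ℤ.*-monoʳ-≤-nonNeg (E c) {{ℤ.nonNegative (variance-nonneg (progression (radon f ξ) c))}} (∑-curve≤3 (0≢ξ ∘ sym) c))

    -- The second moment of segment counts, and the bound on independent sets

    energy : (V → ℤ) → F → ℤ
    energy f y = ∑[ x ∈ Vs ] segment f y x * segment f y x

    1<Q : 1ℤ ℤ.< Q
    1<Q = ℤ.+<+ (prime>1 q-prime)

    -- Summing `∑-variance-curve-≤` over ξ, `∑-variance-radon` evaluates the left side for the
    -- segment counts and the right side for `f`; the common factor q (q - 1) is cancelled. The last
    -- term, which comes from ξ = 0, is exactly the share of the mean, q² · q · (H m)² / q³ with m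
    -- the total of `f`, and the first term bounds the fluctuation around it.
    ∑-energy-≤ : ∀ f → Q * Q * ∑ Fs (energy f) ≤ + 3 * (H * (Q * Q * Q)) * (∑[ x ∈ Vs ] f x * f x) + (H * ∑ Vs f) * (H * ∑ Vs f)
    ∑-energy-≤ f = ℤ.*-cancelˡ-≤-pos _ _ (Q * (Q - 1ℤ)) (subst₂ _≤_ lhs rhs (∑-mono Vs (∑-variance-curve-≤ f)))
      where
      m = ∑ Vs f
      S = ∑[ x ∈ Vs ] f x * f x
      instance
        pos₁ : ℤ.Positive Q
        pos₁ = ℤ.positive (ℤ.<-trans (ℤ.+<+ (s≤s z≤n)) 1<Q)
        pos : ℤ.Positive (Q * (Q - 1ℤ))
        pos = ℤ.positive (subst (ℤ._< Q * (Q - 1ℤ)) (ℤ.*-zeroʳ Q) (ℤ.*-monoˡ-<-pos Q (ℤ.+-monoˡ-< (- 1ℤ) 1<Q)))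
      open ≡-Reasoning
      lhs : ∑[ ξ ∈ Vs ] ∑[ y ∈ Fs ] variance (progression (radon f ξ) (dot ξ (curve y))) ≡ Q * (Q - 1ℤ) * (Q * Q * ∑ Fs (energy f))
      lhs = begin
        ∑[ ξ ∈ Vs ] ∑[ y ∈ Fs ] variance (progression (radon f ξ) (dot ξ (curve y)))
          ≡⟨ ∑-cong Vs (λ ξ → ∑-cong Fs (λ y → variance-cong (λ s → sym (radon-segment f y ξ s)))) ⟩
        ∑[ ξ ∈ Vs ] ∑[ y ∈ Fs ] variance (radon (segment f y) ξ)
          ≡⟨ trans (∑-comm Vs Fs _) (∑-cong Fs (λ y → ∑-variance-radon (segment f y))) ⟩
        ∑[ y ∈ Fs ] Q * (Q * Q * Q - Q * Q) * energy f y
          ≡⟨ trans (∑-*ˡ Fs (Q * (Q * Q * Q - Q * Q)) (energy f)) (e Q (∑ Fs (energy f))) ⟩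
        Q * (Q - 1ℤ) * (Q * Q * ∑ Fs (energy f)) ∎
        where
        e : ∀ q s → q * (q * q * q - q * q) * s ≡ q * (q - 1ℤ) * (q * q * s)
        e = ℤ.solve-∀
      rhs : ∑[ ξ ∈ Vs ] (+ 3 * (Q * H * variance (radon f ξ)) + ⟦ 0V ≟V ξ ⟧ * atZero m) ≡ Q * (Q - 1ℤ) * (+ 3 * (H * (Q * Q * Q)) * S + (H * m) * (H * m))
      rhs = begin
        ∑[ ξ ∈ Vs ] (+ 3 * (Q * H * variance (radon f ξ)) + ⟦ 0V ≟V ξ ⟧ * atZero m)
          ≡⟨ trans (∑-+ Vs _ _) (cong₂ _+_ (trans (∑-*ˡ Vs (+ 3) _) (cong (+ 3 *_) (∑-*ˡ Vs (Q * H) _))) (Finite.∑-δ V-finite 0V (λ _ → atZero m))) ⟩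
        + 3 * (Q * H * (∑[ ξ ∈ Vs ] variance (radon f ξ))) + atZero m
          ≡⟨ cong (λ t → + 3 * (Q * H * t) + atZero m) (∑-variance-radon f) ⟩
        + 3 * (Q * H * (Q * (Q * Q * Q - Q * Q) * S)) + atZero m
          ≡⟨ e Q H S ((H * m) * (H * m)) ⟩
        Q * (Q - 1ℤ) * (+ 3 * (H * (Q * Q * Q)) * S + (H * m) * (H * m)) ∎
        where
        e : ∀ q h s t → + 3 * (q * h * (q * (q * q * q - q * q) * s)) + q * ((q - 1ℤ) * t) ≡ q * (q - 1ℤ) * (+ 3 * (h * (q * q * q)) * s + t)
        e = ℤ.solve-∀

    -- X contains no two points differing by i (y, y², y³) with 2h ≤ i < 4h, so for each x at most one
    -- of the segments at x and at x + 3h (y, y², y³) meets X.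
    module _ {X : V → Set} (X? : ∀ x → Dec (X x))
      (independent : ∀ x y i → 2 ℕ.* h ℕ.≤ i → i ℕ.< 4 ℕ.* h → y ≢ 0F → X x → ¬ X (x +ᵥ [ i ] • curve y)) where

      private
        f : V → ℤ
        f x = ⟦ X? x ⟧
        m = ∑ Vs f

      segments-disjoint : ∀ y → y ≢ 0F → ∀ x → segment f y x * segment f y (x +ᵥ [ 3 ℕ.* h ] • curve y) ≡ 0ℤ
      segments-disjoint y y≢0 x = trans (∑-*-∑ js js _ _) (∑-zero js (λ i → ∑-zero js (λ j → product i j)))
        where
        open Solver using (solve; _:=_; _:+_; _:*_; :-_; con)
        t = [ 3 ℕ.* h ]
        product : ∀ i j → f (x +ᵥ [ toℕ i ] • curve y) * f (x +ᵥ t • curve y +ᵥ [ toℕ j ] • curve y) ≡ 0ℤ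
        product i j with X? (x +ᵥ [ toℕ i ] • curve y)
        ... | no _ = ℤ.*-zeroˡ (f (x +ᵥ t • curve y +ᵥ [ toℕ j ] • curve y))
        ... | yes Xx = trans (cong (1ℤ *_) (⟦⟧-no (X? (x +ᵥ t • curve y +ᵥ [ toℕ j ] • curve y)) (λ Xz →
                independent (x +ᵥ [ toℕ i ] • curve y) y k 2h≤k k<4h y≢0 Xx (subst X (move x (curve y)) Xz)))) (ℤ.*-zeroʳ 1ℤ)
          where
          i<h = Fin.toℕ<n i
          k = 3 ℕ.* h ℕ.+ toℕ j ℕ.∸ toℕ i
          k+i≡ : k ℕ.+ toℕ i ≡ 3 ℕ.* h ℕ.+ toℕ j
          k+i≡ = ℕ.m∸n+n≡m (ℕ.≤-trans (ℕ.<⇒≤ i<h) (ℕ.≤-trans (ℕ.m≤m+n h (2 ℕ.* h)) (ℕ.m≤m+n (3 ℕ.* h) (toℕ j))))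
          2h≤k : 2 ℕ.* h ℕ.≤ k
          2h≤k = ℕ.+-cancelʳ-≤ (toℕ i) _ _ (ℕ.≤-trans (ℕ.+-monoʳ-≤ (2 ℕ.* h) (ℕ.<⇒≤ i<h))
            (ℕ.≤-trans (ℕ.≤-reflexive (ℕ.+-comm (2 ℕ.* h) h)) (ℕ.≤-trans (ℕ.m≤m+n (3 ℕ.* h) (toℕ j)) (ℕ.≤-reflexive (sym k+i≡)))))
          k<4h : k ℕ.< 4 ℕ.* h
          k<4h = ℕ.≤-<-trans (ℕ.m∸n≤m (3 ℕ.* h ℕ.+ toℕ j) (toℕ i)) (ℕ.<-≤-trans (ℕ.+-monoʳ-< (3 ℕ.* h) (Fin.toℕ<n j)) (ℕ.≤-reflexive (ℕ.+-comm (3 ℕ.* h) h)))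
          scalars : t ⊕ [ toℕ j ] ≡ [ toℕ i ] ⊕ [ k ]
          scalars = trans (sym (π-+ (+ (3 ℕ.* h)) (+ toℕ j))) (trans (cong (λ n → π (+ n)) (trans (sym k+i≡) (ℕ.+-comm k (toℕ i)))) (π-+ (+ toℕ i) (+ k)))
          coordinate : ∀ a u → a ⊕ t ⊗ u ⊕ [ toℕ j ] ⊗ u ≡ a ⊕ [ toℕ i ] ⊗ u ⊕ [ k ] ⊗ u
          coordinate a u = trans (solve 4 (λ a t j u → a :+ t :* u :+ j :* u := a :+ (t :+ j) :* u) refl a t [ toℕ j ] u)
            (trans (cong (λ c → a ⊕ c ⊗ u) scalars) (solve 4 (λ a t j u → a :+ (t :+ j) :* u := a :+ t :* u :+ j :* u) refl a [ toℕ i ] [ k ] u))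
          move : ∀ x v → x +ᵥ t • v +ᵥ [ toℕ j ] • v ≡ x +ᵥ [ toℕ i ] • v +ᵥ [ k ] • v
          move (a , b , c) (u , v , w) = cong₂ _,_ (coordinate a u) (cong₂ _,_ (coordinate b v) (coordinate c w))

      -- Cauchy-Schwarz is applied to the sum of the counts at x and at x + 3h (y, y², y³). Its
      -- total is twice that of one count, but as the cross terms vanish its sum of squares also
      -- only doubles. Hence the factor 2 over what Cauchy-Schwarz gives for a single count.
      energy-≥ : ∀ y → y ≢ 0F → + 2 * ((H * m) * (H * m)) ≤ Q * (Q * Q) * energy f y
      energy-≥ y y≢0 = ℤ.*-cancelˡ-≤-pos _ _ (+ 2) (begin
        + 2 * (+ 2 * ((H * m) * (H * m)))     ≡⟨ e₁ (H * m) ⟩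
        (H * m + H * m) * (H * m + H * m)     ≡⟨ cong (λ s → s * s) sum ⟨
        ∑ Vs g * ∑ Vs g                       ≤⟨ ∑-square-≤ Vs g ⟩
        + length Vs * (∑[ x ∈ Vs ] g x * g x) ≡⟨ cong₂ _*_ length-Vs squares ⟩
        Q * (Q * Q) * (N + N)                 ≡⟨ e₂ (Q * (Q * Q)) N ⟩
        + 2 * (Q * (Q * Q) * N)               ∎)
        where
        open ℤ.≤-Reasoning
        n = segment f y
        N = energy f y
        v = [ 3 ℕ.* h ] • curve y
        g : V → ℤ
        g x = n x + n (x +ᵥ v)
        e₁ : ∀ k → + 2 * (+ 2 * (k * k)) ≡ (k + k) * (k + k)
        e₁ = ℤ.solve-∀
        e₂ : ∀ a b → a * (b + b) ≡ + 2 * (a * b)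
        e₂ = ℤ.solve-∀
        e₃ : ∀ a b → (a + b) * (a + b) ≡ a * a + b * b + + 2 * (a * b)
        e₃ = ℤ.solve-∀
        sum : ∑ Vs g ≡ H * m + H * m
        sum = trans (∑-+ Vs n (λ x → n (x +ᵥ v))) (cong₂ _+_ (∑-segment f y) (trans (∑-V-translate v n) (∑-segment f y)))
        squares : ∑[ x ∈ Vs ] g x * g x ≡ N + N
        squares = trans (∑-cong Vs (λ x → trans (e₃ (n x) (n (x +ᵥ v)))
            (trans (cong (λ t → n x * n x + n (x +ᵥ v) * n (x +ᵥ v) + + 2 * t) (segments-disjoint y y≢0 x)) (ℤ.+-identityʳ _))))
          (trans (∑-+ Vs _ _) (cong (λ t → N + t) (∑-V-translate v (λ x → n x * n x))))

      -- From below, each of the q - 1 nonzero directions contributes 2 M² with M = H m; from above,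
      -- the mean accounts for M² over all q directions together with the normalising factor. The
      -- difference 2 (q - 1) - q = q - 2 remains positive for q > 2. As `f` is an indicator, its
      -- sum of squares is m, so the fluctuation term is linear in M and one factor M can be
      -- cancelled.
      independent-≤ : (Q - + 2) * (H * m) ≤ + 3 * (Q * Q * (Q * Q))
      independent-≤ = cancel (H * m) refl
        where
        open ℤ.≤-Reasoning
        M² = (H * m) * (H * m)
        lower : (Q - 1ℤ) * (+ 2 * M²) ≤ Q * (Q * Q * ∑ Fs (energy f))
        lower = begin
          (Q - 1ℤ) * (+ 2 * M²)                                 ≡⟨ e Q (+ 2 * M²) ⟩
          Q * (+ 2 * M²) + - 1ℤ * (+ 2 * M²)                    ≡⟨ cong₂ _+_ (∑-Fs-const (+ 2 * M²)) (trans (∑-*ˡ Fs (- 1ℤ) _) (cong (- 1ℤ *_) (Finite.∑-δ F-finite 0F (λ _ → + 2 * M²)))) ⟨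
          (∑[ y ∈ Fs ] + 2 * M²) + (∑[ y ∈ Fs ] - 1ℤ * (⟦ 0F ≟ y ⟧ * (+ 2 * M²)))  ≡⟨ ∑-+ Fs (λ _ → + 2 * M²) _ ⟨
          ∑[ y ∈ Fs ] (+ 2 * M² + - 1ℤ * (⟦ 0F ≟ y ⟧ * (+ 2 * M²)))  ≤⟨ ∑-mono Fs pointwise ⟩
          ∑[ y ∈ Fs ] Q * (Q * Q) * energy f y                  ≡⟨ ∑-*ˡ Fs (Q * (Q * Q)) (energy f) ⟩
          Q * (Q * Q) * ∑ Fs (energy f)                         ≡⟨ ℤ.*-assoc Q (Q * Q) (∑ Fs (energy f)) ⟩
          Q * (Q * Q * ∑ Fs (energy f))                         ∎
          where
          e : ∀ q k → (q - 1ℤ) * k ≡ q * k + - 1ℤ * k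
          e = ℤ.solve-∀
          e₁ : ∀ k → k + - 1ℤ * (1ℤ * k) ≡ 0ℤ
          e₁ = ℤ.solve-∀
          e₂ : ∀ k → k ≡ k + - 1ℤ * (0ℤ * k)
          e₂ = ℤ.solve-∀
          -- At y = 0 the direction vanishes and `energy-≥` says nothing; the subtracted indicator
          -- reduces the claim there to nonnegativity.
          pointwise : ∀ y → + 2 * M² + - 1ℤ * (⟦ 0F ≟ y ⟧ * (+ 2 * M²)) ≤ Q * (Q * Q) * energy f y
          pointwise y with 0F ≟ y
          ... | yes _ = begin
            + 2 * M² + - 1ℤ * (1ℤ * (+ 2 * M²))   ≡⟨ e₁ (+ 2 * M²) ⟩
            0ℤ                                    ≡⟨ ℤ.*-zeroʳ (Q * (Q * Q)) ⟨
            Q * (Q * Q) * 0ℤ                      ≤⟨ ℤ.*-monoˡ-≤-nonNeg (Q * (Q * Q)) {{ℤ.nonNegative (subst (0ℤ ≤_) length-Vs (+≤+ z≤n))}} (∑-nonneg Vs (λ x → 0≤i*i (segment f y x))) ⟩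
            Q * (Q * Q) * energy f y              ∎
          ... | no 0≢y = subst (_≤ Q * (Q * Q) * energy f y) (e₂ (+ 2 * M²)) (energy-≥ y (0≢y ∘ sym))
        main : (Q - 1ℤ) * (+ 2 * M²) ≤ Q * (+ 3 * (H * (Q * Q * Q)) * m + M²)
        main = ℤ.≤-trans lower (ℤ.*-monoˡ-≤-nonNeg Q (subst (λ s → Q * Q * ∑ Fs (energy f) ≤ + 3 * (H * (Q * Q * Q)) * s + M²)
          (∑-cong Vs (λ x → ⟦⟧-square (X? x))) (∑-energy-≤ f)))
        main′ : (Q - + 2) * (H * m) * (H * m) ≤ + 3 * (Q * Q * (Q * Q)) * (H * m)
        main′ = ℤ.0≤i-j⇒j≤i (subst (0ℤ ≤_) (e Q H m) (ℤ.i≤j⇒0≤j-i main))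
          where
          e : ∀ q h m → q * (+ 3 * (h * (q * q * q)) * m + (h * m) * (h * m)) - (q - 1ℤ) * (+ 2 * ((h * m) * (h * m)))
              ≡ + 3 * (q * q * (q * q)) * (h * m) - (q - + 2) * (h * m) * (h * m)
          e = ℤ.solve-∀
        0≤Hm : 0ℤ ≤ H * m
        0≤Hm = subst (_≤ H * m) (ℤ.*-zeroʳ H) (ℤ.*-monoˡ-≤-nonNeg H (∑-nonneg Vs (λ x → ⟦⟧-nonneg (X? x))))
        cancel : ∀ k → k ≡ H * m → (Q - + 2) * (H * m) ≤ + 3 * (Q * Q * (Q * Q))
        cancel (+ zero) eq = begin
          (Q - + 2) * (H * m)       ≡⟨ cong ((Q - + 2) *_) eq ⟨
          (Q - + 2) * 0ℤ            ≡⟨ ℤ.*-zeroʳ (Q - + 2) ⟩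
          0ℤ                        ≤⟨ ℤ.*-monoˡ-≤-nonNeg (+ 3) (0≤i*i (Q * Q)) ⟩
          + 3 * (Q * Q * (Q * Q))   ∎
        cancel +[1+ k ] eq = ℤ.*-cancelʳ-≤-pos _ _ (H * m) {{subst ℤ.Positive eq _}} main′
        cancel -[1+ k ] eq = contradiction (subst (0ℤ ≤_) (sym eq) 0≤Hm) (λ ())

  -- From F_q³ to residues modulo p

  module Transfer (q : ℕ) (q-prime : Prime q) (h : ℕ) (0<h : 0 ℕ.< h) (6h≤q : 6 ℕ.* h ℕ.≤ q) (p : ℕ) {{p≢0 : NonZero p}}
    (W : ℕ) (3q≤2W : 3 ℕ.* q ℕ.≤ 2 ℕ.* W) (P : ℕ) (ρ : ℕ) (ρ≤q : ρ ℕ.≤ q) (p≡ : p ≡ ρ ℕ.+ P ℕ.* q)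
    (large : 4 ℕ.* q ℕ.* (4 ℕ.* q ℕ.* (4 ℕ.* W)) ℕ.≤ P) where
    private
      instance
        q≢0 : NonZero q
        q≢0 = prime⇒nonZero q-prime
      h≤q : h ℕ.≤ q
      h≤q = ℕ.≤-trans (ℕ.m≤m+n h (5 ℕ.* h)) 6h≤q
    open PrimeField q q-prime
    open CurveGraph q q-prime h h≤q

    module Zp = Residues p

    -- Place values with room for a combination of three members: such a combination has digits of
    -- size at most 3q, hence the factor 4q from one place to the next. The lowest place holds |w| <
    -- 2W together with |k ρ| ≤ 3q ≤ 2W, hence 4W.
    M D : ℕ
    M = 4 ℕ.* W
    D = 4 ℕ.* q ℕ.* M

    value : ℤ → ℤ → ℤ → ℤ → ℤ
    value a b c w = a * + P + (b * + D + (c * + M + w))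

    +p≡ : + p ≡ + ρ + + P * + q
    +p≡ = trans (cong +_ p≡) (cong (λ x → + ρ + x) (ℤ.pos-* P q))

    ∣xd+y∣< : ∀ {x y} d → ∣ x ∣ ℕ.≤ 3 ℕ.* q → ∣ y ∣ ℕ.< d → ∣ x * + d + y ∣ ℕ.< 4 ℕ.* q ℕ.* d
    ∣xd+y∣< {x} {y} d ∣x∣≤ ∣y∣< = begin-strict
      ∣ x * + d + y ∣               ≤⟨ ℤ.∣i+j∣≤∣i∣+∣j∣ (x * + d) y ⟩
      ∣ x * + d ∣ ℕ.+ ∣ y ∣         ≡⟨ cong (ℕ._+ ∣ y ∣) (ℤ.abs-* x (+ d)) ⟩
      ∣ x ∣ ℕ.* d ℕ.+ ∣ y ∣         <⟨ ℕ.+-mono-≤-< (ℕ.*-monoˡ-≤ d ∣x∣≤) ∣y∣< ⟩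
      3 ℕ.* q ℕ.* d ℕ.+ d           ≤⟨ ℕ.+-monoʳ-≤ (3 ℕ.* q ℕ.* d) (ℕ.m≤n*m d q) ⟩
      3 ℕ.* q ℕ.* d ℕ.+ q ℕ.* d     ≡⟨ e q d ⟩
      4 ℕ.* q ℕ.* d                 ∎
      where
      open ℕ.≤-Reasoning
      e : ∀ q d → 3 ℕ.* q ℕ.* d ℕ.+ q ℕ.* d ≡ 4 ℕ.* q ℕ.* d
      e = ℕSolver.solve-∀

    -- Since p = ρ + P q, the multiple of p only affects the leading digit modulo q and, by at most
    -- 3q, the remainder.
    digits-unique : ∀ a b c w k → ∣ a ∣ ℕ.≤ 3 ℕ.* q → ∣ b ∣ ℕ.≤ 3 ℕ.* q → ∣ c ∣ ℕ.≤ 3 ℕ.* q → ∣ w ∣ ℕ.< 2 ℕ.* W →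
      value a b c w ≡ k * + p → a ≡ k * + q × b ≡ 0ℤ × c ≡ 0ℤ × w ≡ k * + ρ
    digits-unique a b c w k ∣a∣≤ ∣b∣≤ ∣c∣≤ ∣w∣< eq =
      ℤ.i-j≡0⇒i≡j a (k * + q) (proj₁ r₁) , proj₁ r₂ , proj₁ r₃ , ℤ.i-j≡0⇒i≡j w (k * + ρ) (proj₂ r₃)
      where
      w′ = w - k * + ρ
      middle : ∀ {w} → ∣ w ∣ ℕ.< M → ∣ b * + D + (c * + M + w) ∣ ℕ.< P
      middle ∣w∣< = ℕ.<-≤-trans (∣xd+y∣< {b} D ∣b∣≤ (∣xd+y∣< {c} M ∣c∣≤ ∣w∣<)) large
      2W≤M : 2 ℕ.* W ℕ.≤ M
      2W≤M = ℕ.*-monoˡ-≤ W {2} {4} (s≤s (s≤s z≤n))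
      -- The digits keep the value below 4 q P in modulus, and q P ≤ p. So |k| ≤ 3, and k ρ is small
      -- enough for the lowest place.
      ∣k∣<4 : ∣ k ∣ ℕ.< 4
      ∣k∣<4 = ℕ.*-cancelʳ-< (P ℕ.* q) ∣ k ∣ 4 (begin-strict
        ∣ k ∣ ℕ.* (P ℕ.* q)   ≤⟨ ℕ.*-monoʳ-≤ ∣ k ∣ (ℕ.≤-trans (ℕ.m≤n+m (P ℕ.* q) ρ) (ℕ.≤-reflexive (sym p≡))) ⟩
        ∣ k ∣ ℕ.* p           ≡⟨ ℤ.abs-* k (+ p) ⟨
        ∣ k * + p ∣           ≡⟨ cong ∣_∣ eq ⟨
        ∣ value a b c w ∣     <⟨ ∣xd+y∣< {a} P ∣a∣≤ (middle (ℕ.<-≤-trans ∣w∣< 2W≤M)) ⟩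
        4 ℕ.* q ℕ.* P         ≡⟨ trans (ℕ.*-assoc 4 q P) (cong (4 ℕ.*_) (ℕ.*-comm q P)) ⟩
        4 ℕ.* (P ℕ.* q)       ∎)
        where open ℕ.≤-Reasoning
      ∣w′∣<M : ∣ w′ ∣ ℕ.< M
      ∣w′∣<M = begin-strict
        ∣ w - k * + ρ ∣               ≤⟨ ℤ.∣i-j∣≤∣i∣+∣j∣ w (k * + ρ) ⟩
        ∣ w ∣ ℕ.+ ∣ k * + ρ ∣         <⟨ ℕ.+-mono-<-≤ ∣w∣< (ℕ.≤-trans (ℕ.≤-reflexive (ℤ.abs-* k (+ ρ))) (ℕ.*-mono-≤ (ℕ.≤-pred ∣k∣<4) ρ≤q)) ⟩
        2 ℕ.* W ℕ.+ 3 ℕ.* q           ≤⟨ ℕ.+-monoʳ-≤ (2 ℕ.* W) 3q≤2W ⟩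
        2 ℕ.* W ℕ.+ 2 ℕ.* W           ≡⟨ ℕ.*-distribʳ-+ W 2 2 ⟨
        M                             ∎
        where open ℕ.≤-Reasoning
      r₁ : a - k * + q ≡ 0ℤ × b * + D + (c * + M + w′) ≡ 0ℤ
      r₁ = digit-zero P (begin
        (a - k * + q) * + P + (b * + D + (c * + M + (w - k * + ρ)))  ≡⟨ e a k (+ q) (+ P) (b * + D) (c * + M) w (+ ρ) ⟩
        value a b c w - k * (+ ρ + + P * + q)                        ≡⟨ cong₂ (λ x y → x - k * y) eq (sym +p≡) ⟩
        k * + p - k * + p                                            ≡⟨ ℤ.i≡j⇒i-j≡0 {k * + p} refl ⟩
        0ℤ                                                           ∎) (middle ∣w′∣<M)
        where
        open ≡-Reasoning
        e : ∀ a k q P b c w ρ → (a - k * q) * P + (b + (c + (w - k * ρ))) ≡ a * P + (b + (c + w)) - k * (ρ + P * q)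
        e = ℤ.solve-∀
      r₂ : b ≡ 0ℤ × c * + M + w′ ≡ 0ℤ
      r₂ = digit-zero D (proj₂ r₁) (∣xd+y∣< {c} M ∣c∣≤ ∣w′∣<M)
      r₃ : c ≡ 0ℤ × w′ ≡ 0ℤ
      r₃ = digit-zero M (proj₂ r₂) ∣w′∣<M

    Digit : Set
    Digit = Fin (q ℕ.+ q)

    digit : Digit → ℤ
    digit a = + toℕ a - + q

    ∣digit∣≤ : ∀ a → ∣ digit a ∣ ℕ.≤ q
    ∣digit∣≤ a with ℕ.≤-total (toℕ a) q
    ... | inj₁ a≤q = ℕ.≤-trans (ℕ.≤-reflexive (trans (cong ∣_∣ (ℤ.m-n≡m⊖n (toℕ a) q)) (ℤ.∣⊖∣-≤ a≤q))) (ℕ.m∸n≤m q (toℕ a))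
    ... | inj₂ q≤a = ℕ.≤-trans (ℕ.≤-reflexive (cong ∣_∣ (trans (ℤ.m-n≡m⊖n (toℕ a) q) (ℤ.⊖-≥ q≤a))))
                       (ℕ.+-cancelʳ-≤ q _ _ (ℕ.≤-trans (ℕ.≤-reflexive (ℕ.m∸n+n≡m q≤a)) (ℕ.<⇒≤ (Fin.toℕ<n a))))

    ∃digit : ∀ {m n} → m ℕ.< q → n ℕ.≤ q → ∃ λ a → digit a ≡ + m - + n
    ∃digit {m} {n} m<q n≤q = fromℕ< m+[q∸n]<2q , (begin
      + toℕ (fromℕ< m+[q∸n]<2q) - + q          ≡⟨ cong (λ x → + x - + q) (Fin.toℕ-fromℕ< m+[q∸n]<2q) ⟩
      + m + + (q ℕ.∸ n) - + q                  ≡⟨ cong (λ x → + m + + (q ℕ.∸ n) - + x) (ℕ.m∸n+n≡m n≤q) ⟨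
      + m + + (q ℕ.∸ n) - (+ (q ℕ.∸ n) + + n)  ≡⟨ e (+ m) (+ (q ℕ.∸ n)) (+ n) ⟩
      + m - + n                                ∎)
      where
      open ≡-Reasoning
      m+[q∸n]<2q : m ℕ.+ (q ℕ.∸ n) ℕ.< q ℕ.+ q
      m+[q∸n]<2q = ℕ.+-mono-<-≤ m<q (ℕ.m∸n≤m q n)
      e : ∀ m r n → m + r - (r + n) ≡ m - n
      e = ℤ.solve-∀

    ∣a+b-c∣≤ : ∀ a b c → ∣ digit a + digit b - digit c ∣ ℕ.≤ 3 ℕ.* q
    ∣a+b-c∣≤ a b c = begin
      ∣ digit a + digit b - digit c ∣                 ≤⟨ ℤ.∣i-j∣≤∣i∣+∣j∣ (digit a + digit b) (digit c) ⟩
      ∣ digit a + digit b ∣ ℕ.+ ∣ digit c ∣           ≤⟨ ℕ.+-mono-≤ (ℤ.∣i+j∣≤∣i∣+∣j∣ (digit a) (digit b)) (∣digit∣≤ c) ⟩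
      ∣ digit a ∣ ℕ.+ ∣ digit b ∣ ℕ.+ q               ≤⟨ ℕ.+-monoˡ-≤ q (ℕ.+-mono-≤ (∣digit∣≤ a) (∣digit∣≤ b)) ⟩
      q ℕ.+ q ℕ.+ q                                   ≡⟨ e q ⟩
      3 ℕ.* q                                         ∎
      where
      open ℕ.≤-Reasoning
      e : ∀ q → q ℕ.+ q ℕ.+ q ≡ 3 ℕ.* q
      e = ℕSolver.solve-∀

    ∣digit∣≤3q : ∀ a → ∣ digit a ∣ ℕ.≤ 3 ℕ.* q
    ∣digit∣≤3q a = ℕ.≤-trans (∣digit∣≤ a) (ℕ.m≤m+n q (2 ℕ.* q))

    residues : Digit → Digit → Digit → V
    residues a b c = π (digit a) , π (digit b) , π (digit c)

    -- The digits range over [-q, q), not only over residues, so that A contains the differences of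
    -- lattice points in both orders.
    Member : Fin p → Set
    Member x = ∃ λ (i : Fin (4 ℕ.* h)) → ∃ λ (y : F) → ∃ λ (a : Digit) → ∃ λ (b : Digit) → ∃ λ (c : Digit) → ∃ λ (w : Fin W) →
      2 ℕ.* h ℕ.≤ toℕ i × y ≢ 0F × residues a b c ≡ [ toℕ i ] • curve y × Zp.π (value (digit a) (digit b) (digit c) (+ toℕ w)) ≡ x

    Member? : Decidable Member
    Member? x = Fin.any? λ i → Fin.any? λ y → Fin.any? λ a → Fin.any? λ b → Fin.any? λ c → Fin.any? λ w →
      (2 ℕ.* h ℕ.≤? toℕ i) ×-dec ¬? (y ≟ 0F) ×-dec (residues a b c ≟V ([ toℕ i ] • curve y)) ×-dec (Zp.π (value (digit a) (digit b) (digit c) (+ toℕ w)) Fin.≟ x)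

    A : Subset p
    A = subset Member?

    4h≤q : 4 ℕ.* h ℕ.≤ q
    4h≤q = ℕ.≤-trans (ℕ.*-monoˡ-≤ h {4} {6} (s≤s (s≤s (s≤s (s≤s z≤n))))) 6h≤q

    π-+-injective : ∀ {i j} → i ℕ.< q → j ℕ.< q → π (+ i) ≡ π (+ j) → i ≡ j
    π-+-injective i<q j<q eq = i+kn≡j⇒i≡j (proj₁ (π-injective eq)) i<q j<q (proj₂ (π-injective eq))

    []≢0 : ∀ {i} → 2 ℕ.* h ℕ.≤ i → i ℕ.< 4 ℕ.* h → [ i ] ≢ 0F
    []≢0 {i} 2h≤i i<4h eq = ℕ.<-irrefl (sym (π-+-injective (ℕ.<-≤-trans i<4h 4h≤q) (ℕ.≤-<-trans z≤n (prime>1 q-prime)) eq))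
      (ℕ.<-≤-trans (ℕ.≤-trans 0<h (ℕ.m≤m+n h _)) 2h≤i)

    -- Sums lie in [4h, 8h). Those below q are too large for [2h, 4h); those that wrap around land
    -- below 8h - q ≤ 2h, which is where `6h≤q` enters.
    middle-sumFree : ∀ {i j k} → 2 ℕ.* h ℕ.≤ i → i ℕ.< 4 ℕ.* h → 2 ℕ.* h ℕ.≤ j → j ℕ.< 4 ℕ.* h → 2 ℕ.* h ℕ.≤ k → k ℕ.< 4 ℕ.* h →
      [ i ] ⊕ [ j ] ≢ [ k ]
    middle-sumFree {i} {j} {k} 2h≤i i<4h 2h≤j j<4h 2h≤k k<4h eq with ℕ.<-≤-connex (i ℕ.+ j) q
    ... | inj₁ i+j<q = contradiction (subst (ℕ._< 4 ℕ.* h) (sym (π-+-injective i+j<q (ℕ.<-≤-trans k<4h 4h≤q) (trans (π-+ (+ i) (+ j)) eq))) k<4h)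
            (ℕ.≤⇒≯ (ℕ.≤-trans (ℕ.≤-reflexive (ℕ.*-distribʳ-+ h 2 2)) (ℕ.+-mono-≤ 2h≤i 2h≤j)))
    ... | inj₂ q≤i+j = contradiction (subst (2 ℕ.* h ℕ.≤_) (sym m≡k) 2h≤k) (ℕ.<⇒≱ m<2h)
      where
      m = i ℕ.+ j ℕ.∸ q
      m+q≡ : m ℕ.+ q ≡ i ℕ.+ j
      m+q≡ = ℕ.m∸n+n≡m q≤i+j
      m<2h : m ℕ.< 2 ℕ.* h
      m<2h = ℕ.+-cancelʳ-< q m (2 ℕ.* h) (begin-strict
        m ℕ.+ q               ≡⟨ m+q≡ ⟩
        i ℕ.+ j               <⟨ ℕ.+-mono-< i<4h j<4h ⟩
        4 ℕ.* h ℕ.+ 4 ℕ.* h   ≡⟨ e h ⟩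
        2 ℕ.* h ℕ.+ 6 ℕ.* h   ≤⟨ ℕ.+-monoʳ-≤ (2 ℕ.* h) 6h≤q ⟩
        2 ℕ.* h ℕ.+ q         ∎)
        where
        open ℕ.≤-Reasoning
        e : ∀ h → 4 ℕ.* h ℕ.+ 4 ℕ.* h ≡ 2 ℕ.* h ℕ.+ 6 ℕ.* h
        e = ℕSolver.solve-∀
      m≡k : m ≡ k
      m≡k = π-+-injective (ℕ.<-≤-trans m<2h (ℕ.≤-trans (ℕ.*-monoˡ-≤ h {2} {6} (s≤s (s≤s z≤n))) 6h≤q)) (ℕ.<-≤-trans k<4h 4h≤q) (begin
        π (+ m)           ≡⟨ π-cong { + m} { + (i ℕ.+ j)} (- 1ℤ , trans (e (+ m) (+ q)) (cong (λ x → + x + - 1ℤ * + q) m+q≡)) ⟩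
        π (+ (i ℕ.+ j))   ≡⟨ π-+ (+ i) (+ j) ⟩
        [ i ] ⊕ [ j ]     ≡⟨ eq ⟩
        [ k ]             ∎)
        where
        open ≡-Reasoning
        e : ∀ m q → m ≡ m + q + - 1ℤ * q
        e = ℤ.solve-∀

    AddEq⇒⊕ : ∀ {x y z} → AddEq p x y z → x Zp.⊕ y ≡ z
    AddEq⇒⊕ {x} {y} {z} add = trans (cong₂ Zp._⊕_ (sym (Zp.π-ι x)) (sym (Zp.π-ι y))) (trans (sym (Zp.π-+ (Zp.ι x) (Zp.ι y)))
      (trans (Zp.π-cong (congruent add)) (Zp.π-ι z)))
      where
      congruent : AddEq p x y z → Zp.ι x + Zp.ι y Zp.≋ Zp.ι z
      congruent (inj₁ eq) = 0ℤ , trans (cong +_ eq) (sym (ℤ.+-identityʳ (Zp.ι z)))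
      congruent (inj₂ eq) = 1ℤ , trans (cong +_ eq) (cong (λ t → Zp.ι z + t) (sym (ℤ.*-identityˡ (+ p))))

    ⊕⇒AddEq : ∀ {x y z} → x Zp.⊕ y ≡ z → AddEq p x y z
    ⊕⇒AddEq {x} {y} {z} eq with ℕ.<-≤-connex (toℕ x ℕ.+ toℕ y) p
    ... | inj₁ x+y<p = inj₁ (i+kn≡j⇒i≡j (proj₁ x+y≋z) x+y<p (Fin.toℕ<n z) (proj₂ x+y≋z))
      where
      x+y≋z : + (toℕ x ℕ.+ toℕ y) Zp.≋ Zp.ι z
      x+y≋z = Zp.π-injective (trans (Zp.π-+ (Zp.ι x) (Zp.ι y)) (trans (cong₂ Zp._⊕_ (Zp.π-ι x) (Zp.π-ι y)) (trans eq (sym (Zp.π-ι z)))))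
    ... | inj₂ p≤x+y = inj₂ (trans (sym m+p≡) (cong (ℕ._+ p) (i+kn≡j⇒i≡j (proj₁ x+y≋z - 1ℤ) m<p (Fin.toℕ<n z) m≡)))
      where
      m = toℕ x ℕ.+ toℕ y ℕ.∸ p
      m+p≡ : m ℕ.+ p ≡ toℕ x ℕ.+ toℕ y
      m+p≡ = ℕ.m∸n+n≡m p≤x+y
      m<p : m ℕ.< p
      m<p = ℕ.+-cancelʳ-< p m p (ℕ.≤-<-trans (ℕ.≤-reflexive m+p≡) (ℕ.+-mono-< (Fin.toℕ<n x) (Fin.toℕ<n y)))
      x+y≋z : + (toℕ x ℕ.+ toℕ y) Zp.≋ Zp.ι z
      x+y≋z = Zp.π-injective (trans (Zp.π-+ (Zp.ι x) (Zp.ι y)) (trans (cong₂ Zp._⊕_ (Zp.π-ι x) (Zp.π-ι y)) (trans eq (sym (Zp.π-ι z)))))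
      m≡ : + m ≡ + toℕ z + (proj₁ x+y≋z - 1ℤ) * + p
      m≡ = trans (e₁ (+ m) (+ p)) (trans (cong (_- + p) (trans (cong +_ m+p≡) (proj₂ x+y≋z))) (e₂ (+ toℕ z) (proj₁ x+y≋z) (+ p)))
        where
        e₁ : ∀ m p → m ≡ m + p - p
        e₁ = ℤ.solve-∀
        e₂ : ∀ z k p → z + k * p - p ≡ z + (k - 1ℤ) * p
        e₂ = ℤ.solve-∀

    -- By `digits-unique` a relation modulo p holds digit by digit, up to a multiple of q in the
    -- leading digit. It is therefore a relation modulo q between three points of `S`; `curve-sum`
    -- turns it into one between their scalars, and `middle-sumFree` excludes that.
    Member-sumFree : ∀ {x y z} → Member x → Member y → Member z → x Zp.⊕ y ≢ z
    Member-sumFree {x} {y} {z} (i , u , a , b , c , w , 2h≤i , u≢0 , s≡ , x≡) (i′ , u′ , a′ , b′ , c′ , w′ , 2h≤i′ , u′≢0 , s′≡ , y≡)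
      (i″ , u″ , a″ , b″ , c″ , w″ , 2h≤i″ , u″≢0 , s″≡ , z≡) x+y≡z =
      middle-sumFree 2h≤i (Fin.toℕ<n i) 2h≤i′ (Fin.toℕ<n i′) 2h≤i″ (Fin.toℕ<n i″)
        (curve-sum ([]≢0 2h≤i (Fin.toℕ<n i)) ([]≢0 2h≤i′ (Fin.toℕ<n i′)) ([]≢0 2h≤i″ (Fin.toℕ<n i″)) u≢0 u′≢0 u″≢0
          (coordinate a a′ a″ (k , proj₁ unique) (cong proj₁ s≡) (cong proj₁ s′≡) (cong proj₁ s″≡))
          (coordinate b b′ b″ (0ℤ , proj₁ (proj₂ unique)) (cong (proj₁ ∘ proj₂) s≡) (cong (proj₁ ∘ proj₂) s′≡) (cong (proj₁ ∘ proj₂) s″≡))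
          (coordinate c c′ c″ (0ℤ , proj₁ (proj₂ (proj₂ unique))) (cong (proj₂ ∘ proj₂) s≡) (cong (proj₂ ∘ proj₂) s′≡) (cong (proj₂ ∘ proj₂) s″≡)))
      where
      v = value (digit a) (digit b) (digit c) (+ toℕ w)
      v′ = value (digit a′) (digit b′) (digit c′) (+ toℕ w′)
      v″ = value (digit a″) (digit b″) (digit c″) (+ toℕ w″)
      v+v′≋v″ : v + v′ Zp.≋ v″
      v+v′≋v″ = Zp.π-injective (trans (Zp.π-+ v v′) (trans (cong₂ Zp._⊕_ x≡ y≡) (trans x+y≡z (sym z≡))))
      k = proj₁ v+v′≋v″
      ∣w+w′-w″∣< : ∣ + toℕ w + + toℕ w′ - + toℕ w″ ∣ ℕ.< 2 ℕ.* W
      ∣w+w′-w″∣< with ℕ.≤-total (toℕ w″) (toℕ w ℕ.+ toℕ w′)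
      ... | inj₁ le = ℕ.≤-<-trans (ℕ.≤-trans (ℕ.≤-reflexive (cong ∣_∣ (trans (ℤ.m-n≡m⊖n (toℕ w ℕ.+ toℕ w′) (toℕ w″)) (ℤ.⊖-≥ le)))) (ℕ.m∸n≤m (toℕ w ℕ.+ toℕ w′) (toℕ w″)))
                        (ℕ.<-≤-trans (ℕ.+-mono-< (Fin.toℕ<n w) (Fin.toℕ<n w′)) (ℕ.≤-reflexive (cong (W ℕ.+_) (sym (ℕ.+-identityʳ W)))))
      ... | inj₂ ge = ℕ.≤-<-trans (ℕ.≤-trans (ℕ.≤-reflexive (trans (cong ∣_∣ (ℤ.m-n≡m⊖n (toℕ w ℕ.+ toℕ w′) (toℕ w″))) (ℤ.∣⊖∣-≤ ge))) (ℕ.m∸n≤m (toℕ w″) (toℕ w ℕ.+ toℕ w′)))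
                        (ℕ.<-≤-trans (Fin.toℕ<n w″) (ℕ.m≤m+n W _))
      unique = digits-unique (digit a + digit a′ - digit a″) (digit b + digit b′ - digit b″) (digit c + digit c′ - digit c″)
        (+ toℕ w + + toℕ w′ - + toℕ w″) k (∣a+b-c∣≤ a a′ a″) (∣a+b-c∣≤ b b′ b″) (∣a+b-c∣≤ c c′ c″) ∣w+w′-w″∣< (begin
          value (digit a + digit a′ - digit a″) (digit b + digit b′ - digit b″) (digit c + digit c′ - digit c″) (+ toℕ w + + toℕ w′ - + toℕ w″)
            ≡⟨ linear (+ P) (+ D) (+ M) (digit a) (digit b) (digit c) (+ toℕ w) (digit a′) (digit b′) (digit c′) (+ toℕ w′) (digit a″) (digit b″) (digit c″) (+ toℕ w″) ⟩
          v + v′ - v″             ≡⟨ cong (_- v″) (proj₂ v+v′≋v″) ⟩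
          v″ + k * + p - v″       ≡⟨ e v″ (k * + p) ⟩
          k * + p                 ∎)
        where
        open ≡-Reasoning
        e : ∀ v r → v + r - v ≡ r
        e = ℤ.solve-∀
        linear : ∀ P D M a b c w a′ b′ c′ w′ a″ b″ c″ w″ →
          (a + a′ - a″) * P + ((b + b′ - b″) * D + ((c + c′ - c″) * M + (w + w′ - w″))) ≡
          (a * P + (b * D + (c * M + w))) + (a′ * P + (b′ * D + (c′ * M + w′))) - (a″ * P + (b″ * D + (c″ * M + w″)))
        linear = ℤ.solve-∀
      coordinate : ∀ a a′ a″ {r r′ r″} → (∃ λ k → digit a + digit a′ - digit a″ ≡ k * + q) → π (digit a) ≡ r → π (digit a′) ≡ r′ → π (digit a″) ≡ r″ → r ⊕ r′ ≡ r″
      coordinate a a′ a″ (k , eq) refl refl refl = trans (sym (π-+ (digit a) (digit a′))) (π-cong (k , trans (e (digit a + digit a′) (digit a″)) (cong (λ t → digit a″ + t) eq)))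
        where
        e : ∀ s d → s ≡ d + (s - d)
        e = ℤ.solve-∀

    A-solutionFree : SolutionFree p A
    A-solutionFree x y z x∈A y∈A z∈A _ _ _ add =
      Member-sumFree (∈-subset⁻ Member? x∈A) (∈-subset⁻ Member? y∈A) (∈-subset⁻ Member? z∈A) (AddEq⇒⊕ add)

    embed : V → ℤ → ℤ
    embed (a , b , c) = value (ι a) (ι b) (ι c)

    -- This copy of F_q³ is not additive, since coordinates are reduced modulo q before they become
    -- digits. The differences of its points nevertheless have digits in (-q, q) with the right
    -- residues, and this is all that membership in `A` asks for.
    lattice : V → Fin p
    lattice v = Zp.π (embed v 0ℤ)

    0<W : 0 ℕ.< W
    0<W = ℕ.*-cancelˡ-< 2 0 W (ℕ.<-≤-trans (ℕ.≤-<-trans z≤n (prime>1 q-prime)) (ℕ.≤-trans (ℕ.m≤m+n q (2 ℕ.* q)) 3q≤2W))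

    value-difference : ∀ P D M a b c w a′ b′ c′ w′ →
      (a - a′) * P + ((b - b′) * D + ((c - c′) * M + (w - w′))) ≡ (a * P + (b * D + (c * M + w))) - (a′ * P + (b′ * D + (c′ * M + w′)))
    value-difference = ℤ.solve-∀

    difference : Fin p → Fin p → Fin p
    difference u v = v Zp.⊕ Zp.⊖ u

    ι-difference : ∀ x z → ∃ λ a → digit a ≡ ι z - ι x × π (digit a) ≡ z ⊕ ⊖ x
    ι-difference x z with ∃digit {toℕ z} {toℕ x} (Fin.toℕ<n z) (ℕ.<⇒≤ (Fin.toℕ<n x))
    ... | a , eq = a , eq , trans (cong π eq) (trans (π-+ (ι z) (- ι x)) (cong₂ _⊕_ (π-ι z) (trans (π-neg (ι x)) (cong ⊖_ (π-ι x)))))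

    lattice-difference-∈ : ∀ x y i → 2 ℕ.* h ℕ.≤ i → i ℕ.< 4 ℕ.* h → y ≢ 0F →
      difference (lattice x) (lattice (x +ᵥ [ i ] • curve y)) ∈ A
    lattice-difference-∈ x@(x₁ , x₂ , x₃) y i 2h≤i i<4h y≢0 = ∈-subset⁺ Member?
      (fromℕ< i<4h , y , proj₁ d₁ , proj₁ d₂ , proj₁ d₃ , fromℕ< 0<W , subst (2 ℕ.* h ℕ.≤_) (sym i≡) 2h≤i , y≢0 ,
        trans (cong₂ _,_ (proj₂ (proj₂ d₁)) (cong₂ _,_ (proj₂ (proj₂ d₂)) (proj₂ (proj₂ d₃)))) (trans (cong₂ _,_ (e x₁ s₁) (cong₂ _,_ (e x₂ s₂) (e x₃ s₃))) (cong (λ t → [ t ] • curve y) (sym i≡))) ,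
        (begin
          Zp.π (value (digit (proj₁ d₁)) (digit (proj₁ d₂)) (digit (proj₁ d₃)) (+ toℕ (fromℕ< 0<W)))
            ≡⟨ cong Zp.π (cong₂ (λ a t → a * + P + t) (proj₁ (proj₂ d₁)) (cong₂ (λ b t → b * + D + t) (proj₁ (proj₂ d₂)) (cong₂ (λ c t → c * + M + t) (proj₁ (proj₂ d₃)) (cong +_ (Fin.toℕ-fromℕ< 0<W))))) ⟩
          Zp.π (value (ι z₁ - ι x₁) (ι z₂ - ι x₂) (ι z₃ - ι x₃) (0ℤ - 0ℤ))
            ≡⟨ cong Zp.π (value-difference (+ P) (+ D) (+ M) (ι z₁) (ι z₂) (ι z₃) 0ℤ (ι x₁) (ι x₂) (ι x₃) 0ℤ) ⟩
          Zp.π (value (ι z₁) (ι z₂) (ι z₃) 0ℤ - value (ι x₁) (ι x₂) (ι x₃) 0ℤ)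
            ≡⟨ trans (Zp.π-+ (value (ι z₁) (ι z₂) (ι z₃) 0ℤ) (- value (ι x₁) (ι x₂) (ι x₃) 0ℤ)) (cong (λ t → Zp.π (value (ι z₁) (ι z₂) (ι z₃) 0ℤ) Zp.⊕ t) (Zp.π-neg (value (ι x₁) (ι x₂) (ι x₃) 0ℤ))) ⟩
          difference (lattice x) (lattice (z₁ , z₂ , z₃)) ∎))
      where
      open ≡-Reasoning
      i≡ = Fin.toℕ-fromℕ< i<4h
      s₁ = [ i ] ⊗ y
      s₂ = [ i ] ⊗ (y ⊗ y)
      s₃ = [ i ] ⊗ (y ⊗ y ⊗ y)
      z₁ = x₁ ⊕ s₁
      z₂ = x₂ ⊕ s₂
      z₃ = x₃ ⊕ s₃
      d₁ = ι-difference x₁ z₁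
      d₂ = ι-difference x₂ z₂
      d₃ = ι-difference x₃ z₃
      e : ∀ x s → x ⊕ s ⊕ ⊖ x ≡ s
      e = solve 2 (λ x s → x :+ s :+ (:- x) := s) refl where open Solver using (solve; _:=_; _:+_; :-_)

    ∣ι-ι∣≤ : ∀ x z → ∣ ι z - ι x ∣ ℕ.≤ 3 ℕ.* q
    ∣ι-ι∣≤ x z = subst (λ d → ∣ d ∣ ℕ.≤ 3 ℕ.* q) (proj₁ (proj₂ (ι-difference x z))) (∣digit∣≤3q (proj₁ (ι-difference x z)))

    lattice-cancel : ∀ x z (w w′ : Fin W) → Zp.π (embed z (+ toℕ w)) ≡ Zp.π (embed x (+ toℕ w′)) → z ≡ x × w ≡ w′
    lattice-cancel (x₁ , x₂ , x₃) (z₁ , z₂ , z₃) w w′ eq =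
      cong₂ _,_ z₁≡x₁ (cong₂ _,_ (Fin-≡ (proj₁ (proj₂ unique))) (Fin-≡ (proj₁ (proj₂ (proj₂ unique))))) ,
      Fin.toℕ-injective (ℤ.+-injective (ℤ.i-j≡0⇒i≡j (+ toℕ w) (+ toℕ w′) (trans (proj₂ (proj₂ (proj₂ unique))) (cong (_* + ρ) k≡0))))
      where
      v≋v′ = Zp.π-injective eq
      k = proj₁ v≋v′
      v = value (ι z₁) (ι z₂) (ι z₃) (+ toℕ w)
      v′ = value (ι x₁) (ι x₂) (ι x₃) (+ toℕ w′)
      ∣w-w′∣< : ∣ + toℕ w - + toℕ w′ ∣ ℕ.< 2 ℕ.* W
      ∣w-w′∣< = ℕ.≤-<-trans (ℤ.∣i-j∣≤∣i∣+∣j∣ (+ toℕ w) (+ toℕ w′)) (ℕ.<-≤-trans (ℕ.+-mono-< (Fin.toℕ<n w) (Fin.toℕ<n w′)) (ℕ.≤-reflexive (cong (W ℕ.+_) (sym (ℕ.+-identityʳ W)))))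
      unique = digits-unique (ι z₁ - ι x₁) (ι z₂ - ι x₂) (ι z₃ - ι x₃) (+ toℕ w - + toℕ w′) k (∣ι-ι∣≤ x₁ z₁) (∣ι-ι∣≤ x₂ z₂) (∣ι-ι∣≤ x₃ z₃) ∣w-w′∣<
        (trans (value-difference (+ P) (+ D) (+ M) (ι z₁) (ι z₂) (ι z₃) (+ toℕ w) (ι x₁) (ι x₂) (ι x₃) (+ toℕ w′))
          (trans (cong (_- v′) (proj₂ v≋v′)) (e v′ (k * + p))))
        where
        e : ∀ v r → v + r - v ≡ r
        e = ℤ.solve-∀
      Fin-≡ : ∀ {a b : F} → ι a - ι b ≡ 0ℤ → a ≡ b
      Fin-≡ {a} {b} eq = Fin.toℕ-injective (ℤ.+-injective (ℤ.i-j≡0⇒i≡j (ι a) (ι b) eq))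
      z₁≡x₁ : z₁ ≡ x₁
      z₁≡x₁ = ι-≋⇒≡ (k , trans (e (ι z₁) (ι x₁)) (cong (λ t → ι x₁ + t) (proj₁ unique)))
        where
        e : ∀ z x → z ≡ x + (z - x)
        e = ℤ.solve-∀
      -- The lowest digits have been compared only up to k ρ. Both leading digits lie in [0, q) and
      -- differ by k q, so `k` vanishes.
      k≡0 : k ≡ 0ℤ
      k≡0 = [ (λ k≡0 → k≡0) , (λ q≡0 → contradiction (ℤ.+-injective q≡0) (ℕ.m<n⇒n≢0 (prime>1 q-prime))) ]′
        (ℤ.i*j≡0⇒i≡0∨j≡0 k {+ q} (trans (sym (proj₁ unique)) (ℤ.i≡j⇒i-j≡0 (cong ι z₁≡x₁))))

    independent-transfer : ∀ I → Independent p A I → ∀ t x y i → 2 ℕ.* h ℕ.≤ i → i ℕ.< 4 ℕ.* h → y ≢ 0F →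
      t Zp.⊕ lattice x ∈ I → ¬ (t Zp.⊕ lattice (x +ᵥ [ i ] • curve y) ∈ I)
    independent-transfer I indep t x y i 2h≤i i<4h y≢0 u∈I v∈I = indep u v u∈I v∈I u≢v
      (difference (lattice x) (lattice z) , lattice-difference-∈ x y i 2h≤i i<4h y≢0 , ⊕⇒AddEq u+d≡v)
      where
      z = x +ᵥ [ i ] • curve y
      u = t Zp.⊕ lattice x
      v = t Zp.⊕ lattice z
      u+d≡v : u Zp.⊕ difference (lattice x) (lattice z) ≡ v
      u+d≡v = solve 3 (λ t a b → t :+ a :+ (b :+ (:- a)) := t :+ b) refl t (lattice x) (lattice z) where open Zp.Solver using (solve; _:=_; _:+_; :-_)
      cancel : u ≡ v → lattice z ≡ lattice x
      cancel eq = trans (solve 2 (λ t b → b := t :+ b :+ (:- t)) refl t (lattice z)) (trans (cong (Zp._⊕ Zp.⊖ t) (sym eq)) (solve 2 (λ t b → t :+ b :+ (:- t) := b) refl t (lattice x)))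
        where open Zp.Solver using (solve; _:=_; _:+_; :-_)
      lattice≡ : ∀ a → lattice a ≡ Zp.π (embed a (+ toℕ (fromℕ< 0<W)))
      lattice≡ a = cong (λ w → Zp.π (embed a (+ w))) (sym (Fin.toℕ-fromℕ< 0<W))
      -- `Independent` speaks of distinct vertices only. If the two coincided, then the shift would
      -- vanish in its first coordinate i y, a product of nonzero factors.
      u≢v : u ≢ v
      u≢v eq = ⊗-≢0 ([]≢0 2h≤i i<4h) y≢0 (shift≡0 (cong proj₁ (proj₁ (lattice-cancel x z (fromℕ< 0<W) (fromℕ< 0<W)
        (trans (sym (lattice≡ z)) (trans (cancel eq) (lattice≡ x)))))))
        where
        open Solver using (solve; _:=_; _:+_; :-_)
        shift≡0 : ∀ {a s} → a ⊕ s ≡ a → s ≡ 0F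
        shift≡0 {a} {s} eq = trans (solve 2 (λ a s → s := a :+ s :+ (:- a)) refl a s) (≡⇒⊕⊖≡0 eq)

    ∑-Zp-translate : ∀ a (f : Fin p → ℤ) → ∑[ t ∈ allFin p ] f (t Zp.⊕ a) ≡ ∑ (allFin p) f
    ∑-Zp-translate a = ∑-bijection (Fin-finite p) (Fin-finite p) (Zp._⊕ a) (Zp._⊕ Zp.⊖ a)
      (λ x → solve 2 (λ x a → x :+ a :+ (:- a) := x) refl x a) (λ x → solve 2 (λ x a → x :+ (:- a) :+ a := x) refl x a)
      where open Zp.Solver using (solve; _:=_; _:+_; :-_)

    -- Averaging over the translates of the lattice: every translate pulls `I` back to a set in F_q³
    -- to which `independent-≤` applies, and every lattice point runs through each element of `I`
    -- exactly once, so the p translates meet `I` in q³ |I| points altogether.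
    A-independent-≤ : ∀ I → Independent p A I → (Q - + 2) * (H * + Subset.∣ I ∣) ≤ + 3 * (Q * + p)
    A-independent-≤ I indep = ℤ.*-cancelʳ-≤-pos _ _ (Q * (Q * Q)) {{Q³-positive}} (begin
      (Q - + 2) * (H * + Subset.∣ I ∣) * (Q * (Q * Q))
        ≡⟨ e₁ (Q - + 2) H (+ Subset.∣ I ∣) Q ⟩
      (Q - + 2) * (H * (Q * (Q * (Q * + Subset.∣ I ∣))))
        ≡⟨ cong (λ s → (Q - + 2) * (H * s)) (∑-Vs-const (+ Subset.∣ I ∣)) ⟨
      (Q - + 2) * (H * (∑[ x ∈ Vs ] + Subset.∣ I ∣))
        ≡⟨ cong (λ s → (Q - + 2) * (H * s)) (trans (∑-comm (allFin p) Vs _) (∑-cong Vs (λ x → trans (∑-Zp-translate (lattice x) (λ t → ⟦ t ∈? I ⟧)) (∑-∈ I)))) ⟨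
      (Q - + 2) * (H * (∑[ t ∈ allFin p ] ∑[ x ∈ Vs ] ⟦ t Zp.⊕ lattice x ∈? I ⟧))
        ≡⟨ trans (∑-*ˡ (allFin p) (Q - + 2) _) (cong ((Q - + 2) *_) (∑-*ˡ (allFin p) H _)) ⟨
      ∑[ t ∈ allFin p ] (Q - + 2) * (H * (∑[ x ∈ Vs ] ⟦ t Zp.⊕ lattice x ∈? I ⟧))
        ≤⟨ ∑-mono (allFin p) (λ t → independent-≤ (λ x → (t Zp.⊕ lattice x) ∈? I) (independent-transfer I indep t)) ⟩
      ∑[ t ∈ allFin p ] + 3 * (Q * Q * (Q * Q))
        ≡⟨ trans (∑-const (allFin p) _) (cong (λ l → + l * (+ 3 * (Q * Q * (Q * Q)))) (List.length-tabulate {n = p} (λ x → x))) ⟩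
      + p * (+ 3 * (Q * Q * (Q * Q)))
        ≡⟨ e₂ (+ p) Q ⟩
      + 3 * (Q * + p) * (Q * (Q * Q)) ∎)
      where
      open ℤ.≤-Reasoning
      e₁ : ∀ a h i q → a * (h * i) * (q * (q * q)) ≡ a * (h * (q * (q * (q * i))))
      e₁ = ℤ.solve-∀
      e₂ : ∀ p q → p * (+ 3 * (q * q * (q * q))) ≡ + 3 * (q * p) * (q * (q * q))
      e₂ = ℤ.solve-∀
      Q³-positive : ℤ.Positive (Q * (Q * Q))
      Q³-positive = subst ℤ.Positive (trans (ℤ.pos-* q (q ℕ.* q)) (cong (Q *_) (ℤ.pos-* q q)))
        (ℤ.positive (ℤ.+<+ (ℕ.>-nonZero⁻¹ (q ℕ.* (q ℕ.* q)) {{ℕ.m*n≢0 q (q ℕ.* q) {{q≢0}} {{ℕ.m*n≢0 q q}}}})))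

    -- Only members with digits in [0, q) are counted, one for each scalar, nonzero parameter and
    -- lowest digit. `lattice-cancel` recovers the point and the lowest digit, `curve-unique` the
    -- scalar and the parameter.
    A-size : 2 ℕ.* h ℕ.* (ℕ.pred q ℕ.* W) ℕ.≤ Subset.∣ A ∣
    A-size = injection⇒≤∣∣ (φ ∘ decode) (decode-injective ∘ φ-injective) A (φ∈A ∘ decode)
      where
      Index : Set
      Index = Fin (2 ℕ.* h) × Fin (ℕ.pred q) × Fin W
      decode : Fin (2 ℕ.* h ℕ.* (ℕ.pred q ℕ.* W)) → Index
      decode n = proj₁ (Fin.remQuot (ℕ.pred q ℕ.* W) n) , Fin.remQuot {ℕ.pred q} W (proj₂ (Fin.remQuot {2 ℕ.* h} (ℕ.pred q ℕ.* W) n))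
      decode-injective : ∀ {m n} → decode m ≡ decode n → m ≡ n
      decode-injective {m} {n} eq = trans (sym (Fin.combine-remQuot {2 ℕ.* h} (ℕ.pred q ℕ.* W) m)) (trans (cong₂ Fin.combine (cong proj₁ eq)
        (trans (sym (Fin.combine-remQuot {ℕ.pred q} W _)) (trans (cong (λ r → Fin.combine (proj₁ (proj₂ r)) (proj₂ (proj₂ r))) eq) (Fin.combine-remQuot {ℕ.pred q} W _))))
        (Fin.combine-remQuot {2 ℕ.* h} (ℕ.pred q ℕ.* W) n))
      scalar : Fin (2 ℕ.* h) → ℕ
      scalar i = 2 ℕ.* h ℕ.+ toℕ i
      scalar<4h : ∀ i → scalar i ℕ.< 4 ℕ.* h
      scalar<4h i = ℕ.<-≤-trans (ℕ.+-monoʳ-< (2 ℕ.* h) (Fin.toℕ<n i)) (ℕ.≤-reflexive (sym (ℕ.*-distribʳ-+ h 2 2)))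
      scalar≢0 : ∀ i → [ scalar i ] ≢ 0F
      scalar≢0 i = []≢0 (ℕ.m≤m+n (2 ℕ.* h) (toℕ i)) (scalar<4h i)
      parameter : Fin (ℕ.pred q) → F
      parameter y = π (+ suc (toℕ y))
      suc<q : ∀ (y : Fin (ℕ.pred q)) → suc (toℕ y) ℕ.< q
      suc<q y = ℕ.<-≤-trans (s≤s (Fin.toℕ<n y)) (ℕ.≤-reflexive (ℕ.suc-pred q))
      parameter≢0 : ∀ y → parameter y ≢ 0F
      parameter≢0 y eq = ℕ.1+n≢0 (π-+-injective (suc<q y) (ℕ.≤-<-trans z≤n (prime>1 q-prime)) eq)
      point : Index → V
      point (i , y , _) = [ scalar i ] • curve (parameter y)
      φ : Index → Fin p
      φ r = Zp.π (embed (point r) (+ toℕ (proj₂ (proj₂ r))))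
      φ-injective : ∀ {r r′} → φ r ≡ φ r′ → r ≡ r′
      φ-injective {i , y , w} {i′ , y′ , w′} eq = cong₂ _,_
        (Fin.toℕ-injective (ℕ.+-cancelˡ-≡ (2 ℕ.* h) _ _ (π-+-injective (ℕ.<-≤-trans (scalar<4h i) 4h≤q) (ℕ.<-≤-trans (scalar<4h i′) 4h≤q) (proj₁ same))))
        (cong₂ _,_ (Fin.toℕ-injective (ℕ.suc-injective (π-+-injective (suc<q y) (suc<q y′) (proj₂ same)))) (proj₂ cancelled))
        where
        cancelled = lattice-cancel (point (i′ , y′ , w′)) (point (i , y , w)) w w′ eq
        same = curve-unique (scalar≢0 i) (parameter≢0 y) (cong proj₁ (proj₁ cancelled)) (cong (proj₁ ∘ proj₂) (proj₁ cancelled))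
      ι-digit : ∀ s → ∃ λ a → digit a ≡ ι s
      ι-digit s with ∃digit {toℕ s} {0} (Fin.toℕ<n s) z≤n
      ... | a , eq = a , trans eq (ℤ.+-identityʳ (ι s))
      φ∈A : ∀ r → φ r ∈ A
      φ∈A r@(i , y , w) = ∈-subset⁺ Member? (fromℕ< (scalar<4h i) , parameter y , proj₁ d₁ , proj₁ d₂ , proj₁ d₃ , w ,
          subst (2 ℕ.* h ℕ.≤_) (sym i≡) (ℕ.m≤m+n (2 ℕ.* h) (toℕ i)) , parameter≢0 y ,
          trans (cong₂ _,_ (residue d₁) (cong₂ _,_ (residue d₂) (residue d₃))) (cong (λ t → [ t ] • curve (parameter y)) (sym i≡)) ,
          cong Zp.π (cong₂ (λ a t → a * + P + t) (proj₂ d₁) (cong₂ (λ b t → b * + D + t) (proj₂ d₂) (cong (λ c → c * + M + + toℕ w) (proj₂ d₃)))))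
        where
        i≡ = Fin.toℕ-fromℕ< (scalar<4h i)
        d₁ = ι-digit (proj₁ (point r))
        d₂ = ι-digit (proj₁ (proj₂ (point r)))
        d₃ = ι-digit (proj₂ (proj₂ (point r)))
        residue : ∀ {s} (d : ∃ λ a → digit a ≡ ι s) → π (digit (proj₁ d)) ≡ s
        residue {s} (_ , eq) = trans (cong π eq) (π-ι s)

open CayleyGraphs using (module Transfer)

open import Data.Fin.Subset using (∣_∣)
open import Data.Integer as ℤ using (+_; -[1+_]; +≤+; +<+)
import Data.Integer.Properties as ℤ
open import Data.Nat.Coprimality as Coprimality using (1-coprimeTo)
open import Data.Rational using (ℚ; mkℚ; toℚᵘ; 0ℚ; 1ℚ; _<_; _≤_; _*_; _-_; *≤*; *<*)
import Data.Rational.Properties as ℚ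
open import Data.Rational.Unnormalised as ℚᵘ using (mkℚᵘ)
import Data.Rational.Unnormalised.Properties as ℚᵘ

-- Rational inequalities cleared of denominators

toℚᵘ-ℕ→ℚ : ∀ n → toℚᵘ (ℕ→ℚ n) ≡ mkℚᵘ (+ n) 0
toℚᵘ-ℕ→ℚ n = cong toℚᵘ (ℚ.normalize-coprime {n} {0} (Coprimality.sym (1-coprimeTo n)))

ℕ→ℚ-≤-* : ∀ {m n d p} ε → toℚᵘ ε ≡ mkℚᵘ (+ n) d → m ℕ.* suc d ℕ.≤ n ℕ.* p → ℕ→ℚ m ≤ ε * ℕ→ℚ p
ℕ→ℚ-≤-* {m} {n} {d} {p} ε ε≡ le = ℚ.toℚᵘ-cancel-≤ (ℚᵘ.≤-respʳ-≃ (ℚᵘ.≃-sym (ℚ.toℚᵘ-homo-* ε (ℕ→ℚ p)))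
  (subst₂ ℚᵘ._≤_ (sym (toℚᵘ-ℕ→ℚ m)) (cong₂ ℚᵘ._*_ (sym ε≡) (sym (toℚᵘ-ℕ→ℚ p)))
    (ℚᵘ.*≤* (subst₂ ℤ._≤_
      (trans (ℤ.pos-* m (suc d)) (cong (λ x → + m ℤ.* + suc x) (sym (ℕ.*-identityʳ d))))
      (trans (ℤ.pos-* n p) (sym (ℤ.*-identityʳ (+ n ℤ.* + p))))
      (+≤+ le)))))

ℕ→ℚ-*-≤ : ∀ {m n d p k} c ε → toℚᵘ c ≡ mkℚᵘ (+ 1) k → toℚᵘ ε ≡ mkℚᵘ (+ n) d → n ℕ.* p ℕ.≤ suc k ℕ.* suc d ℕ.* m → c * ε * ℕ→ℚ p ≤ ℕ→ℚ m
ℕ→ℚ-*-≤ {m} {n} {d} {p} {k} c ε c≡ ε≡ le = ℚ.toℚᵘ-cancel-≤ (ℚᵘ.≤-respˡ-≃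
  (ℚᵘ.≃-sym (ℚᵘ.≃-trans (ℚ.toℚᵘ-homo-* (c * ε) (ℕ→ℚ p)) (ℚᵘ.*-congʳ {toℚᵘ (ℕ→ℚ p)} (ℚ.toℚᵘ-homo-* c ε))))
  (subst₂ ℚᵘ._≤_ (cong₂ ℚᵘ._*_ (cong₂ ℚᵘ._*_ (sym c≡) (sym ε≡)) (sym (toℚᵘ-ℕ→ℚ p))) (sym (toℚᵘ-ℕ→ℚ m))
    (ℚᵘ.*≤* (subst₂ ℤ._≤_
      (trans (ℤ.pos-* n p) (trans (cong (ℤ._* + p) (sym (ℤ.*-identityˡ (+ n)))) (sym (ℤ.*-identityʳ (+ 1 ℤ.* + n ℤ.* + p)))))
      (trans (cong +_ (ℕ.*-comm (suc k ℕ.* suc d) m)) (trans (ℤ.pos-* m (suc k ℕ.* suc d)) (cong (λ x → + m ℤ.* + x) (sym (ℕ.*-identityʳ (suc k ℕ.* suc d))))))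
      (+≤+ le)))))

numeratorDenominator : ∀ ε → 0ℚ < ε → ε ≤ 1ℚ → ∃ λ n → ∃ λ d → toℚᵘ ε ≡ mkℚᵘ (+ n) d × 1 ℕ.≤ n × n ℕ.≤ suc d
numeratorDenominator (mkℚ (+ zero) d _) (*<* (+<+ ())) _
numeratorDenominator (mkℚ -[1+ n ] d _) (*<* ()) _
numeratorDenominator (mkℚ (+ suc n) d _) _ (*≤* ε≤1) = suc n , d , refl , s≤s z≤n ,
  ℤ.drop‿+≤+ (subst₂ ℤ._≤_ (ℤ.*-identityʳ (+ suc n)) (ℤ.*-identityˡ (+ suc d)) ε≤1)

-- Here `δ` is the slack by which the limsup is expressed through infinitely many primes.
*-deficit-≤ : ∀ x δ p → 0ℚ < δ → (x - δ) * ℕ→ℚ p ≤ x * ℕ→ℚ p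
*-deficit-≤ x δ p 0<δ = ℚ.*-monoʳ-≤-nonNeg (ℕ→ℚ p) {{ℚ.normalize-nonNeg p 1}}
  (subst (x - δ ≤_) (ℚ.+-identityʳ x) (ℚ.+-monoʳ-≤ x (ℚ.neg-antimono-≤ (ℚ.<⇒≤ 0<δ))))

-- Choice of q and p for a given ε

n<2^n : ∀ n → n ℕ.< 2 ℕ.^ n
n<2^n zero = s≤s z≤n
n<2^n (suc n) = ℕ.≤-trans (ℕ.+-mono-≤ (ℕ.m^n>0 2 n) (n<2^n n)) (ℕ.≤-reflexive (sym (2^suc n)))

4^_ : ℕ → ℕ
4^ a = 2 ℕ.^ (a ℕ.+ a)

4^-suc : ∀ a → 4^ (suc a) ≡ 4 ℕ.* 4^ a
4^-suc a = trans (cong (2 ℕ.^_) (cong suc (ℕ.+-suc a a))) (sym (ℕ.*-assoc 2 2 (4^ a)))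

n≤4^n : ∀ n → n ℕ.≤ 4^ n
n≤4^n n = ℕ.≤-trans (ℕ.<⇒≤ (n<2^n n)) (ℕ.^-monoʳ-≤ 2 (ℕ.m≤m+n n n))

4^10≤2^20 : 4^ 10 ℕ.≤ 1048576
4^10≤2^20 = ℕ.≤ᵇ⇒≤ (4^ 10) 1048576 _

-- The bound 36 = 6 · 6 ensures that h = ⌊q/6⌋ is at least 6, so that q ≤ 6h + 6 ≤ 7h later on.
∃primeNear : ∀ a → 10 ℕ.≤ a → ∃ λ q → Prime q × q ℕ.≤ 4^ a × 4^ a ℕ.≤ 8 ℕ.* q × 36 ℕ.≤ q
∃primeNear a 10≤a = conclude (∃prime a k 10≤a (ℕ.m∸n+n≡m 3≤2a))
  where
  open ℕ.≤-Reasoning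
  k = a ℕ.+ a ℕ.∸ 3
  3≤2a : 3 ℕ.≤ a ℕ.+ a
  3≤2a = ℕ.≤-trans (ℕ.≤-trans (ℕ.m≤m+n 3 7) 10≤a) (ℕ.m≤m+n a a)
  conclude : (∃ λ q → Prime q × 2 ℕ.^ k ℕ.< q × q ℕ.≤ 2 ℕ.^ (a ℕ.+ a)) → ∃ λ q → Prime q × q ℕ.≤ 4^ a × 4^ a ℕ.≤ 8 ℕ.* q × 36 ℕ.≤ q
  conclude (q , q-prime , 2^k<q , q≤) = q , q-prime , q≤ , (begin
    2 ℕ.^ (a ℕ.+ a)   ≡⟨ cong (2 ℕ.^_) (ℕ.m+[n∸m]≡n 3≤2a) ⟨
    2 ℕ.^ (3 ℕ.+ k)   ≡⟨ ℕ.^-distribˡ-+-* 2 3 k ⟩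
    8 ℕ.* 2 ℕ.^ k     ≤⟨ ℕ.*-monoʳ-≤ 8 (ℕ.<⇒≤ 2^k<q) ⟩
    8 ℕ.* q           ∎) , (begin
    36                ≤⟨ ℕ.≤ᵇ⇒≤ 36 (2 ℕ.^ 6) _ ⟩
    2 ℕ.^ 6           ≤⟨ ℕ.^-monoʳ-≤ 2 (ℕ.∸-monoˡ-≤ 3 (ℕ.≤-trans (ℕ.≤-trans (ℕ.m≤m+n 9 1) 10≤a) (ℕ.m≤m+n a a))) ⟩
    2 ℕ.^ k           ≤⟨ ℕ.<⇒≤ 2^k<q ⟩
    q                 ∎)

-- The exponent a = 10 + 8 (N + 1) is chosen so that 8 (N + 1) ≤ a ≤ 4^a ≤ 8 p.
∃prime> : ∀ N → ∃ λ p → Prime p × N ℕ.< p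
∃prime> N = let p , p-prime , _ , 4^a≤8p , _ = ∃primeNear (10 ℕ.+ 8 ℕ.* suc N) (ℕ.m≤m+n 10 (8 ℕ.* suc N)) in
  p , p-prime , ℕ.*-cancelˡ-≤ 8 (ℕ.≤-trans (ℕ.m≤n+m (8 ℕ.* suc N) 10) (ℕ.≤-trans (n≤4^n (10 ℕ.+ 8 ℕ.* suc N)) 4^a≤8p))

first : ∀ {P : ℕ → Set} → (∀ n → Dec (P n)) → ∀ {N} → P N → P 0 ⊎ ∃ λ n → ¬ P n × P (suc n)
first P? {zero} P0 = inj₁ P0
first P? {suc N} PN with P? N
... | yes p = first P? p
... | no ¬p = inj₂ (N , ¬p , PN)

-- With ε = n/d, this finds a scale between B/ε and C/ε. At a crossing of B/ε the previous scale is
-- still too small, so growth by a factor of 4 overshoots to at most 4B/ε; if already the initial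
-- scale is large enough, then ε ≤ 1 bounds it by C/ε.
∃scale : ∀ (s : ℕ → ℕ) B C → (∀ a → s (suc a) ≡ 4 ℕ.* s a) → (∀ a → a ℕ.≤ s a) → s 0 ℕ.≤ C → 4 ℕ.* B ℕ.≤ C →
  ∀ n d → 1 ℕ.≤ n → n ℕ.≤ d → ∃ λ a → B ℕ.* d ℕ.≤ s a ℕ.* n × s a ℕ.* n ℕ.≤ C ℕ.* d
∃scale s B C growth a≤sa s0≤C 4B≤C n d 1≤n n≤d
  with first {λ a → B ℕ.* d ℕ.≤ s a ℕ.* n} (λ a → B ℕ.* d ℕ.≤? s a ℕ.* n) {B ℕ.* d}
    (ℕ.≤-trans (a≤sa (B ℕ.* d)) (ℕ.m≤m*n (s (B ℕ.* d)) n {{ℕ.>-nonZero 1≤n}}))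
... | inj₁ le = 0 , le , ℕ.*-mono-≤ s0≤C n≤d
... | inj₂ (a , ¬le , le) = suc a , le , (begin
  s (suc a) ℕ.* n       ≡⟨ cong (ℕ._* n) (growth a) ⟩
  4 ℕ.* s a ℕ.* n       ≡⟨ ℕ.*-assoc 4 (s a) n ⟩
  4 ℕ.* (s a ℕ.* n)     ≤⟨ ℕ.*-monoʳ-≤ 4 (ℕ.<⇒≤ (ℕ.≰⇒> ¬le)) ⟩
  4 ℕ.* (B ℕ.* d)       ≡⟨ ℕ.*-assoc 4 B d ⟨
  4 ℕ.* B ℕ.* d         ≤⟨ ℕ.*-monoˡ-≤ d 4B≤C ⟩
  C ℕ.* d               ∎)
  where open ℕ.≤-Reasoning

m*n≤o⇒m≤o/n : ∀ m n o .{{_ : NonZero n}} → m ℕ.* n ℕ.≤ o → m ℕ.≤ o ℕ./ n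
m*n≤o⇒m≤o/n m n o le = ℕ.≤-trans (ℕ.≤-reflexive (sym (ℕ.m*n/n≡m m n))) (ℕ./-monoˡ-≤ n le)

n<[1+n/d]*d : ∀ n d .{{_ : NonZero d}} → n ℕ.< suc (n ℕ./ d) ℕ.* d
n<[1+n/d]*d n d = ℕ.≤-<-trans (ℕ.≤-reflexive (ℕ.m≡m%n+[m/n]*n n d)) (ℕ.+-monoˡ-< (n ℕ./ d ℕ.* d) (ℕ.m%n<n n d))

-- 42 = 2 · 7 · 3, where 3 is the multiplicity of the values of the cubic, and 2 and 7 are lost in
-- passing from q - 2 and `h` to q. In the size bound the 2 is already supplied by the 2h admissible
-- scalars, which leaves 7.
sumFreeSet : ∀ q (q-prime : Prime q) h (0<h : 0 ℕ.< h) → 6 ℕ.* h ℕ.≤ q → q ℕ.≤ 7 ℕ.* h → q ℕ.≤ 2 ℕ.* (q ℕ.∸ 2) → ∀ p (p≢0 : NonZero p) W → 3 ℕ.* q ℕ.≤ 2 ℕ.* W →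
  ∀ P ρ → ρ ℕ.≤ q → p ≡ ρ ℕ.+ P ℕ.* q → 4 ℕ.* q ℕ.* (4 ℕ.* q ℕ.* (4 ℕ.* W)) ℕ.≤ P →
  Σ (Subset p) λ A → SolutionFree p A × (∀ I → Independent p A I → q ℕ.* ∣ I ∣ ℕ.≤ 42 ℕ.* p) × q ℕ.* q ℕ.* W ℕ.≤ 7 ℕ.* ∣ A ∣
sumFreeSet q q-prime h 0<h 6h≤q q≤7h q≤2[q-2] p p≢0 W 3q≤2W P ρ ρ≤q p≡ large = T.A , T.A-solutionFree , independent , size
  where
  instance
    q≢0 : NonZero q
    q≢0 = prime⇒nonZero q-prime
  open ℕ.≤-Reasoning
  module T = Transfer q q-prime h 0<h 6h≤q p {{p≢0}} W 3q≤2W P ρ ρ≤q p≡ large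
  r = q ℕ.∸ 2
  bound : ∀ I → Independent p T.A I → r ℕ.* (h ℕ.* ∣ I ∣) ℕ.≤ 3 ℕ.* (q ℕ.* p)
  bound I indep = ℤ.drop‿+≤+ (subst₂ ℤ._≤_
    (trans (cong₂ ℤ._*_ (trans (ℤ.m-n≡m⊖n q 2) (ℤ.⊖-≥ (prime>1 q-prime))) (sym (ℤ.pos-* h ∣ I ∣))) (sym (ℤ.pos-* r (h ℕ.* ∣ I ∣))))
    (trans (cong (+ 3 ℤ.*_) (sym (ℤ.pos-* q p))) (sym (ℤ.pos-* 3 (q ℕ.* p))))
    (T.A-independent-≤ I indep))
  independent : ∀ I → Independent p T.A I → q ℕ.* ∣ I ∣ ℕ.≤ 42 ℕ.* p
  independent I indep = ℕ.*-cancelˡ-≤ q (begin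
    q ℕ.* (q ℕ.* ∣ I ∣)                   ≡⟨ ℕ.*-assoc q q ∣ I ∣ ⟨
    q ℕ.* q ℕ.* ∣ I ∣                     ≤⟨ ℕ.*-monoˡ-≤ ∣ I ∣ (ℕ.*-mono-≤ q≤2[q-2] q≤7h) ⟩
    2 ℕ.* r ℕ.* (7 ℕ.* h) ℕ.* ∣ I ∣       ≡⟨ e₁ r h ∣ I ∣ ⟩
    14 ℕ.* (r ℕ.* (h ℕ.* ∣ I ∣))          ≤⟨ ℕ.*-monoʳ-≤ 14 (bound I indep) ⟩
    14 ℕ.* (3 ℕ.* (q ℕ.* p))              ≡⟨ e₂ q p ⟩
    q ℕ.* (42 ℕ.* p)                      ∎)
    where
    e₁ : ∀ r h i → 2 ℕ.* r ℕ.* (7 ℕ.* h) ℕ.* i ≡ 14 ℕ.* (r ℕ.* (h ℕ.* i))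
    e₁ = ℕSolver.solve-∀
    e₂ : ∀ q p → 14 ℕ.* (3 ℕ.* (q ℕ.* p)) ≡ q ℕ.* (42 ℕ.* p)
    e₂ = ℕSolver.solve-∀
  size : q ℕ.* q ℕ.* W ℕ.≤ 7 ℕ.* ∣ T.A ∣
  size = begin
    q ℕ.* q ℕ.* W                               ≤⟨ ℕ.*-monoˡ-≤ W (ℕ.*-mono-≤ q≤7h (ℕ.≤-trans q≤2[q-2] (ℕ.*-monoʳ-≤ 2 (ℕ.∸-monoʳ-≤ q (s≤s (z≤n {1})))))) ⟩
    7 ℕ.* h ℕ.* (2 ℕ.* (q ℕ.∸ 1)) ℕ.* W         ≡⟨ e h (q ℕ.∸ 1) W ⟩
    7 ℕ.* (2 ℕ.* h ℕ.* ((q ℕ.∸ 1) ℕ.* W))       ≤⟨ ℕ.*-monoʳ-≤ 7 T.A-size ⟩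
    7 ℕ.* ∣ T.A ∣                               ∎
    where
    e : ∀ h s W → 7 ℕ.* h ℕ.* (2 ℕ.* s) ℕ.* W ≡ 7 ℕ.* (2 ℕ.* h ℕ.* (s ℕ.* W))
    e = ℕSolver.solve-∀

∃quotient : ∀ m d k → 0 ℕ.< d → k ℕ.* d ℕ.≤ m → ∃ λ W → k ℕ.≤ W × W ℕ.* d ℕ.≤ m × m ℕ.≤ suc W ℕ.* d
∃quotient m d k 0<d kd≤m = m ℕ./ d , m*n≤o⇒m≤o/n k d m kd≤m , ℕ.m/n*n≤m m d , ℕ.<⇒≤ (n<[1+n/d]*d m d)
  where instance
    d≢0 : NonZero d
    d≢0 = ℕ.>-nonZero 0<d

-- The number of lowest digits is W = ⌊p / (64 q³)⌋, where 64 q³ is the product of the spacings 4q,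
-- 4q, 4 and of q, which accounts for the leading digit. The lower bound on p gives W ≥ 2q, hence 3q
-- ≤ 2W. Rounding W down costs at most a factor of 2, and 896 = 2 · 64 · 7.
∃sumFreeSet : ∀ q → Prime q → 36 ℕ.≤ q → ∀ p → NonZero p → 2 ℕ.* q ℕ.* (64 ℕ.* (q ℕ.* (q ℕ.* q))) ℕ.≤ p →
  Σ (Subset p) λ A → SolutionFree p A × (∀ I → Independent p A I → q ℕ.* ∣ I ∣ ℕ.≤ 42 ℕ.* p) × p ℕ.≤ 896 ℕ.* (q ℕ.* ∣ A ∣)
∃sumFreeSet q q-prime 36≤q p p≢0 2qC≤p
  with ∃quotient q 6 6 (s≤s z≤n) 36≤q | ∃quotient p (64 ℕ.* (q ℕ.* (q ℕ.* q))) (2 ℕ.* q) (ℕ.>-nonZero⁻¹ (64 ℕ.* (q ℕ.* (q ℕ.* q))) {{C≢0}}) 2qC≤p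
  where
  instance
    q≢0 : NonZero q
    q≢0 = prime⇒nonZero q-prime
  C≢0 : NonZero (64 ℕ.* (q ℕ.* (q ℕ.* q)))
  C≢0 = ℕ.m*n≢0 64 (q ℕ.* (q ℕ.* q)) {{_}} {{ℕ.m*n≢0 q (q ℕ.* q) {{q≢0}} {{ℕ.m*n≢0 q q}}}}
... | h , 6≤h , h*6≤q , q≤6+h*6 | W , 2q≤W , WC≤p , p≤C+WC =
  conclude (sumFreeSet q q-prime h (ℕ.<-≤-trans (s≤s z≤n) 6≤h) 6h≤q q≤7h q≤2[q-2] p p≢0 W 3q≤2W (p ℕ./ q) (p ℕ.% q) (ℕ.<⇒≤ (ℕ.m%n<n p q)) (ℕ.m≡m%n+[m/n]*n p q) large)
  where
  open ℕ.≤-Reasoning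
  instance
    q≢0 : NonZero q
    q≢0 = prime⇒nonZero q-prime
  6h≤q : 6 ℕ.* h ℕ.≤ q
  6h≤q = ℕ.≤-trans (ℕ.≤-reflexive (ℕ.*-comm 6 h)) h*6≤q
  q≤7h : q ℕ.≤ 7 ℕ.* h
  q≤7h = begin
    q                   ≤⟨ q≤6+h*6 ⟩
    6 ℕ.+ h ℕ.* 6       ≤⟨ ℕ.+-mono-≤ 6≤h (ℕ.≤-reflexive (ℕ.*-comm h 6)) ⟩
    7 ℕ.* h             ∎
  q≤2[q-2] : q ℕ.≤ 2 ℕ.* (q ℕ.∸ 2)
  q≤2[q-2] = begin
    q                               ≡⟨ ℕ.m+[n∸m]≡n (ℕ.≤-trans (s≤s (s≤s z≤n)) 36≤q) ⟨
    2 ℕ.+ (q ℕ.∸ 2)                 ≤⟨ ℕ.+-monoˡ-≤ (q ℕ.∸ 2) (ℕ.≤-trans (s≤s (s≤s z≤n)) (ℕ.∸-monoˡ-≤ 2 36≤q)) ⟩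
    q ℕ.∸ 2 ℕ.+ (q ℕ.∸ 2)           ≡⟨ cong (q ℕ.∸ 2 ℕ.+_) (ℕ.+-identityʳ (q ℕ.∸ 2)) ⟨
    2 ℕ.* (q ℕ.∸ 2)                 ∎
  3q≤2W : 3 ℕ.* q ℕ.≤ 2 ℕ.* W
  3q≤2W = begin
    3 ℕ.* q           ≤⟨ ℕ.*-monoˡ-≤ q {3} {4} (s≤s (s≤s (s≤s z≤n))) ⟩
    4 ℕ.* q           ≡⟨ ℕ.*-assoc 2 2 q ⟩
    2 ℕ.* (2 ℕ.* q)   ≤⟨ ℕ.*-monoʳ-≤ 2 2q≤W ⟩
    2 ℕ.* W           ∎
  large : 4 ℕ.* q ℕ.* (4 ℕ.* q ℕ.* (4 ℕ.* W)) ℕ.≤ p ℕ./ q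
  large = m*n≤o⇒m≤o/n (4 ℕ.* q ℕ.* (4 ℕ.* q ℕ.* (4 ℕ.* W))) q p (ℕ.≤-trans (ℕ.≤-reflexive (e 4 q W)) WC≤p)
    where
    e : ∀ c q W → c ℕ.* q ℕ.* (c ℕ.* q ℕ.* (c ℕ.* W)) ℕ.* q ≡ W ℕ.* (c ℕ.* c ℕ.* c ℕ.* (q ℕ.* (q ℕ.* q)))
    e = ℕSolver.solve-∀
  conclude : (Σ (Subset p) λ A → SolutionFree p A × (∀ I → Independent p A I → q ℕ.* ∣ I ∣ ℕ.≤ 42 ℕ.* p) × q ℕ.* q ℕ.* W ℕ.≤ 7 ℕ.* ∣ A ∣) →
    Σ (Subset p) λ A → SolutionFree p A × (∀ I → Independent p A I → q ℕ.* ∣ I ∣ ℕ.≤ 42 ℕ.* p) × p ℕ.≤ 896 ℕ.* (q ℕ.* ∣ A ∣)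
  conclude (A , free , independent , size) = A , free , independent , (begin
    p                                              ≤⟨ p≤C+WC ⟩
    suc W ℕ.* (64 ℕ.* (q ℕ.* (q ℕ.* q)))           ≤⟨ ℕ.*-monoˡ-≤ (64 ℕ.* (q ℕ.* (q ℕ.* q))) (ℕ.+-monoˡ-≤ W (ℕ.≤-trans (ℕ.>-nonZero⁻¹ q) (ℕ.≤-trans (ℕ.m≤m+n q (q ℕ.+ 0)) 2q≤W))) ⟩
    (W ℕ.+ W) ℕ.* (64 ℕ.* (q ℕ.* (q ℕ.* q)))       ≡⟨ e₁ 64 q W ⟩
    128 ℕ.* q ℕ.* (q ℕ.* q ℕ.* W)                  ≤⟨ ℕ.*-monoʳ-≤ (128 ℕ.* q) size ⟩
    128 ℕ.* q ℕ.* (7 ℕ.* ∣ A ∣)                    ≡⟨ e₂ 128 7 q ∣ A ∣ ⟩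
    896 ℕ.* (q ℕ.* ∣ A ∣)                          ∎)
    where
    e₁ : ∀ c q W → (W ℕ.+ W) ℕ.* (c ℕ.* (q ℕ.* (q ℕ.* q))) ≡ (c ℕ.+ c) ℕ.* q ℕ.* (q ℕ.* q ℕ.* W)
    e₁ = ℕSolver.solve-∀
    e₂ : ∀ c d q a → c ℕ.* q ℕ.* (d ℕ.* a) ≡ c ℕ.* d ℕ.* (q ℕ.* a)
    e₂ = ℕSolver.solve-∀

∃sumFree : ∀ q → Prime q → 36 ℕ.≤ q → ∀ N → ∃ λ p → p > N × Prime p × Σ (Subset p) λ A → SolutionFree p A ×
  (∀ I → Independent p A I → q ℕ.* ∣ I ∣ ℕ.≤ 42 ℕ.* p) × p ℕ.≤ 896 ℕ.* (q ℕ.* ∣ A ∣)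
∃sumFree q q-prime 36≤q N = let p , p-prime , N+T<p = ∃prime> (N ℕ.+ T) in
  p , ℕ.≤-<-trans (ℕ.m≤m+n N T) N+T<p , p-prime ,
  ∃sumFreeSet q q-prime 36≤q p (prime⇒nonZero p-prime) (ℕ.≤-trans (ℕ.m≤n+m T N) (ℕ.<⇒≤ N+T<p))
  where
  T : ℕ
  T = 2 ℕ.* q ℕ.* (64 ℕ.* (q ℕ.* (q ℕ.* q)))

-- With ε = n/d, the hypotheses on `E` give q ≥ E/e ≥ (b/e)/ε = c/ε, so that c p / q is at most ε p.
independence-arithmetic : ∀ {i n d p q E} b c e .{{_ : NonZero b}} → b ℕ.* d ℕ.≤ E ℕ.* n → E ℕ.≤ e ℕ.* q → q ℕ.* i ℕ.≤ c ℕ.* p → e ℕ.* c ≡ b →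
  i ℕ.* d ℕ.≤ n ℕ.* p
independence-arithmetic {i} {n} {d} {p} {q} {E} b c e bd≤En E≤eq qi≤cp ec≡b = ℕ.*-cancelˡ-≤ b (begin
  b ℕ.* (i ℕ.* d)             ≡⟨ e₁ b i d ⟩
  i ℕ.* (b ℕ.* d)             ≤⟨ ℕ.*-monoʳ-≤ i (ℕ.≤-trans bd≤En (ℕ.*-monoˡ-≤ n E≤eq)) ⟩
  i ℕ.* (e ℕ.* q ℕ.* n)       ≡⟨ e₂ i e q n ⟩
  e ℕ.* n ℕ.* (q ℕ.* i)       ≤⟨ ℕ.*-monoʳ-≤ (e ℕ.* n) qi≤cp ⟩
  e ℕ.* n ℕ.* (c ℕ.* p)       ≡⟨ e₃ e n c p ⟩
  e ℕ.* c ℕ.* (n ℕ.* p)       ≡⟨ cong (ℕ._* (n ℕ.* p)) ec≡b ⟩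
  b ℕ.* (n ℕ.* p)             ∎)
  where
  open ℕ.≤-Reasoning
  e₁ : ∀ a b c → a ℕ.* (b ℕ.* c) ≡ b ℕ.* (a ℕ.* c)
  e₁ = ℕSolver.solve-∀
  e₂ : ∀ i e q n → i ℕ.* (e ℕ.* q ℕ.* n) ≡ e ℕ.* n ℕ.* (q ℕ.* i)
  e₂ = ℕSolver.solve-∀
  e₃ : ∀ e n c p → e ℕ.* n ℕ.* (c ℕ.* p) ≡ e ℕ.* c ℕ.* (n ℕ.* p)
  e₃ = ℕSolver.solve-∀

-- Conversely q ≤ E ≤ C/ε, so a set of size at least p / (c q) has at least ε p / (c C) elements.
size-arithmetic : ∀ {m n d p q E} c C k → p ℕ.≤ c ℕ.* (q ℕ.* m) → q ℕ.≤ E → E ℕ.* n ℕ.≤ C ℕ.* d → c ℕ.* C ℕ.≤ k → n ℕ.* p ℕ.≤ k ℕ.* d ℕ.* m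
size-arithmetic {m} {n} {d} {p} {q} {E} c C k p≤cqm q≤E En≤Cd cC≤k = begin
  n ℕ.* p                         ≤⟨ ℕ.*-monoʳ-≤ n (ℕ.≤-trans p≤cqm (ℕ.*-monoʳ-≤ c (ℕ.*-monoˡ-≤ m q≤E))) ⟩
  n ℕ.* (c ℕ.* (E ℕ.* m))         ≡⟨ e n c E m ⟩
  c ℕ.* (E ℕ.* n) ℕ.* m           ≤⟨ ℕ.*-monoˡ-≤ m (ℕ.*-monoʳ-≤ c En≤Cd) ⟩
  c ℕ.* (C ℕ.* d) ℕ.* m           ≡⟨ cong (ℕ._* m) (ℕ.*-assoc c C d) ⟨
  c ℕ.* C ℕ.* d ℕ.* m             ≤⟨ ℕ.*-monoˡ-≤ m (ℕ.*-monoˡ-≤ d cC≤k) ⟩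
  k ℕ.* d ℕ.* m                   ∎
  where
  open ℕ.≤-Reasoning
  e : ∀ n c E m → n ℕ.* (c ℕ.* (E ℕ.* m)) ≡ c ℕ.* (E ℕ.* n) ℕ.* m
  e = ℕSolver.solve-∀

-- 336 = 8 · 42, 1048576 = 4¹⁰ and 939524096 = 896 · 4¹⁰.
∃dense : ∀ K → 939524096 ℕ.≤ K → ∀ n d → 1 ℕ.≤ n → n ℕ.≤ d → ∀ N → ∃ λ p → p > N × Prime p × Σ (Subset p) λ A → SolutionFree p A ×
  (∀ I → Independent p A I → ∣ I ∣ ℕ.* d ℕ.≤ n ℕ.* p) × n ℕ.* p ℕ.≤ K ℕ.* d ℕ.* ∣ A ∣
∃dense K ≤K n d 1≤n n≤d N =
  let a , 336d≤En , En≤Cd = ∃scale (λ a → 4^ (10 ℕ.+ a)) 336 1048576 (λ a → 4^-suc (10 ℕ.+ a)) (λ a → ℕ.≤-trans (ℕ.m≤n+m a 10) (n≤4^n (10 ℕ.+ a)))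
        4^10≤2^20 (ℕ.≤ᵇ⇒≤ 1344 1048576 _) n d 1≤n n≤d
      q , q-prime , q≤E , E≤8q , 36≤q = ∃primeNear (10 ℕ.+ a) (ℕ.m≤m+n 10 a)
      p , p>N , p-prime , A , free , independent , size = ∃sumFree q q-prime 36≤q N
  in p , p>N , p-prime , A , free ,
     (λ I indep → independence-arithmetic {∣ I ∣} {n} {d} {p} {q} {4^ (10 ℕ.+ a)} 336 42 8 336d≤En E≤8q (independent I indep) refl) ,
     size-arithmetic {∣ A ∣} {n} {d} {p} {q} {4^ (10 ℕ.+ a)} 896 1048576 K size q≤E En≤Cd ≤K

∃dense-ℚ : ∀ k → 939524096 ℕ.≤ suc k → ∀ c → toℚᵘ c ≡ mkℚᵘ (+ 1) k → (ε : ℚ) → 0ℚ < ε → ε ≤ 1ℚ → (δ : ℚ) → 0ℚ < δ → (N : ℕ) →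
  Σ ℕ (λ p → (p > N) × Prime p × Σ (Subset p) (λ A → SolutionFree p A × AlphaLe p A ε × ((c * ε - δ) * ℕ→ℚ p ≤ ℕ→ℚ ∣ A ∣)))
∃dense-ℚ k ≤k c c≡ ε 0<ε ε≤1 δ 0<δ N =
  let n , d , ε≡ , 1≤n , n≤d = numeratorDenominator ε 0<ε ε≤1
      p , p>N , p-prime , A , free , independent , size = ∃dense (suc k) ≤k n (suc d) 1≤n n≤d N
  in p , p>N , p-prime , A , free , (λ I indep → ℕ→ℚ-≤-* {∣ I ∣} {n} {d} {p} ε ε≡ (independent I indep)) ,
     ℚ.≤-trans (*-deficit-≤ (c * ε) δ p 0<δ) (ℕ→ℚ-*-≤ {∣ A ∣} {n} {d} {p} c ε c≡ ε≡ size)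

theorem4p2 : Σ ℚ (λ c → (0ℚ < c) × ((ε : ℚ) → 0ℚ < ε → ε ≤ 1ℚ →
    (δ : ℚ) → 0ℚ < δ → (N : ℕ) →
    Σ ℕ (λ p → (p > N) × Prime p × Σ (Subset p) (λ A →
    SolutionFree p A × AlphaLe p A ε ×
    ((c * ε - δ) * ℕ→ℚ p ≤ ℕ→ℚ ∣ A ∣)))))
-- The constant is 2^(-30), stored with the denominator less one: 2^30 = 8 · 2^27 is the first power
-- of two above 939524096 = 7 · 2^27.
theorem4p2 = mkℚ (+ 1) 1073741823 (1-coprimeTo 1073741824) , *<* (+<+ (s≤s z≤n)) ,
  ∃dense-ℚ 1073741823 (ℕ.≤ᵇ⇒≤ 939524096 1073741824 _) (mkℚ (+ 1) 1073741823 (1-coprimeTo 1073741824)) refl
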